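{- Let $G$ be an abelian group definable (with parameters) in $(Z,+,<)$. Then $G$ has a definable subgroup $H$ which is isomorphic as a definable group to $Z^n$ for some $n\in\mathbb{N}$, such that $G/H$ is bounded.
   Context: $Z$ denotes an $\omega$-saturated model of the complete theory of Presburger arithmetic $(\mathbb{Z},+,<)$ (a $Z$-group). A definable set $X\subseteq Z^k$ is bounded if $X\subseteq[-c,c]^k$ for some $c\in Z$. Since $Z$ has definable Skolem functions, $G/H$ can be identified with a definable set of coset representatives; "$G/H$ is bounded" means it can be represented by a bounded definable set (equivalently, no definable injection $Z\to G/H$ exists). -}

module Defs where

open import Algebra.Bundles using (AbelianGroup; RawGroup)
open import Algebra.Core using (Op₁; Op₂)
import Algebra.Construct.Pointwise as Pointwise
open import Algebra.Definitions using (Congruent₂)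
import Algebra.Morphism.GroupMonomorphism as GroupMonomorphism
open import Algebra.Morphism.Structures
  using (IsGroupMonomorphism; IsGroupIsomorphism)
open import Algebra.Structures using (IsAbelianGroup)
open import Data.Empty using () renaming (⊥ to Empty)
open import Data.Empty.Polymorphic using (⊥)
open import Data.Fin.Base using (Fin; zero; suc; _↑ˡ_; _↑ʳ_)
import Data.Integer.Base as ℤ
import Data.Integer.Properties as ℤ
open import Data.List.Base using (List)
open import Data.List.Relation.Unary.All using (All)
open import Data.Nat.Base using (ℕ; zero; suc; _+_)
open import Data.Product using (Σ; ∃-syntax; ∃!; _×_; _,_; proj₁; proj₂)
open import Data.Sum.Base using (_⊎_)
open import Data.Vec.Functional using (Vector; []; _∷_; _++_)
open import Data.Vec.Functional.Properties using (lookup-++ˡ; lookup-++ʳ)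
open import Function.Base using (id; _∘_)
open import Function.Bundles using (_⇔_; mk⇔; Equivalence)
open import Level using (Level; 0ℓ) renaming (suc to lsuc)
open import Relation.Binary.Core using (Rel)
open import Relation.Binary.Definitions using (_Respects₂_)
open import Relation.Binary.PropositionalEquality
  using (_≡_; refl; cong₂; subst₂; isEquivalence; resp₂; sym)
open import Relation.Binary.Structures using (IsEquivalence)
open import Relation.Unary using (Pred)

private
  variable
    c ℓ : Level

-- First-order formulas in the language {+, <} expanded by constants from C,
-- with n free variables (de Bruijn indices: index zero is the innermost one).

data Term (C : Set c) (n : ℕ) : Set c where
  var   : Fin n → Term C n
  const : C → Term C n
  _⊕_   : Term C n → Term C n → Term C n

data Formula (C : Set c) : ℕ → Set c where
  _≐_ _≺_     : ∀ {n} → Term C n → Term C n → Formula C n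
  falsum      : ∀ {n} → Formula C n
  _∧_ _∨_ _⇒_ : ∀ {n} → Formula C n → Formula C n → Formula C n
  all ex      : ∀ {n} → Formula C (suc n) → Formula C n

infixl 6 _⊕_
infix  5 _≐_ _≺_
infixr 4 _∧_ _∨_
infixr 3 _⇒_

Sentence : Set
Sentence = Formula Empty 0

-- Equality is a setoid equality, since Agda has no quotient types; it
-- interprets the equality symbol of the logic.

record Structure (ℓ : Level) : Set (lsuc ℓ) where
  infix  4 _≈_ _<_
  infixl 6 _+ᶻ_
  field
    Carrier       : Set ℓ
    _≈_           : Rel Carrier ℓ
    _+ᶻ_          : Op₂ Carrier
    _<_           : Rel Carrier ℓ
    ≈-isEquivalence : IsEquivalence _≈_
    +-cong        : Congruent₂ _≈_ _+ᶻ_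
    <-resp-≈      : _<_ Respects₂ _≈_

  module ≈ = IsEquivalence ≈-isEquivalence

  module Semantics {c} {C : Set c} (γ : C → Carrier) where

    ⟦_⟧ᵗ : ∀ {n} → Term C n → Vector Carrier n → Carrier
    ⟦ var i   ⟧ᵗ ρ = ρ i
    ⟦ const a ⟧ᵗ ρ = γ a
    ⟦ s ⊕ t   ⟧ᵗ ρ = ⟦ s ⟧ᵗ ρ +ᶻ ⟦ t ⟧ᵗ ρ

    ⟦_⟧ : ∀ {n} → Formula C n → Vector Carrier n → Set ℓ
    ⟦ s ≐ t  ⟧ ρ = ⟦ s ⟧ᵗ ρ ≈ ⟦ t ⟧ᵗ ρ
    ⟦ s ≺ t  ⟧ ρ = ⟦ s ⟧ᵗ ρ < ⟦ t ⟧ᵗ ρ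
    ⟦ falsum ⟧ ρ = ⊥
    ⟦ φ ∧ ψ  ⟧ ρ = ⟦ φ ⟧ ρ × ⟦ ψ ⟧ ρ
    ⟦ φ ∨ ψ  ⟧ ρ = ⟦ φ ⟧ ρ ⊎ ⟦ ψ ⟧ ρ
    ⟦ φ ⇒ ψ  ⟧ ρ = ⟦ φ ⟧ ρ → ⟦ ψ ⟧ ρ
    ⟦ all φ  ⟧ ρ = ∀ x → ⟦ φ ⟧ (x ∷ ρ)
    ⟦ ex φ   ⟧ ρ = ∃[ x ] ⟦ φ ⟧ (x ∷ ρ)

infix 2 _⊨_

_⊨_ : Structure ℓ → Sentence → Set ℓ
M ⊨ φ = Structure.Semantics.⟦_⟧ M {C = Empty} (λ ()) φ []

ℤ-structure : Structure 0ℓ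
ℤ-structure = record
  { Carrier       = ℤ.ℤ
  ; _≈_           = _≡_
  ; _+ᶻ_          = ℤ._+_
  ; _<_           = ℤ._<_
  ; ≈-isEquivalence = isEquivalence
  ; +-cong        = cong₂ ℤ._+_
  ; <-resp-≈      = resp₂ ℤ._<_
  }

-- ω-saturation: every set of formulas in one variable, over finitely many
-- parameters, that is finitely satisfiable in M is realised in M.

ω-Saturated : Structure ℓ → Set (lsuc 0ℓ Level.⊔ ℓ)
ω-Saturated M =
  ∀ {m} (a : Vector Carrier m) (p : Pred (Formula (Fin m) 1) 0ℓ) →
  let open Semantics a in
  (∀ (φs : List (Formula (Fin m) 1)) → All p φs →
    ∃[ x ] All (λ φ → ⟦ φ ⟧ (x ∷ [])) φs) →
  ∃[ x ] (∀ φ → p φ → ⟦ φ ⟧ (x ∷ []))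
  where open Structure M

private
  module Axioms where
    v₀ : ∀ {n} → Term Empty (suc n)
    v₀ = var zero

    v₁ : ∀ {n} → Term Empty (suc (suc n))
    v₁ = var (suc zero)

    v₂ : ∀ {n} → Term Empty (suc (suc (suc n)))
    v₂ = var (suc (suc zero))

    assocᶠ commᶠ inverseᶠ : Sentence
    assocᶠ   = all (all (all ((v₂ ⊕ v₁) ⊕ v₀ ≐ v₂ ⊕ (v₁ ⊕ v₀))))
    commᶠ    = all (all (v₁ ⊕ v₀ ≐ v₀ ⊕ v₁))
    inverseᶠ = ex (all (v₁ ⊕ v₀ ≐ v₀) ∧ all (ex (v₀ ⊕ v₁ ≐ v₂)))

    ℤ⊨assocᶠ : ℤ-structure ⊨ assocᶠ
    ℤ⊨assocᶠ = ℤ.+-assoc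

    ℤ⊨commᶠ : ℤ-structure ⊨ commᶠ
    ℤ⊨commᶠ = ℤ.+-comm

    ℤ⊨inverseᶠ : ℤ-structure ⊨ inverseᶠ
    ℤ⊨inverseᶠ = ℤ.0ℤ , ℤ.+-identityˡ , λ x → ℤ.- x , ℤ.+-inverseˡ x

-- A model of the complete theory of (ℤ, +, <).

record PresburgerModel (ℓ : Level) : Set (lsuc ℓ) where
  field
    structure : Structure ℓ
    models    : ∀ φ → ℤ-structure ⊨ φ → structure ⊨ φ

  open Structure structure public
  open Axioms

  private
    +-comm : ∀ x y → x +ᶻ y ≈ y +ᶻ x
    +-comm = models commᶠ ℤ⊨commᶠ

    inverse : ∃[ z ] (∀ y → z +ᶻ y ≈ y) × (∀ x → ∃[ y ] y +ᶻ x ≈ z)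
    inverse = models inverseᶠ ℤ⊨inverseᶠ

  0ᶻ : Carrier
  0ᶻ = proj₁ inverse

  private
    +-identityˡ : ∀ y → 0ᶻ +ᶻ y ≈ y
    +-identityˡ = proj₁ (proj₂ inverse)

  infix 8 -ᶻ_

  -ᶻ_ : Op₁ Carrier
  -ᶻ x = proj₁ (proj₂ (proj₂ inverse) x)

  private
    +-assoc : ∀ x y z → (x +ᶻ y) +ᶻ z ≈ x +ᶻ (y +ᶻ z)
    +-assoc = models assocᶠ ℤ⊨assocᶠ

    +-inverseˡ : ∀ x → -ᶻ x +ᶻ x ≈ 0ᶻ
    +-inverseˡ x = proj₂ (proj₂ (proj₂ inverse) x)

    inverse-unique : ∀ {x y z} → x +ᶻ y ≈ 0ᶻ → z +ᶻ x ≈ 0ᶻ → z ≈ y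
    inverse-unique {x} {y} {z} xy zx =
      ≈.trans (≈.sym (+-identityˡ z))
      (≈.trans (+-comm 0ᶻ z)
      (≈.trans (+-cong ≈.refl (≈.sym xy))
      (≈.trans (≈.sym (+-assoc z x y))
      (≈.trans (+-cong zx ≈.refl)
      (+-identityˡ y)))))

    -‿cong : ∀ {x y} → x ≈ y → -ᶻ x ≈ -ᶻ y
    -‿cong {x} {y} x≈y = inverse-unique
      (≈.trans (+-comm x (-ᶻ y))
        (≈.trans (+-cong ≈.refl x≈y) (+-inverseˡ y)))
      (+-inverseˡ x)

  +-abelianGroup : AbelianGroup ℓ ℓ
  +-abelianGroup = record
    { Carrier = Carrier
    ; _≈_     = _≈_
    ; _∙_     = _+ᶻ_
    ; ε       = 0ᶻ
    ; _⁻¹     = -ᶻ_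
    ; isAbelianGroup = record
      { isGroup = record
        { isMonoid = record
          { isSemigroup = record
            { isMagma = record
              { isEquivalence = ≈-isEquivalence
              ; ∙-cong        = +-cong
              }
            ; assoc = +-assoc
            }
          ; identity = +-identityˡ
                     , λ x → ≈.trans (+-comm x 0ᶻ) (+-identityˡ x)
          }
        ; inverse = +-inverseˡ
                  , λ x → ≈.trans (+-comm x (-ᶻ x)) (+-inverseˡ x)
        ; ⁻¹-cong = -‿cong
        }
      ; comm = +-comm
      }
    }

  infix 4 _≤_

  _≤_ : Rel Carrier ℓ
  x ≤ y = x < y ⊎ x ≈ y

module _ (Z : PresburgerModel ℓ) where

  open PresburgerModel Z
  open Semantics {C = Carrier} id

  -- A set definable with parameters is given by a formula whose constants are
  -- elements of Z.

  DefinableSet : ℕ → Set ℓ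
  DefinableSet k = Formula Carrier k

  _∈ᵈ_ : ∀ {k} → Vector Carrier k → DefinableSet k → Set ℓ
  x ∈ᵈ X = ⟦ X ⟧ x

  infix 4 _∈ᵈ_ _⊆ᵈ_

  _⊆ᵈ_ : ∀ {k} → DefinableSet k → DefinableSet k → Set ℓ
  X ⊆ᵈ Y = ∀ x → x ∈ᵈ X → x ∈ᵈ Y

  Element : ∀ {k} → DefinableSet k → Set ℓ
  Element X = ∃[ x ] x ∈ᵈ X

  -- Membership proofs are ignored.
  ElementEq : ∀ {k} (X : DefinableSet k) → Rel (Element X) ℓ
  ElementEq X (x , _) (y , _) = ∀ i → x i ≈ y i

  IsBounded : ∀ {k} → DefinableSet k → Set ℓ
  IsBounded X = ∃[ c ] (∀ x → x ∈ᵈ X → ∀ i → (-ᶻ c ≤ x i) × (x i ≤ c))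

  IsDefinableMap : ∀ {k l} (X : DefinableSet k) (Y : DefinableSet l) →
                   (Element X → Element Y) → Set ℓ
  IsDefinableMap {k} {l} X Y f =
    Σ (DefinableSet (k + l)) λ Γ →
      ∀ x y → ElementEq Y (f x) y ⇔ (proj₁ x ++ proj₁ y) ∈ᵈ Γ

  IsDefinableOp₂ : ∀ {k} (X : DefinableSet k) → Op₂ (Element X) → Set ℓ
  IsDefinableOp₂ {k} X _∙_ =
    Σ (DefinableSet (k + (k + k))) λ Γ →
      ∀ x y z → ElementEq X (x ∙ y) z ⇔
                (proj₁ x ++ (proj₁ y ++ proj₁ z)) ∈ᵈ Γ

  record DefinableAbelianGroup : Set ℓ where
    infixl 7 _∙_
    infix  8 _⁻¹
    field
      {dim}          : ℕ
      universe       : DefinableSet dim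
      _∙_            : Op₂ (Element universe)
      ε              : Element universe
      _⁻¹            : Op₁ (Element universe)
      isAbelianGroup : IsAbelianGroup (ElementEq universe) _∙_ ε _⁻¹
      ∙-definable    : IsDefinableOp₂ universe _∙_

    abelianGroup : AbelianGroup ℓ ℓ
    abelianGroup = record { isAbelianGroup = isAbelianGroup }

    open AbelianGroup abelianGroup public using (rawGroup)

  record DefinableSubgroup (G : DefinableAbelianGroup) : Set ℓ where
    open DefinableAbelianGroup G
    field
      subset    : DefinableSet dim
      subset⊆G  : subset ⊆ᵈ universe
      ∙-closed  : ∀ x y → proj₁ x ∈ᵈ subset → proj₁ y ∈ᵈ subset →
                  proj₁ (x ∙ y) ∈ᵈ subset
      ε-closed  : proj₁ ε ∈ᵈ subset
      ⁻¹-closed : ∀ x → proj₁ x ∈ᵈ subset → proj₁ (x ⁻¹) ∈ᵈ subset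

    private
      include : Element subset → Element universe
      include (x , x∈H) = x , subset⊆G x x∈H

      rawSubgroup : RawGroup ℓ ℓ
      rawSubgroup = record
        { Carrier = Element subset
        ; _≈_     = ElementEq subset
        ; _∙_     = λ x y → proj₁ (include x ∙ include y)
                          , ∙-closed (include x) (include y) (proj₂ x) (proj₂ y)
        ; ε       = proj₁ ε , ε-closed
        ; _⁻¹     = λ x → proj₁ (include x ⁻¹)
                        , ⁻¹-closed (include x) (proj₂ x)
        }

      include-mono : IsGroupMonomorphism rawSubgroup rawGroup include
      include-mono = record
        { isGroupHomomorphism = record
          { isMonoidHomomorphism = record
            { isMagmaHomomorphism = record
              { isRelHomomorphism = record { cong = id }
              ; homo = λ _ _ _ → ≈.refl
              }
            ; ε-homo = λ _ → ≈.refl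
            }
          ; ⁻¹-homo = λ _ _ → ≈.refl
          }
        ; injective = id
        }

    definableGroup : DefinableAbelianGroup
    definableGroup = record
      { universe       = subset
      ; _∙_            = RawGroup._∙_ rawSubgroup
      ; ε              = RawGroup.ε rawSubgroup
      ; _⁻¹            = RawGroup._⁻¹ rawSubgroup
      ; isAbelianGroup =
          GroupMonomorphism.isAbelianGroup include-mono isAbelianGroup
      ; ∙-definable    = proj₁ ∙-definable
                       , λ x y z → proj₂ ∙-definable
                                     (include x) (include y) (include z)
      }

  private
    ⋀ : ∀ {k} n → (Fin n → Formula Carrier k) → Formula Carrier k
    ⋀ zero    φ = falsum ⇒ falsum
    ⋀ (suc n) φ = φ zero ∧ ⋀ n (φ ∘ suc)

    ⋀-correct : ∀ {k} n (φ : Fin n → Formula Carrier k) (ρ : Vector Carrier k) →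
                (∀ i → ⟦ φ i ⟧ ρ) ⇔ ⟦ ⋀ n φ ⟧ ρ
    ⋀-correct n φ ρ = mk⇔ (to n φ) (from n φ)
      where
      to : ∀ n (φ : Fin n → Formula Carrier _) →
           (∀ i → ⟦ φ i ⟧ ρ) → ⟦ ⋀ n φ ⟧ ρ
      to zero    φ h = λ ()
      to (suc n) φ h = h zero , to n (φ ∘ suc) (h ∘ suc)

      from : ∀ n (φ : Fin n → Formula Carrier _) →
             ⟦ ⋀ n φ ⟧ ρ → ∀ i → ⟦ φ i ⟧ ρ
      from (suc n) φ (h , _) zero    = h
      from (suc n) φ (_ , h) (suc i) = from n (φ ∘ suc) h i

  -- Zⁿ with coordinatewise addition, as a definable group.

  module _ (n : ℕ) where

    private
      module Zⁿ = AbelianGroup (Pointwise.abelianGroup (Fin n) +-abelianGroup)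

      everything : DefinableSet n
      everything = falsum ⇒ falsum

      rawPower : RawGroup ℓ ℓ
      rawPower = record
        { Carrier = Element everything
        ; _≈_     = ElementEq everything
        ; _∙_     = λ x y → proj₁ x Zⁿ.∙ proj₁ y , id
        ; ε       = Zⁿ.ε , id
        ; _⁻¹     = λ x → proj₁ x Zⁿ.⁻¹ , id
        }

      forget-mono : IsGroupMonomorphism rawPower Zⁿ.rawGroup proj₁
      forget-mono = record
        { isGroupHomomorphism = record
          { isMonoidHomomorphism = record
            { isMagmaHomomorphism = record
              { isRelHomomorphism = record { cong = id }
              ; homo = λ _ _ _ → ≈.refl
              }
            ; ε-homo = λ _ → ≈.refl
            }
          ; ⁻¹-homo = λ _ _ → ≈.refl
          }
        ; injective = id
        }

      addᶠ : Fin n → Formula Carrier (n + (n + n))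
      addᶠ i = var (i ↑ˡ (n + n)) ⊕ var (n ↑ʳ (i ↑ˡ n))
             ≐ var (n ↑ʳ (n ↑ʳ i))

      addᶠ-correct : ∀ (x y z : Vector Carrier n) →
                     (∀ i → x i +ᶻ y i ≈ z i) ⇔
                     (x ++ (y ++ z)) ∈ᵈ ⋀ n addᶠ
      addᶠ-correct x y z = mk⇔
        (λ h → A.to λ i → eq-to i (h i))
        (λ h i → eq-from i (A.from h i))
        where
        module A = Equivalence (⋀-correct n addᶠ (x ++ (y ++ z)))

        xs : ∀ i → (x ++ (y ++ z)) (i ↑ˡ (n + n)) ≡ x i
        xs = lookup-++ˡ x (y ++ z)

        ys : ∀ i → (x ++ (y ++ z)) (n ↑ʳ (i ↑ˡ n)) ≡ y i
        ys i rewrite lookup-++ʳ x (y ++ z) (i ↑ˡ n) = lookup-++ˡ y z i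

        zs : ∀ i → (x ++ (y ++ z)) (n ↑ʳ (n ↑ʳ i)) ≡ z i
        zs i rewrite lookup-++ʳ x (y ++ z) (n ↑ʳ i) = lookup-++ʳ y z i

        eq-to : ∀ i → x i +ᶻ y i ≈ z i → ⟦ addᶠ i ⟧ (x ++ (y ++ z))
        eq-to i = subst₂ _≈_ (sym (cong₂ _+ᶻ_ (xs i) (ys i))) (sym (zs i))

        eq-from : ∀ i → ⟦ addᶠ i ⟧ (x ++ (y ++ z)) → x i +ᶻ y i ≈ z i
        eq-from i = subst₂ _≈_ (cong₂ _+ᶻ_ (xs i) (ys i)) (zs i)

    powerGroup : DefinableAbelianGroup
    powerGroup = record
      { universe       = everything
      ; _∙_            = RawGroup._∙_ rawPower
      ; ε              = RawGroup.ε rawPower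
      ; _⁻¹            = RawGroup._⁻¹ rawPower
      ; isAbelianGroup =
          GroupMonomorphism.isAbelianGroup forget-mono Zⁿ.isAbelianGroup
      ; ∙-definable    = ⋀ n addᶠ
                       , λ x y z → addᶠ-correct (proj₁ x) (proj₁ y) (proj₁ z)
      }

  -- The graph of the inverse of a definable bijection is definable, so nothing
  -- need be required of the inverse.

  record DefinableIsomorphism (G H : DefinableAbelianGroup) : Set ℓ where
    private
      module G = DefinableAbelianGroup G
      module H = DefinableAbelianGroup H
    field
      to                 : Element G.universe → Element H.universe
      to-definable       : IsDefinableMap G.universe H.universe to
      isGroupIsomorphism : IsGroupIsomorphism G.rawGroup H.rawGroup to

  -- G/H is bounded: some bounded definable subset of G contains exactly one
  -- element of each coset of H.

  record HasBoundedQuotient (G : DefinableAbelianGroup)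
                            (H : DefinableSubgroup G) : Set ℓ where
    open DefinableAbelianGroup G
    open DefinableSubgroup H using (subset)
    field
      representatives   : DefinableSet dim
      representatives⊆G : representatives ⊆ᵈ universe
      bounded           : IsBounded representatives
      transversal       : ∀ g → ∃! (ElementEq universe) λ r →
                            (proj₁ r ∈ᵈ representatives) ×
                            (proj₁ (g ⁻¹ ∙ r) ∈ᵈ subset)

-- Write "eventually x" for "all sufficiently large x in Z", and iterate it for
-- vectors.
--
-- An Ehrenfeucht–Fraïssé argument in ℤ shows that the truth of a formula depends
-- only on the signs of finitely many integer linear forms and on residues modulo
-- a fixed number; moreover a witness y of ∃ y φ (y, x) may always be moved next to
-- a value of such a form. Hence, if eventually ∃ y φ (y, x), there are a standard
-- modulus M and finitely many possible slopes a such that, for some c, eventually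
-- φ (a x + c, M x). This is a scheme of sentences, so it holds in Z with
-- parameters, and iterating it gives linear solutions in several variables.
--
-- Let F x = A x + c be a linear map into G, defined eventually, together with an
-- integer matrix T of n columns such that A T is injective, with n maximal. After
-- rescaling, F u · F x = L u + L′ x + l. By maximality the columns of L T depend
-- on those of L′ T: N L T = L′ T κ. So F (u + N T d) / F u equals
-- F (x + T κ d) / F x, and after another rescaling F (x + T d) / F x is an element
-- θ d of G that eventually does not depend on x. As "eventually" is invariant
-- under translation, θ is a homomorphism Zⁿ → G; it is injective since A T is.
-- Its image is H.
--
-- Choose representatives of the cosets of H definably. If they were unbounded, an
-- unbounded definable curve U t = B t + b, B ≠ 0, would consist of representatives.
-- Maximality of n, applied to U t · F x, puts U (t + e) / U t in H for some e ≠ 0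
-- with B e ≠ 0, so that two distinct representatives would share a coset.

module Submission where

open import Defs
open import Level using (Level; 0ℓ; _⊔_; Lift; lift; lower) renaming (suc to lsuc)
open import Axiom.ExcludedMiddle using (ExcludedMiddle)
open import Algebra.Bundles using (AbelianGroup)
open import Algebra.Structures using (IsAbelianGroup)
open import Data.Empty using (⊥-elim) renaming (⊥ to Empty)
open import Data.Empty.Polymorphic using (⊥) renaming (⊥-elim to ⊥ₚ-elim)
open import Data.Fin.Base using (Fin; zero; suc; _↑ˡ_; _↑ʳ_; splitAt; punchIn; punchOut)
open import Data.Fin.Properties using (punchIn-punchOut; any?) renaming (_≟_ to _≟ᶠ_)
open import Data.Integer.Base as ℤ using (ℤ; +_; -[1+_]; _⊖_; ∣_∣; 0ℤ; 1ℤ)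
import Data.Integer.Properties as ℤ
open import Data.Integer.Tactic.RingSolver using (solve-∀)
open import Data.List.Base as List using (List) renaming ([] to []ˡ; _∷_ to _∷ˡ_; _++_ to _++ˡ_)
open import Data.List.Membership.Propositional using (_∈_)
open import Data.List.Membership.Propositional.Properties using (∈-++⁺ˡ; ∈-++⁺ʳ)
open import Data.List.Relation.Binary.Pointwise.Base using (Pointwise) renaming ([] to []ˡ; _∷_ to _∷ˡ_)
open import Data.List.Relation.Binary.Subset.Propositional using (_⊆_)
open import Data.List.Relation.Unary.All as All using (All) renaming ([] to []ˡ; _∷_ to _∷ˡ_)
open import Data.List.Relation.Unary.Any as Any using (Any; here; there)
import Data.List.Relation.Unary.Any.Properties as Any
open import Data.Nat.Base as ℕ using (ℕ; zero; suc; NonZero; _!)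
import Data.Nat.Divisibility as ℕ
import Data.Nat.DivMod as ℕ
open import Data.Nat.Induction using (<-rec)
import Data.Nat.Properties as ℕ
open import Data.Product.Base using (Σ; ∃; ∃-syntax; _×_; _,_; proj₁; proj₂)
open import Data.Sum.Base as Sum using (_⊎_; inj₁; inj₂; [_,_])
open import Data.Vec.Functional using (Vector; []; _∷_; _++_; head; tail; take; drop; insertAt; removeAt)
open import Data.Vec.Functional.Properties using (lookup-++ˡ; lookup-++ʳ; insertAt-lookup; insertAt-punchIn)
open import Function.Base using (_∘_; id)
open import Function.Bundles using (_⇔_; mk⇔; Equivalence)
open import Relation.Binary.Definitions using (tri<; tri≈; tri>)
open import Relation.Binary.PropositionalEquality as ≡ using (_≡_; _≢_)
open import Relation.Nullary using (¬_; Dec; yes; no; ¬?)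
import Relation.Nullary.Decidable as Dec

-- Divisibility shapes the whole argument. A witness can in general be moved only to a fraction of a
-- form, never to the form itself, so every linear solution comes with a dilation of the variables.
-- Dilation by a positive standard integer is harmless, since "eventually" is invariant under it as
-- well; this is why moduli are multiplied wherever solutions are composed. The bounds on slope and
-- modulus must come from the formula alone and not from its parameters: only then is quantification
-- over slopes a finite disjunction and the statement about ℤ a sentence. Each eliminated variable
-- multiplies the alternatives by the number of slopes, hence the finite lists of formulas in place
-- of single ones. The matrix `T` is there because the linear form of a product lives in more
-- variables than it has new independent directions. A chart keeps all these variables and merely
-- selects directions. Since `A T` is an injective matrix with `k` rows, its number `n` of columns
-- is at most `k`, whatever the number of variables; so a maximal `n` exists.

module _ where

  open import Data.Integer.Base using (_+_; _*_; _-_; -_; _≤_; _<_; +≤+)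
  open import Relation.Binary.PropositionalEquality using (refl; sym; trans; cong; cong₂; subst; subst₂)

  -- Signs of integer linear forms, and similar points of ℤⁿ

  nonneg-+ : ∀ {a b c} → 0ℤ ≤ a → 0ℤ ≤ b → c ≡ a + b → 0ℤ ≤ c
  nonneg-+ p q refl = ℤ.+-mono-≤ p q

  nonneg-* : ∀ {a b c} → 0ℤ ≤ a → 0ℤ ≤ b → c ≡ a * b → 0ℤ ≤ c
  nonneg-* {+ m} {+ n} p q refl = subst (0ℤ ≤_) (ℤ.pos-* m n) (+≤+ ℕ.z≤n)

  nonneg-resp : ∀ {a b} → 0ℤ ≤ a → b ≡ a → 0ℤ ≤ b
  nonneg-resp p refl = p

  -- By discreteness, the negation of a nonnegativity is again a nonnegativity. Order arguments over
  -- ℤ are phrased in this way so that only ring identities remain to be checked.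
  nonneg-dec : ∀ a → 0ℤ ≤ a ⊎ 0ℤ ≤ - 1ℤ - a
  nonneg-dec (+ n)    = inj₁ (+≤+ ℕ.z≤n)
  nonneg-dec -[1+ n ] = inj₂ (+≤+ ℕ.z≤n)

  nonneg-asym : ∀ {a b} → 0ℤ ≤ a → 0ℤ ≤ b → - 1ℤ ≡ a + b → Empty
  nonneg-asym p q e with nonneg-+ p q e
  ... | ()

  nonneg-cancel : ∀ n .{{_ : NonZero n}} {a b} → 0ℤ ≤ b → b ≡ + n * a → 0ℤ ≤ a
  nonneg-cancel (suc n) {+ m} _ _ = +≤+ ℕ.z≤n
  nonneg-cancel (suc n) { -[1+ m ]} p refl with p
  ... | ()

  ∣∣-reflects : ∀ {a b} → 0ℤ ≤ a → 0ℤ ≤ b → ∣ a ∣ ℕ.≤ ∣ b ∣ → 0ℤ ≤ b - a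
  ∣∣-reflects {+ m} {+ n} _ _ m≤n = ℤ.i≤j⇒0≤j-i (+≤+ m≤n)

  ∣+∣≤ : ∀ {a b m n} → ∣ a ∣ ℕ.≤ m → ∣ b ∣ ℕ.≤ n → ∣ a + b ∣ ℕ.≤ m ℕ.+ n
  ∣+∣≤ {a} {b} p q = ℕ.≤-trans (ℤ.∣i+j∣≤∣i∣+∣j∣ a b) (ℕ.+-mono-≤ p q)

  ∣-∣≤ : ∀ {a b m n} → ∣ a ∣ ℕ.≤ m → ∣ b ∣ ℕ.≤ n → ∣ a - b ∣ ℕ.≤ m ℕ.+ n
  ∣-∣≤ {a} {b} p q = ℕ.≤-trans (ℤ.∣i-j∣≤∣i∣+∣j∣ a b) (ℕ.+-mono-≤ p q)

  ∣*∣≤ : ∀ {a b m n} → ∣ a ∣ ℕ.≤ m → ∣ b ∣ ℕ.≤ n → ∣ a * b ∣ ℕ.≤ m ℕ.* n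
  ∣*∣≤ {a} {b} p q = subst (ℕ._≤ _) (sym (ℤ.∣i*j∣≡∣i∣*∣j∣ a b)) (ℕ.*-mono-≤ p q)

  dot : ∀ {n} → Vector ℤ n → Vector ℤ n → ℤ
  dot {zero}  a ρ = 0ℤ
  dot {suc n} a ρ = head a * head ρ + dot (tail a) (tail ρ)

  dot-zero : ∀ {n} (ρ : Vector ℤ n) → dot (λ _ → 0ℤ) ρ ≡ 0ℤ
  dot-zero {zero}  ρ = refl
  dot-zero {suc n} ρ = cong₂ _+_ (ℤ.*-zeroˡ (head ρ)) (dot-zero (tail ρ))

  dot-combine : ∀ {n} k l (a b ρ : Vector ℤ n) →
                dot (λ i → k * a i + l * b i) ρ ≡ k * dot a ρ + l * dot b ρ
  dot-combine {zero} k l a b ρ = lemma k l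
    where
    lemma : ∀ k l → 0ℤ ≡ k * 0ℤ + l * 0ℤ
    lemma = solve-∀
  dot-combine {suc n} k l a b ρ
    rewrite dot-combine k l (tail a) (tail b) (tail ρ) =
    lemma k l (head a) (head b) (head ρ) (dot (tail a) (tail ρ)) (dot (tail b) (tail ρ))
    where
    lemma : ∀ k l a b r x y → (k * a + l * b) * r + (k * x + l * y)
                              ≡ k * (a * r + x) + l * (b * r + y)
    lemma = solve-∀

  dot-scale : ∀ {n} k (a ρ : Vector ℤ n) → dot (λ i → k * a i) ρ ≡ k * dot a ρ
  dot-scale {zero}  k a ρ = sym (ℤ.*-zeroʳ k)
  dot-scale {suc n} k a ρ rewrite dot-scale k (tail a) (tail ρ) =
    lemma k (head a) (head ρ) (dot (tail a) (tail ρ))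
    where
    lemma : ∀ k a r x → (k * a) * r + k * x ≡ k * (a * r + x)
    lemma = solve-∀

  dot-minus : ∀ {n} (a b ρ : Vector ℤ n) → dot (λ i → a i - b i) ρ ≡ dot a ρ - dot b ρ
  dot-minus {zero}  a b ρ = refl
  dot-minus {suc n} a b ρ rewrite dot-minus (tail a) (tail b) (tail ρ) =
    lemma (head a) (head b) (head ρ) (dot (tail a) (tail ρ)) (dot (tail b) (tail ρ))
    where
    lemma : ∀ a b r x y → (a - b) * r + (x - y) ≡ (a * r + x) - (b * r + y)
    lemma = solve-∀

  dot-shift : ∀ {n} m (a ρ ρ′ : Vector ℤ n) → (∀ i → ∃[ q ] ρ′ i ≡ ρ i + m * q) →
              ∃[ q ] dot a ρ′ ≡ dot a ρ + m * q
  dot-shift {zero}  m a ρ ρ′ h = 0ℤ , sym (trans (ℤ.+-identityˡ _) (ℤ.*-zeroʳ m))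
  dot-shift {suc n} m a ρ ρ′ h
    with p , ep ← h zero | q , eq ← dot-shift m (tail a) (tail ρ) (tail ρ′) (h ∘ suc) =
    head a * p + q ,
    trans (cong₂ (λ u v → head a * u + v) ep eq)
          (lemma m (head a) (head ρ) p (dot (tail a) (tail ρ)) q)
    where
    lemma : ∀ m a r p x q → a * (r + m * p) + (x + m * q) ≡ (a * r + x) + m * (a * p + q)
    lemma = solve-∀

  BoundedBy : ∀ {n} → ℕ → Vector ℤ n → Set
  BoundedBy B a = ∀ i → ∣ a i ∣ ℕ.≤ B

  -- One direction of the sign condition suffices. Applied to minus a form minus one it yields the
  -- converse, and the constant of that form may be larger by one; `sim-sym` pays for this with one
  -- unit of `B`.
  record Sim {n} (B M : ℕ) (ρ ρ′ : Vector ℤ n) : Set where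
    constructor sim
    field
      congruent : ∀ i → ∃[ q ] ρ′ i ≡ ρ i + + M * q
      signs     : ∀ a c → BoundedBy B a → ∣ c ∣ ℕ.≤ B →
                  0ℤ ≤ dot a ρ + c → 0ℤ ≤ dot a ρ′ + c


  open Sim

  sim-refl : ∀ {n B M} {ρ : Vector ℤ n} → Sim B M ρ ρ
  sim-refl {M = M} {ρ} = sim (λ i → 0ℤ , sym (trans (cong (λ z → ρ i + z) (ℤ.*-zeroʳ (+ M))) (ℤ.+-identityʳ _)))
                   (λ _ _ _ _ → id)

  sim-sym : ∀ {n B M} {ρ ρ′ : Vector ℤ n} → Sim (suc B) M ρ ρ′ → Sim B M ρ′ ρ
  sim-sym {B = B} {M} {ρ} {ρ′} s = sim
    (λ i → let q , e = congruent s i in - q ,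
           trans (lemma₁ (ρ i) (+ M) q) (cong (_+ + M * - q) (sym e)))
    sgn
    where
    lemma₁ : ∀ r m q → r ≡ r + m * q + m * - q
    lemma₁ = solve-∀
    lemma₂ : ∀ x c → - 1ℤ * x + (- 1ℤ - c) ≡ - 1ℤ - (x + c)
    lemma₂ = solve-∀
    lemma₃ : ∀ x c → - 1ℤ ≡ (x + c) + (- 1ℤ * x + (- 1ℤ - c))
    lemma₃ = solve-∀
    sgn : ∀ a c → BoundedBy B a → ∣ c ∣ ℕ.≤ B → 0ℤ ≤ dot a ρ′ + c → 0ℤ ≤ dot a ρ + c
    sgn a c ba bc p with nonneg-dec (dot a ρ + c)
    ... | inj₁ q = q
    ... | inj₂ q = ⊥-elim (nonneg-asym p neg (trans (lemma₃ (dot a ρ′) c)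
                     (cong (λ z → dot a ρ′ + c + (z + (- 1ℤ - c))) (sym (dot-scale (- 1ℤ) a ρ′)))))
      where
      bounded : BoundedBy (suc B) (λ i → - 1ℤ * a i)
      bounded i = subst (ℕ._≤ suc B) (sym (trans (cong ∣_∣ (ℤ.-1*i≡-i (a i))) (ℤ.∣-i∣≡∣i∣ (a i))))
                    (ℕ.m≤n⇒m≤1+n (ba i))
      neg : 0ℤ ≤ dot (λ i → - 1ℤ * a i) ρ′ + (- 1ℤ - c)
      neg = signs s (λ i → - 1ℤ * a i) (- 1ℤ - c) bounded (∣-∣≤ { - 1ℤ} {c} (ℕ.s≤s ℕ.z≤n) bc)
              (nonneg-resp q (trans (cong (_+ (- 1ℤ - c)) (dot-scale (- 1ℤ) a ρ)) (lemma₂ (dot a ρ) c)))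

  sim-weaken : ∀ {n B B′ M M′} {ρ ρ′ : Vector ℤ n} → B ℕ.≤ B′ → M ℕ.∣ M′ →
               Sim B′ M′ ρ ρ′ → Sim B M ρ ρ′
  sim-weaken {M = M} {M′} {ρ} B≤B′ (ℕ.divides k M′≡kM) s = sim
    (λ i → let q , e = congruent s i in + k * q ,
           trans e (cong (λ z → ρ i + z) (trans (cong (λ m → m * q) (trans (cong +_ M′≡kM) (ℤ.pos-* k M)))
                                         (lemma (+ k) (+ M) q))))
    (λ a c ba bc → signs s a c (λ i → ℕ.≤-trans (ba i) B≤B′) (ℕ.≤-trans bc B≤B′))
    where
    lemma : ∀ k m q → (k * m) * q ≡ m * (k * q)
    lemma = solve-∀

  least : ExcludedMiddle 0ℓ → (P : ℕ → Set) → ∀ n → P n → ∃[ m ] P m × (∀ k → P k → m ℕ.≤ k)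
  least em P = <-rec _ go
    where
    go : ∀ n → (∀ {m} → m ℕ.< n → P m → ∃[ m ] P m × (∀ k → P k → m ℕ.≤ k)) →
         P n → ∃[ m ] P m × (∀ k → P k → m ℕ.≤ k)
    go n rec pn with em {∃[ m ] m ℕ.< n × P m}
    ... | yes (m , m<n , pm) = rec m<n pm
    ... | no  none = n , pn , λ k pk → ℕ.≮⇒≥ λ k<n → none (k , k<n , pk)

  -- Unlike the usual remainder, `σ` keeps the sign of `s` and lies between it and zero; on the
  -- negative side it is at most -1. A point at distance `s` from the value of a form can thus be
  -- brought near that value without passing it.
  centred-remainder : ∀ (P : ℕ) .{{_ : NonZero P}} (s : ℤ) →
    ∃[ σ ] ∃[ q ] s ≡ σ + + P * q × ∣ σ ∣ ℕ.≤ P ×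
    ((0ℤ ≤ s × 0ℤ ≤ σ × 0ℤ ≤ s - σ) ⊎ (0ℤ ≤ - 1ℤ - s × 0ℤ ≤ - 1ℤ - σ × 0ℤ ≤ σ - s))
  centred-remainder P (+ s) = + (s ℕ.% P) , + (s ℕ./ P) , eq , ℕ.<⇒≤ (ℕ.m%n<n s P) ,
    inj₁ (+≤+ ℕ.z≤n , +≤+ ℕ.z≤n , ℤ.i≤j⇒0≤j-i (+≤+ (ℕ.m%n≤m s P)))
    where
    eq : + s ≡ + (s ℕ.% P) + + P * + (s ℕ./ P)
    eq = trans (cong +_ (ℕ.m≡m%n+[m/n]*n s P))
          (cong (λ z → + (s ℕ.% P) + z) (trans (ℤ.pos-* (s ℕ./ P) P) (ℤ.*-comm (+ (s ℕ./ P)) (+ P))))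
  centred-remainder P -[1+ s ] = -[1+ s ℕ.% P ] , - + (s ℕ./ P) ,
    trans (sym (neg s)) (trans (cong (λ z → - 1ℤ - z) eq)
      (trans (lemma (+ (s ℕ.% P)) (+ P) (+ (s ℕ./ P)))
             (cong (λ z → z + + P * - + (s ℕ./ P)) (neg (s ℕ.% P))))) ,
    ℕ.m%n<n s P ,
    inj₂ (+≤+ ℕ.z≤n , +≤+ ℕ.z≤n , ℤ.i≤j⇒0≤j-i (ℤ.-≤- (ℕ.m%n≤m s P)))
    where
    eq : + s ≡ + (s ℕ.% P) + + P * + (s ℕ./ P)
    eq = trans (cong +_ (ℕ.m≡m%n+[m/n]*n s P))
          (cong (λ z → + (s ℕ.% P) + z) (trans (ℤ.pos-* (s ℕ./ P) P) (ℤ.*-comm (+ (s ℕ./ P)) (+ P))))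
    neg : ∀ n → - 1ℤ - + n ≡ -[1+ n ]
    neg zero    = refl
    neg (suc n) = refl
    lemma : ∀ r p q → - 1ℤ - (r + p * q) ≡ (- 1ℤ - r) + p * - q
    lemma = solve-∀


  value : ∀ {n} → Vector ℤ n → ℤ → Vector ℤ n → ℤ
  value β κ ρ = dot β ρ + κ

  -- One round of the Ehrenfeucht-Fraïssé game

  module Step (em : ExcludedMiddle 0ℓ) (B M : ℕ) .{{M≢0 : NonZero M}} where

    -- Every coefficient of x is at most B, hence divides N.
    N D P B⁺ : ℕ
    N = B !
    D = N ℕ.* B ℕ.+ 1
    P = N ℕ.* M
    B⁺ = (D ℕ.+ D) ℕ.+ P ℕ.+ 1

    instance
      N≢0 : NonZero N
      N≢0 = ℕ._!≢0 B
      P≢0 : NonZero P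
      P≢0 = ℕ.m*n≢0 N M


    D≤B⁺ : D ℕ.≤ B⁺
    D≤B⁺ = ℕ.≤-trans (ℕ.m≤m+n D D) (ℕ.≤-trans (ℕ.m≤m+n (D ℕ.+ D) P) (ℕ.m≤m+n _ 1))

    NB≤D : N ℕ.* B ℕ.≤ D
    NB≤D = ℕ.m≤m+n _ 1

    B≤B⁺ : B ℕ.≤ B⁺
    B≤B⁺ = ℕ.≤-trans (ℕ.≤-trans (ℕ.m≤n*m B N) NB≤D) D≤B⁺

    -- N x and value β₀ κ₀ ρ + σ lie on the same side of every bounded form.
    record Nearest {n} (ρ : Vector ℤ n) (x : ℤ) : Set where
      field
        β₀   : Vector ℤ n
        κ₀   : ℤ
        β₀≤  : BoundedBy D β₀
        κ₀≤  : ∣ κ₀ ∣ ℕ.≤ D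
        σ q  : ℤ
        σ≤   : ∣ σ ∣ ℕ.≤ P
        Nx≡  : + N * x ≡ value β₀ κ₀ ρ + σ + + P * q
        to   : ∀ β κ → BoundedBy D β → ∣ κ ∣ ℕ.≤ D →
               0ℤ ≤ + N * x - value β κ ρ → 0ℤ ≤ value β₀ κ₀ ρ + σ - value β κ ρ
        from : ∀ β κ → BoundedBy D β → ∣ κ ∣ ℕ.≤ D →
               0ℤ ≤ value β₀ κ₀ ρ + σ - value β κ ρ → 0ℤ ≤ + N * x - value β κ ρ

    -- The form closest to `N x` has no other bounded form strictly between its value and `N x`, so
    -- shortening the distance to its remainder modulo `P` crosses none of them.
    nearest : ∀ {n} (ρ : Vector ℤ n) (x : ℤ) → Nearest ρ x
    nearest {n} ρ x with least em Distance _ ((λ _ → 0ℤ) , 0ℤ , (λ _ → ℕ.z≤n) , ℕ.z≤n , refl)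
      where
      Distance : ℕ → Set
      Distance k = Σ (Vector ℤ n) λ β → ∃[ κ ] BoundedBy D β × ∣ κ ∣ ℕ.≤ D × k ≡ ∣ + N * x - value β κ ρ ∣
    ... | _ , (β₀ , κ₀ , β₀≤ , κ₀≤ , refl) , minimal
      with σ , q , s≡ , σ≤ , side ← centred-remainder P (+ N * x - value β₀ κ₀ ρ) = record
      { β₀ = β₀ ; κ₀ = κ₀ ; β₀≤ = β₀≤ ; κ₀≤ = κ₀≤ ; σ = σ ; q = q ; σ≤ = σ≤
      ; Nx≡ = trans (lemma₀ X t₀) (trans (cong (λ z → t₀ + z) s≡) (sym (ℤ.+-assoc t₀ σ (+ P * q))))
      ; to = λ β κ bβ bκ → proj₁ (both side β κ bβ bκ)
      ; from = λ β κ bβ bκ → proj₂ (both side β κ bβ bκ)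
      }
      where
      X t₀ : ℤ
      X = + N * x
      t₀ = value β₀ κ₀ ρ
      lemma₀ : ∀ X t → X ≡ t + (X - t)
      lemma₀ = solve-∀
      lemma₁ : ∀ X t t₀ σ → t₀ + σ - t ≡ ((X - t) - (X - t₀)) + σ
      lemma₁ = solve-∀
      lemma₂ : ∀ X t t₀ σ → X - t ≡ (t₀ + σ - t) + (X - t₀ - σ)
      lemma₂ = solve-∀
      lemma₃ : ∀ X t t₀ σ → t₀ + σ - t ≡ (X - t) + (σ - (X - t₀))
      lemma₃ = solve-∀
      lemma₄ : ∀ X t → t - X ≡ (- 1ℤ - (X - t)) + 1ℤ
      lemma₄ = solve-∀
      lemma₅ : ∀ X t t₀ σ → σ ≡ (t₀ + σ - t) + ((t - X) - (t₀ - X))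
      lemma₅ = solve-∀
      lemma₆ : ∀ σ → - 1ℤ ≡ σ + (- 1ℤ - σ)
      lemma₆ = solve-∀
      both : _ → ∀ β κ → BoundedBy D β → ∣ κ ∣ ℕ.≤ D →
             (0ℤ ≤ X - value β κ ρ → 0ℤ ≤ t₀ + σ - value β κ ρ) ×
             (0ℤ ≤ t₀ + σ - value β κ ρ → 0ℤ ≤ X - value β κ ρ)
      both (inj₁ (0≤s , 0≤σ , σ≤s)) β κ bβ bκ =
        (λ p → nonneg-+ (∣∣-reflects 0≤s p (minimal _ (β , κ , bβ , bκ , refl))) 0≤σ
                 (lemma₁ X (value β κ ρ) t₀ σ)) ,
        (λ p → nonneg-+ p σ≤s (lemma₂ X (value β κ ρ) t₀ σ))
      both (inj₂ (s<0 , σ<0 , s≤σ)) β κ bβ bκ =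
        (λ p → nonneg-+ p s≤σ (lemma₃ X (value β κ ρ) t₀ σ)) , from
        where
        t : ℤ
        t = value β κ ρ
        from : 0ℤ ≤ t₀ + σ - t → 0ℤ ≤ X - t
        from p with nonneg-dec (X - t)
        ... | inj₁ r = r
        -- Were `t` above `X`, minimality would give `t₀ ≤ t`; with `t ≤ t₀ + σ` this forces
        -- `0 ≤ σ`, but here `σ` is strictly negative.
        ... | inj₂ r = ⊥-elim (nonneg-asym (nonneg-+ p closer (lemma₅ X t t₀ σ)) σ<0 (lemma₆ σ))
          where
          closer : 0ℤ ≤ (t - X) - (t₀ - X)
          closer = ∣∣-reflects (nonneg-+ s<0 (+≤+ ℕ.z≤n) (lemma₄ X t₀)) (nonneg-+ r (+≤+ ℕ.z≤n) (lemma₄ X t))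
                     (subst₂ ℕ._≤_ (ℤ.∣i-j∣≡∣j-i∣ X t₀) (ℤ.∣i-j∣≡∣j-i∣ X t)
                       (minimal _ (β , κ , bβ , bκ , refl)))

    record Extension {n} (ρ ρ′ : Vector ℤ n) (x : ℤ) : Set where
      field
        x′       : ℤ
        similar  : Sim B M (x ∷ ρ) (x′ ∷ ρ′)
        β        : Vector ℤ n
        κ        : ℤ
        β≤       : BoundedBy D β
        κ≤       : ∣ κ ∣ ℕ.≤ D ℕ.+ P
        Nx′≡     : + N * x′ ≡ value β κ ρ′

    -- The reply is dictated by asking that `N x′` have the same position relative to the nearest
    -- form at `ρ′` as at `ρ`. The game needs only that the reply is similar; that `N x′` is the
    -- value of a bounded form is recorded because linear solutions are read off from it.
    extend : ∀ {n} {ρ ρ′ : Vector ℤ n} → Sim B⁺ P ρ ρ′ → ∀ x → Extension ρ ρ′ x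
    extend {n} {ρ} {ρ′} s x = record
      { x′ = x′
      ; similar = sim congr sgn
      ; β = β₀ ; κ = κ₀ + σ ; β≤ = β₀≤ ; κ≤ = ∣+∣≤ {κ₀} {σ} κ₀≤ σ≤
      ; Nx′≡ = trans Nx′≡ (ℤ.+-assoc (dot β₀ ρ′) κ₀ σ)
      }
      where
      open Nearest (nearest ρ x)
      h : ℤ
      h = proj₁ (dot-shift (+ P) β₀ ρ ρ′ (congruent s))
      x′ : ℤ
      -- From `ρ` to `ρ′` the nearest form moves by `P h`, while `P q` is the part of the distance
      -- to be discarded. As `P` is `N M`, division by `N` leaves a multiple of `M`, so `x′` stays
      -- congruent to `x`.
      x′ = x + + M * (h - q)

      lemma₁ : ∀ N x M h q → N * (x + M * (h - q)) ≡ N * x + (N * M * h - N * M * q)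
      lemma₁ = solve-∀
      lemma₂ : ∀ b k s PQ PH → b + k + s + PQ + (PH - PQ) ≡ (b + PH) + k + s
      lemma₂ = solve-∀
      Nx′≡ : + N * x′ ≡ value β₀ κ₀ ρ′ + σ
      Nx′≡ = trans (lemma₁ (+ N) x (+ M) h q)
        (trans (cong₂ _+_ Nx≡ (cong (λ m → m * h - m * q) (sym (ℤ.pos-* N M))))
        (trans (lemma₂ (dot β₀ ρ) κ₀ σ (+ P * q) (+ P * h))
               (cong (λ d → d + κ₀ + σ) (sym (proj₂ (dot-shift (+ P) β₀ ρ ρ′ (congruent s)))))))

      lemma₃ : ∀ b₀ k₀ s b k → (b₀ - b) + (k₀ - k + s) ≡ b₀ + k₀ + s - (b + k)
      lemma₃ = solve-∀
      lemma₄ : ∀ b₀ k₀ s b k → (b - b₀) + (k - k₀ - s - 1ℤ) ≡ - 1ℤ - (b₀ + k₀ + s - (b + k))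
      lemma₄ = solve-∀
      lemma₅ : ∀ z → - 1ℤ ≡ z + (- 1ℤ - z)
      lemma₅ = solve-∀

      -- Once `N x` is replaced by a form, the comparison is the sign of a difference of forms in
      -- `ρ` alone: its coefficients are at most `D + D` and its constant at most `D + D + P`. The
      -- last unit of `B⁺` is for the complementary inequality in `reflect`.
      transfer : ∀ β κ → BoundedBy D β → ∣ κ ∣ ℕ.≤ D →
                 0ℤ ≤ + N * x - value β κ ρ → 0ℤ ≤ + N * x′ - value β κ ρ′
      transfer β κ bβ bκ p = nonneg-resp
        (signs s (λ i → β₀ i - β i) (κ₀ - κ + σ)
          (λ i → ℕ.≤-trans (∣-∣≤ {β₀ i} {β i} (β₀≤ i) (bβ i))
                   (ℕ.≤-trans (ℕ.m≤m+n (D ℕ.+ D) P) (ℕ.m≤m+n _ 1)))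
          (ℕ.≤-trans (∣+∣≤ {κ₀ - κ} {σ} (∣-∣≤ {κ₀} {κ} κ₀≤ bκ) σ≤) (ℕ.m≤m+n _ 1))
          (nonneg-resp (to β κ bβ bκ p)
            (trans (cong (_+ (κ₀ - κ + σ)) (dot-minus β₀ β ρ)) (lemma₃ (dot β₀ ρ) κ₀ σ (dot β ρ) κ))))
        (trans (cong (λ z → z - value β κ ρ′) Nx′≡)
          (trans (sym (lemma₃ (dot β₀ ρ′) κ₀ σ (dot β ρ′) κ))
                 (cong (_+ (κ₀ - κ + σ)) (sym (dot-minus β₀ β ρ′)))))

      reflect : ∀ β κ → BoundedBy D β → ∣ κ ∣ ℕ.≤ D →
                0ℤ ≤ + N * x′ - value β κ ρ′ → 0ℤ ≤ + N * x - value β κ ρ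
      reflect β κ bβ bκ p with nonneg-dec (value β₀ κ₀ ρ + σ - value β κ ρ)
      ... | inj₁ r = from β κ bβ bκ r
      ... | inj₂ r = ⊥-elim (nonneg-asym p contrary (lemma₅ (+ N * x′ - value β κ ρ′)))
        where
        contrary : 0ℤ ≤ - 1ℤ - (+ N * x′ - value β κ ρ′)
        contrary = nonneg-resp
          (signs s (λ i → β i - β₀ i) (κ - κ₀ - σ - 1ℤ)
            (λ i → ℕ.≤-trans (∣-∣≤ {β i} {β₀ i} (bβ i) (β₀≤ i))
                     (ℕ.≤-trans (ℕ.m≤m+n (D ℕ.+ D) P) (ℕ.m≤m+n _ 1)))
            (∣-∣≤ {κ - κ₀ - σ} {1ℤ} (∣-∣≤ {κ - κ₀} {σ} (∣-∣≤ {κ} {κ₀} bκ κ₀≤) σ≤) (ℕ.s≤s ℕ.z≤n))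
            (nonneg-resp r
              (trans (cong (_+ (κ - κ₀ - σ - 1ℤ)) (dot-minus β β₀ ρ))
                     (lemma₄ (dot β₀ ρ) κ₀ σ (dot β ρ) κ))))
          (trans (cong (λ z → - 1ℤ - (z - value β κ ρ′)) Nx′≡)
            (trans (sym (lemma₄ (dot β₀ ρ′) κ₀ σ (dot β ρ′) κ))
                   (cong (_+ (κ - κ₀ - σ - 1ℤ)) (sym (dot-minus β β₀ ρ′)))))

      congr : ∀ i → ∃[ q ] (x′ ∷ ρ′) i ≡ (x ∷ ρ) i + + M * q
      congr zero    = h - q , refl
      congr (suc i) = congruent (sim-weaken ℕ.≤-refl (ℕ.divides N refl) s) i

      divisor : ∀ m → suc m ℕ.≤ B → ∃[ k ] N ≡ k ℕ.* suc m × k ℕ.≤ N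
      divisor m m≤B with ℕ.∣-trans (ℕ.m∣m*n (m !)) (ℕ.m≤n⇒m!∣n! m≤B)
      ... | ℕ.divides k N≡ = k , N≡ , subst (k ℕ.≤_) (sym N≡) (ℕ.m≤m*n k (suc m))

      factor-nonzero : ∀ k m → N ≡ k ℕ.* suc m → NonZero k
      factor-nonzero zero    m N≡ = ⊥-elim (ℕ.≢-nonZero⁻¹ N N≡)
      factor-nonzero (suc k) m N≡ = _

      lemma₆ : ∀ k a x b c → k * a * x - (- k * b + - k * c) ≡ k * (a * x + b + c)
      lemma₆ = solve-∀
      lemma₇ : ∀ k a x b c → - 1ℤ - (k * a * x - (k * b + (k * c + 1ℤ))) ≡ k * (- a * x + b + c)
      lemma₇ = solve-∀

      -- A nonzero coefficient of `x` divides `N` up to sign; multiplying by the quotient `k` turns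
      -- the form into a comparison of `N x` with a form of size at most `N B`. A negative
      -- coefficient gives an upper bound for `N x`, which is the negation of a lower bound larger
      -- by one; this is the 1 in `D`.
      sgn : ∀ a c → BoundedBy B a → ∣ c ∣ ℕ.≤ B →
            0ℤ ≤ dot a (x ∷ ρ) + c → 0ℤ ≤ dot a (x′ ∷ ρ′) + c
      sgn a c ba bc p with head a in a₀≡ | ba zero
      ... | + zero | _ = nonneg-resp
        (signs s (tail a) c (λ i → ℕ.≤-trans (ba (suc i)) B≤B⁺) (ℕ.≤-trans bc B≤B⁺)
          (nonneg-resp p (cong (_+ c) (sym (trans (cong (_+ dot (tail a) ρ) (ℤ.*-zeroˡ x)) (ℤ.+-identityˡ (dot (tail a) ρ)))))))
        (cong (_+ c) (trans (cong (_+ dot (tail a) ρ′) (ℤ.*-zeroˡ x′)) (ℤ.+-identityˡ (dot (tail a) ρ′))))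
      ... | + suc m | a₀≤B with divisor m a₀≤B
      ...   | k , N≡ , k≤N = nonneg-cancel k {{factor-nonzero k m N≡}}
        (transfer (λ i → - + k * tail a i) (- + k * c)
          (λ i → ℕ.≤-trans (∣*∣≤ { - + k} {tail a i} ∣-k∣≤N (ba (suc i))) NB≤D)
          (ℕ.≤-trans (∣*∣≤ { - + k} {c} ∣-k∣≤N bc) NB≤D)
          (nonneg-resp (nonneg-* {+ k} (+≤+ ℕ.z≤n) p refl) (eq x ρ)))
        (eq x′ ρ′)
        where
        ∣-k∣≤N : ∣ - + k ∣ ℕ.≤ N
        ∣-k∣≤N = subst (ℕ._≤ N) (sym (ℤ.∣-i∣≡∣i∣ (+ k))) k≤N
        eq : ∀ x ρ → + N * x - value (λ i → - + k * tail a i) (- + k * c) ρ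
                     ≡ + k * (+ suc m * x + dot (tail a) ρ + c)
        eq x ρ = trans (cong₂ (λ z d → z * x - (d + - + k * c))
                              (trans (cong +_ N≡) (ℤ.pos-* k (suc m))) (dot-scale (- + k) (tail a) ρ))
                       (lemma₆ (+ k) (+ suc m) x (dot (tail a) ρ) c)
      sgn a c ba bc p | -[1+ m ] | a₀≤B with divisor m a₀≤B
      ...   | k , N≡ , k≤N = nonneg-cancel k {{factor-nonzero k m N≡}} below (eq x′ ρ′)
        where
        eq : ∀ x ρ → - 1ℤ - (+ N * x - value (λ i → + k * tail a i) (+ k * c + 1ℤ) ρ)
                     ≡ + k * (-[1+ m ] * x + dot (tail a) ρ + c)
        eq x ρ = trans (cong₂ (λ z d → - 1ℤ - (z * x - (d + (+ k * c + 1ℤ))))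
                              (trans (cong +_ N≡) (ℤ.pos-* k (suc m))) (dot-scale (+ k) (tail a) ρ))
                       (lemma₇ (+ k) (+ suc m) x (dot (tail a) ρ) c)
        below : 0ℤ ≤ - 1ℤ - (+ N * x′ - value (λ i → + k * tail a i) (+ k * c + 1ℤ) ρ′)
        below with nonneg-dec (+ N * x′ - value (λ i → + k * tail a i) (+ k * c + 1ℤ) ρ′)
        ... | inj₂ r = r
        ... | inj₁ r = ⊥-elim (nonneg-asym
                (reflect (λ i → + k * tail a i) (+ k * c + 1ℤ)
                  (λ i → ℕ.≤-trans (∣*∣≤ {+ k} {tail a i} k≤N (ba (suc i))) NB≤D)
                  (∣+∣≤ {+ k * c} {1ℤ} (∣*∣≤ {+ k} {c} k≤N bc) (ℕ.s≤s ℕ.z≤n))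
                  r)
                (nonneg-resp (nonneg-* {+ k} (+≤+ ℕ.z≤n) p refl) (eq x ρ))
                (lemma₅ (+ N * x - value (λ i → + k * tail a i) (+ k * c + 1ℤ) ρ)))

  -- Invariance of formulas under similarity

  no-constants : ∀ {a} {A : Set a} → Empty → A
  no-constants ()

  open Structure.Semantics ℤ-structure (no-constants {A = ℤ}) public renaming (⟦_⟧ to ⟦_⟧ℤ; ⟦_⟧ᵗ to ⟦_⟧ᵗℤ)

  dot-plus : ∀ {n} (a b ρ : Vector ℤ n) → dot (λ i → a i + b i) ρ ≡ dot a ρ + dot b ρ
  dot-plus {zero}  a b ρ = refl
  dot-plus {suc n} a b ρ rewrite dot-plus (tail a) (tail b) (tail ρ) =
    lemma (head a) (head b) (head ρ) (dot (tail a) (tail ρ)) (dot (tail b) (tail ρ))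
    where
    lemma : ∀ a b r x y → (a + b) * r + (x + y) ≡ (a * r + x) + (b * r + y)
    lemma = solve-∀

  unit : ∀ {n} → Fin n → Vector ℤ n
  unit zero    = 1ℤ ∷ λ _ → 0ℤ
  unit (suc i) = 0ℤ ∷ unit i

  dot-unit : ∀ {n} (i : Fin n) ρ → dot (unit i) ρ ≡ ρ i
  dot-unit zero    ρ = trans (cong₂ _+_ (ℤ.*-identityˡ (ρ zero)) (dot-zero (tail ρ))) (ℤ.+-identityʳ _)
  dot-unit (suc i) ρ = trans (cong₂ _+_ (ℤ.*-zeroˡ (ρ zero)) (dot-unit i (tail ρ))) (ℤ.+-identityˡ _)

  coefficients : ∀ {n} → Term Empty n → Vector ℤ n
  coefficients (var i)    = unit i
  coefficients (s ⊕ t)  i = coefficients s i + coefficients t i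

  coefficients-correct : ∀ {n} (t : Term Empty n) ρ → ⟦ t ⟧ᵗℤ ρ ≡ dot (coefficients t) ρ
  coefficients-correct (var i) ρ = sym (dot-unit i ρ)
  coefficients-correct (s ⊕ t) ρ =
    trans (cong₂ _+_ (coefficients-correct s ρ) (coefficients-correct t ρ))
          (sym (dot-plus (coefficients s) (coefficients t) ρ))

  bound : ∀ {n} → Vector ℤ n → ℕ
  bound {zero}  a = 0
  bound {suc n} a = ∣ head a ∣ ℕ.+ bound (tail a)

  bounded : ∀ {n} (a : Vector ℤ n) → BoundedBy (bound a) a
  bounded a zero    = ℕ.m≤m+n _ _
  bounded a (suc i) = ℕ.≤-trans (bounded (tail a) i) (ℕ.m≤n+m _ _)

  Invariant : ∀ {n} → ℕ → ℕ → Formula Empty n → Set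
  Invariant B M φ = ∀ ρ ρ′ → Sim B M ρ ρ′ → ⟦ φ ⟧ℤ ρ → ⟦ φ ⟧ℤ ρ′

  record Level-of {n} (φ : Formula Empty n) : Set where
    constructor level
    field
      B M       : ℕ
      {{M≢0}}   : NonZero M
      invariant : Invariant B M φ

  form : ∀ {n} → Term Empty n → Term Empty n → Vector ℤ n
  form s t i = coefficients t i - coefficients s i

  form-correct : ∀ {n} (s t : Term Empty n) ρ → dot (form s t) ρ ≡ ⟦ t ⟧ᵗℤ ρ - ⟦ s ⟧ᵗℤ ρ
  form-correct s t ρ = trans (dot-minus (coefficients t) (coefficients s) ρ)
    (cong₂ _-_ (sym (coefficients-correct t ρ)) (sym (coefficients-correct s ρ)))

  sim-≤ : ∀ {n B M} (s t : Term Empty n) c {ρ ρ′} → bound (form s t) ℕ.≤ B → ∣ c ∣ ℕ.≤ B →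
          Sim B M ρ ρ′ → 0ℤ ≤ ⟦ t ⟧ᵗℤ ρ - ⟦ s ⟧ᵗℤ ρ + c → 0ℤ ≤ ⟦ t ⟧ᵗℤ ρ′ - ⟦ s ⟧ᵗℤ ρ′ + c
  sim-≤ s t c {ρ} {ρ′} st≤B c≤B ρ~ρ′ p = nonneg-resp
    (signs ρ~ρ′ (form s t) c (λ i → ℕ.≤-trans (bounded (form s t) i) st≤B) c≤B
      (nonneg-resp p (cong (_+ c) (form-correct s t ρ))))
    (cong (_+ c) (sym (form-correct s t ρ′)))

  module _ (em : ExcludedMiddle 0ℓ) where

    -- Each quantifier costs one round of the game. Atoms need no congruences, hence modulus 1;
    -- congruences enter only when a round divides by `N`.
    level-of : ∀ {n} (φ : Formula Empty n) → Level-of φ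
    level-of (s ≐ t) = level (bound (form s t) ℕ.+ bound (form t s)) 1 λ ρ ρ′ ρ~ρ′ e →
      ℤ.≤-antisym
        (ℤ.0≤i-j⇒j≤i (nonneg-resp (sim-≤ s t 0ℤ (ℕ.m≤m+n _ _) ℕ.z≤n ρ~ρ′ (eq s t ρ e)) (sym (ℤ.+-identityʳ _))))
        (ℤ.0≤i-j⇒j≤i (nonneg-resp (sim-≤ t s 0ℤ (ℕ.m≤n+m _ _) ℕ.z≤n ρ~ρ′ (eq t s ρ (sym e))) (sym (ℤ.+-identityʳ _))))
      where
      eq : ∀ s t ρ → ⟦ s ⟧ᵗℤ ρ ≡ ⟦ t ⟧ᵗℤ ρ → 0ℤ ≤ ⟦ t ⟧ᵗℤ ρ - ⟦ s ⟧ᵗℤ ρ + 0ℤ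
      eq s t ρ e = nonneg-resp (ℤ.i≤j⇒0≤j-i (ℤ.≤-reflexive e)) (ℤ.+-identityʳ _)
    level-of (s ≺ t) = level (bound (form s t) ℕ.+ 1) 1 λ ρ ρ′ ρ~ρ′ s<t →
      ℤ.suc[i]≤j⇒i<j (ℤ.0≤i-j⇒j≤i (nonneg-resp
        (sim-≤ s t (- 1ℤ) (ℕ.m≤m+n _ _) (ℕ.m≤n+m 1 _) ρ~ρ′
          (nonneg-resp (ℤ.i≤j⇒0≤j-i (ℤ.i<j⇒suc[i]≤j s<t)) (sym (lemma (⟦ s ⟧ᵗℤ ρ) (⟦ t ⟧ᵗℤ ρ)))))
        (lemma (⟦ s ⟧ᵗℤ ρ′) (⟦ t ⟧ᵗℤ ρ′))))
      where
      lemma : ∀ s t → t - (1ℤ + s) ≡ t - s + - 1ℤ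
      lemma = solve-∀
    level-of falsum = level 0 1 λ _ _ _ ()
    level-of (φ ∧ ψ) with level-of φ | level-of ψ
    ... | level B M f | level B′ M′ g = level (B ℕ.+ B′) (M ℕ.* M′) {{ℕ.m*n≢0 M M′}} λ _ _ s (p , q) →
      f _ _ (sim-weaken (ℕ.m≤m+n B B′) (ℕ.m∣m*n M′) s) p ,
      g _ _ (sim-weaken (ℕ.m≤n+m B′ B) (ℕ.n∣m*n M) s) q
    level-of (φ ∨ ψ) with level-of φ | level-of ψ
    ... | level B M f | level B′ M′ g = level (B ℕ.+ B′) (M ℕ.* M′) {{ℕ.m*n≢0 M M′}} λ _ _ s →
      Sum.map (f _ _ (sim-weaken (ℕ.m≤m+n B B′) (ℕ.m∣m*n M′) s))
              (g _ _ (sim-weaken (ℕ.m≤n+m B′ B) (ℕ.n∣m*n M) s))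
    level-of (φ ⇒ ψ) with level-of φ | level-of ψ
    ... | level B M f | level B′ M′ g = level (suc (B ℕ.+ B′)) (M ℕ.* M′) {{ℕ.m*n≢0 M M′}} λ _ _ s h p →
      g _ _ (sim-weaken (ℕ.m≤n⇒m≤1+n (ℕ.m≤n+m B′ B)) (ℕ.n∣m*n M) s)
        (h (f _ _ (sim-sym (sim-weaken (ℕ.s≤s (ℕ.m≤m+n B B′)) (ℕ.m∣m*n M′) s)) p))
    level-of (all φ) with level-of φ
    -- The challenge `x′` comes from the side of `ρ′`, so similarity is reversed before the round
    -- and again after it. This accounts for the successor here and for the one in
    -- `Step em (suc B) M`.
    ... | level B M f = level (suc B⁺) P λ _ _ s h x′ →
      let open Extension (extend (sim-sym s) x′) in f _ _ (sim-sym similar) (h _)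
      where open Step em (suc B) M
    level-of (ex φ) with level-of φ
    ... | level B M f = level B⁺ P λ _ _ s (x , p) →
      let open Extension (extend s x) in x′ , f _ _ similar p
      where open Step em B M

    common-level : ∀ {n} (Φ : List (Formula Empty n)) → ∃[ B ] ∃[ M ] NonZero M × All (Invariant B M) Φ
    common-level []ˡ = 0 , 1 , _ , []ˡ
    common-level (φ ∷ˡ Φ) with level-of φ | common-level Φ
    ... | level B M {{M≢0}} f | B′ , M′ , M′≢0 , fs =
      B ℕ.+ B′ , M ℕ.* M′ , ℕ.m*n≢0 M M′ {{M≢0}} {{M′≢0}} ,
      (λ _ _ s → f _ _ (sim-weaken (ℕ.m≤m+n B B′) (ℕ.m∣m*n M′) s)) ∷ˡ
      All.map (λ g _ _ s → g _ _ (sim-weaken (ℕ.m≤n+m B′ B) (ℕ.n∣m*n M) s)) fs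

  -- Linear solutions over ℤ

  Eventuallyℤ : (ℤ → Set) → Set
  Eventuallyℤ P = ∃[ C ] ∀ x → C < x → P x

  dot-bounded : ∀ {n B} (a ρ : Vector ℤ n) → BoundedBy B a → ∣ dot a ρ ∣ ℕ.≤ B ℕ.* bound ρ
  dot-bounded {zero}      a ρ b = ℕ.z≤n
  dot-bounded {suc n} {B} a ρ b = subst (∣ dot a ρ ∣ ℕ.≤_) (sym (ℕ.*-distribˡ-+ B ∣ head ρ ∣ _))
    (∣+∣≤ {head a * head ρ} (∣*∣≤ {head a} {head ρ} (b zero) ℕ.≤-refl) (dot-bounded (tail a) (tail ρ) (b ∘ suc)))

  ∣∣≤⇒0≤+ : ∀ {r C} → ∣ r ∣ ℕ.≤ C → 0ℤ ≤ + C + r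
  ∣∣≤⇒0≤+ {+ r}      _ = +≤+ ℕ.z≤n
  ∣∣≤⇒0≤+ { -[1+ r ]} p = ℤ.i≤j⇒0≤j-i (+≤+ p)

  -- Beyond `C` the leading coefficient decides the sign, and for `a = 0` the point does not matter.
  far-sign : ∀ {C r x x′} a → ∣ r ∣ ℕ.≤ C → + C < x → + C < x′ → 0ℤ ≤ a * x + r → 0ℤ ≤ a * x′ + r
  far-sign {C} {r} {x} {x′} (+ zero) _ _ _ p = nonneg-resp p
    (cong (_+ r) (trans (ℤ.*-zeroˡ x′) (sym (ℤ.*-zeroˡ x))))
  far-sign {C} {r} {x} {x′} (+ suc m) r≤C _ C<x′ p = nonneg-+
    (nonneg-* {+ m} {x′} (+≤+ ℕ.z≤n) (ℤ.<⇒≤ (ℤ.≤-<-trans (+≤+ ℕ.z≤n) C<x′)) refl)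
    (nonneg-+ (ℤ.i≤j⇒0≤j-i (ℤ.<⇒≤ C<x′)) (∣∣≤⇒0≤+ {r} r≤C) refl)
    (lemma (+ m) x′ r (+ C))
    where
    lemma : ∀ m x r C → (1ℤ + m) * x + r ≡ m * x + (x - C + (C + r))
    lemma = solve-∀
  far-sign {C} {r} {x} {x′} -[1+ m ] r≤C C<x _ p = ⊥-elim (nonneg-asym p
    (nonneg-+ (nonneg-* {+ m} {x} (+≤+ ℕ.z≤n) (ℤ.<⇒≤ (ℤ.≤-<-trans (+≤+ ℕ.z≤n) C<x)) refl)
      (nonneg-+ (ℤ.i≤j⇒0≤j-i (ℤ.i<j⇒suc[i]≤j C<x))
        (∣∣≤⇒0≤+ { - r} (subst (ℕ._≤ C) (sym (ℤ.∣-i∣≡∣i∣ r)) r≤C)) refl) refl)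
    (lemma (+ m) x r (+ C)))
    where
    lemma : ∀ m x r C → - 1ℤ ≡ - (1ℤ + m) * x + r + (m * x + (x - (1ℤ + C) + (C + - r)))
    lemma = solve-∀

  scaled-< : ∀ {C w} P .{{_ : NonZero P}} → + C < w → + C < + P * w
  scaled-< {C} { + w} (suc P) (ℤ.+<+ C<w) = subst (+ C <_) (ℤ.pos-* (suc P) w)
    (ℤ.+<+ (ℕ.≤-trans C<w (ℕ.m≤n*m w (suc P))))

  module _ (em : ExcludedMiddle 0ℓ) {n} (Φ : List (Formula Empty (suc (suc n)))) where

    -- `slope` and `modulus` are chosen before `ρ`, so that they can be written into a formula. In
    -- the hypothesis the member of `Φ` may vary with `x`; in the conclusion one member serves all
    -- large `w`.
    record LinearSolutions : Set where
      field
        slope modulus  : ℕ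
        {{modulus≢0}}  : NonZero modulus
        solve : ∀ ρ → Eventuallyℤ (λ x → Any (λ φ → ∃[ y ] ⟦ φ ⟧ℤ (y ∷ x ∷ ρ)) Φ) →
                Any (λ φ → ∃[ a ] ∣ a ∣ ℕ.≤ slope × ∃[ c ]
                           Eventuallyℤ (λ w → ⟦ φ ⟧ℤ (a * w + c ∷ + modulus * w ∷ ρ))) Φ

    linear-solutions : LinearSolutions
    linear-solutions with common-level em Φ
    ... | B , M , M≢0 , fs = record
      { slope = D ℕ.* M ; modulus = P
      ; solve = λ ρ (C , h) → find ρ (w₀ ρ C) (w₀-large ρ C) fs (h _ (x₀-large ρ C)) }
      where
      instance
        M≢0′ : NonZero M
        M≢0′ = M≢0
      open Step em B M
      -- `K ρ` bounds the constant term that `N` times a bounded form acquires along the line; it is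
      -- the `C` required by `far-sign`.
      K : Vector ℤ n → ℕ
      K ρ = B ℕ.* (D ℕ.* bound ρ ℕ.+ (D ℕ.+ P)) ℕ.+ N ℕ.* (B ℕ.* bound ρ ℕ.+ B)
      w₀ : Vector ℤ n → ℤ → ℤ
      w₀ ρ C = + suc (∣ C ∣ ℕ.+ K ρ)
      w₀-large : ∀ ρ C → + K ρ < w₀ ρ C
      w₀-large ρ C = ℤ.+<+ (ℕ.s≤s (ℕ.m≤n+m (K ρ) ∣ C ∣))
      C≤∣C∣ : ∀ C → C ≤ + ∣ C ∣
      C≤∣C∣ (+ n)    = ℤ.≤-refl
      C≤∣C∣ -[1+ n ] = ℤ.-≤+
      x₀-large : ∀ ρ C → C < + P * w₀ ρ C
      x₀-large ρ C = ℤ.≤-<-trans (C≤∣C∣ C) (scaled-< P (ℤ.+<+ (ℕ.s≤s (ℕ.m≤m+n ∣ C ∣ (K ρ)))))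

      module _ (ρ : Vector ℤ n) (w₀ : ℤ) (w₀-large : + K ρ < w₀) where
        -- A single point `w₀` is enough. Playing a round from `P w₀ ∷ ρ` against itself moves the
        -- witness onto a line; a step of `w` along it changes both `x` and `y` by multiples of `M`,
        -- and beyond `K ρ` no bounded form changes sign. So all points of the line are similar to
        -- the one at `w₀`.
        solution : ∀ φ → Invariant B M φ → ∃[ y ] ⟦ φ ⟧ℤ (y ∷ + P * w₀ ∷ ρ) →
                   ∃[ a ] ∣ a ∣ ℕ.≤ D ℕ.* M × ∃[ c ] Eventuallyℤ (λ w → ⟦ φ ⟧ℤ (a * w + c ∷ + P * w ∷ ρ))
        solution φ f (y₀ , p) = β zero * + M , ∣*∣≤ {β zero} (β≤ zero) ℕ.≤-refl ,
          x′ - β zero * + M * w₀ , + K ρ , λ w w-large → f _ _ (similar-at w w-large) (f _ _ similar p)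
          where
          open Extension (extend {ρ = + P * w₀ ∷ ρ} sim-refl y₀)
          b : ℤ
          b = β zero
          s : ℤ
          s = dot (tail β) ρ
          P≡ : + P ≡ + N * + M
          P≡ = ℤ.pos-* N M
          lemma₁ : ∀ b M w w₀ y → b * M * w + (y - b * M * w₀) ≡ y + M * (b * (w - w₀))
          lemma₁ = solve-∀
          lemma₂ : ∀ N M w w₀ → N * M * w ≡ N * M * w₀ + M * (N * (w - w₀))
          lemma₂ = solve-∀
          lemma₃ : ∀ N M b w w₀ y → N * (b * M * w + (y - b * M * w₀)) ≡ N * y + b * (N * M * w - N * M * w₀)
          lemma₃ = solve-∀
          lemma₄ : ∀ b s κ x₀ x → (b * x₀ + s + κ) + b * (x - x₀) ≡ b * x + (s + κ)
          lemma₄ = solve-∀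
          lemma₅ : ∀ N e₀ e₁ d f y x → N * (e₀ * y + (e₁ * x + d) + f) ≡ e₀ * (N * y) + N * e₁ * x + N * (d + f)
          lemma₅ = solve-∀
          lemma₆ : ∀ N e₀ e₁ d f b x s → e₀ * (b * x + s) + N * e₁ * x + N * (d + f)
                     ≡ (e₀ * b + N * e₁) * x + (e₀ * s + N * (d + f))
          lemma₆ = solve-∀
          lemma₇ : ∀ b M w₀ y → b * M * w₀ + (y - b * M * w₀) ≡ y
          lemma₇ = solve-∀
          y : ℤ → ℤ
          y w = b * + M * w + (x′ - b * + M * w₀)
          Ny≡ : ∀ w → + N * y w ≡ b * (+ P * w) + (s + κ)
          Ny≡ w = trans (lemma₃ (+ N) (+ M) b w w₀ x′)
            (trans (cong₂ (λ z m → z + b * (m * w - m * w₀)) Nx′≡ (sym P≡))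
                   (lemma₄ b s κ (+ P * w₀) (+ P * w)))
          similar-at : ∀ w → + K ρ < w → Sim B M (x′ ∷ + P * w₀ ∷ ρ) (y w ∷ + P * w ∷ ρ)
          similar-at w w-large = sim congr sgn
            where
            congr : ∀ i → ∃[ q ] (y w ∷ + P * w ∷ ρ) i ≡ (x′ ∷ + P * w₀ ∷ ρ) i + + M * q
            congr zero          = b * (w - w₀) , lemma₁ b (+ M) w w₀ x′
            congr (suc zero)    = + N * (w - w₀) ,
              trans (cong (_* w) P≡) (trans (lemma₂ (+ N) (+ M) w w₀) (cong (λ m → m * w₀ + + M * (+ N * (w - w₀))) (sym P≡)))
            congr (suc (suc i)) = congruent (sim-refl {B = B} {M} {ρ}) i
            sgn : ∀ e f → BoundedBy B e → ∣ f ∣ ℕ.≤ B → 0ℤ ≤ dot e (x′ ∷ + P * w₀ ∷ ρ) + f →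
                  0ℤ ≤ dot e (y w ∷ + P * w ∷ ρ) + f
            sgn e f be bf p = nonneg-cancel N (far-sign A r≤K (scaled-< P w₀-large) (scaled-< P w-large)
                (nonneg-resp (nonneg-* {+ N} (+≤+ ℕ.z≤n) p refl)
                   (trans (sym (eq w₀)) (cong (λ z → + N * (e₀ * z + (e₁ * (+ P * w₀) + d) + f)) (lemma₇ b (+ M) w₀ x′)))))
              (sym (eq w))
              where
              e₀ e₁ d A r : ℤ
              e₀ = e zero
              e₁ = e (suc zero)
              d  = dot (tail (tail e)) ρ
              A  = e₀ * b + + N * e₁
              r  = e₀ * (s + κ) + + N * (d + f)
              eq : ∀ w → + N * (e₀ * y w + (e₁ * (+ P * w) + d) + f) ≡ A * (+ P * w) + r
              eq w = trans (lemma₅ (+ N) e₀ e₁ d f (y w) (+ P * w))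
                (trans (cong (λ z → e₀ * z + + N * e₁ * (+ P * w) + + N * (d + f)) (Ny≡ w))
                       (lemma₆ (+ N) e₀ e₁ d f b (+ P * w) (s + κ)))
              r≤K : ∣ r ∣ ℕ.≤ K ρ
              r≤K = ∣+∣≤ {e₀ * (s + κ)} {+ N * (d + f)}
                (∣*∣≤ {e₀} {s + κ} (be zero) (∣+∣≤ {s} {κ} (dot-bounded (tail β) ρ (β≤ ∘ suc)) κ≤))
                (∣*∣≤ {+ N} {d + f} ℕ.≤-refl (∣+∣≤ {d} {f} (dot-bounded (tail (tail e)) ρ (λ i → be (suc (suc i)))) bf))

        find : ∀ {Ψ} → All (Invariant B M) Ψ → Any (λ φ → ∃[ y ] ⟦ φ ⟧ℤ (y ∷ + P * w₀ ∷ ρ)) Ψ →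
               Any (λ φ → ∃[ a ] ∣ a ∣ ℕ.≤ D ℕ.* M × ∃[ c ]
                          Eventuallyℤ (λ w → ⟦ φ ⟧ℤ (a * w + c ∷ + P * w ∷ ρ))) Ψ
        find {φ ∷ˡ _} (f ∷ˡ _)  (here p)  = here (solution φ f p)
        find (_ ∷ˡ fs) (there p) = there (find fs p)

open Equivalence using (to; from)

-- Integer multiples in abelian groups

module IntegerMultiples {a ℓ} (A : AbelianGroup a ℓ) where

  open AbelianGroup A renaming (_∙_ to infixl 6 _+_; ε to 0#; _⁻¹ to infix 8 -_; ∙-cong to +-cong; ∙-congˡ to +-congˡ;
    ∙-congʳ to +-congʳ; identityˡ to +-identityˡ; identityʳ to +-identityʳ; assoc to +-assoc; comm to +-comm;
    inverseˡ to -‿inverseˡ; inverseʳ to -‿inverseʳ; ⁻¹-cong to -‿cong) hiding (_-_)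
  open import Algebra.Properties.AbelianGroup A using () renaming (⁻¹-∙-comm to -‿+-comm)
  open import Algebra.Properties.Group group using ()
    renaming (ε⁻¹≈ε to -0≈0; ⁻¹-involutive to -‿involutive; inverseˡ-unique to -‿unique)
  open import Algebra.Properties.CommutativeMonoid.Mult commutativeMonoid
    using (×-congʳ; ×-homo-+; ×-distrib-+) renaming (_×_ to infixr 8 _•_)
  open import Algebra.Properties.CommutativeSemigroup commutativeSemigroup using (interchange)
  open import Relation.Binary.Reasoning.Setoid setoid

  infixl 6 _-_
  _-_ : Carrier → Carrier → Carrier
  x - y = x + - y

  +-cancel-sub : ∀ x y z → (x + y) - (x + z) ≈ y - z
  +-cancel-sub x y z = begin
    (x + y) + - (x + z)     ≈⟨ +-congˡ (-‿+-comm x z) ⟨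
    (x + y) + (- x + - z)   ≈⟨ interchange x y (- x) (- z) ⟩
    (x + - x) + (y + - z)   ≈⟨ +-congʳ (-‿inverseʳ x) ⟩
    0# + (y + - z)          ≈⟨ +-identityˡ _ ⟩
    y - z                   ∎

  sub-+-sub : ∀ x y z w → (x - y) + (z - w) ≈ (x + z) - (y + w)
  sub-+-sub x y z w = trans (interchange x (- y) z (- w)) (+-congˡ (-‿+-comm y w))

  neg-sub : ∀ x y → - (x - y) ≈ y - x
  neg-sub x y = trans (sym (-‿+-comm x (- y))) (trans (+-congˡ (-‿involutive y)) (+-comm (- x) y))

  sub-+ : ∀ x y → (x - y) + y ≈ x
  sub-+ x y = trans (+-assoc x (- y) y) (trans (+-congˡ (-‿inverseˡ y)) (+-identityʳ x))

  +-sub : ∀ x y → (x + y) - y ≈ x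
  +-sub x y = trans (+-assoc x y (- y)) (trans (+-congˡ (-‿inverseʳ y)) (+-identityʳ x))

  x-0≈x : ∀ x → x - 0# ≈ x
  x-0≈x x = trans (+-congˡ -0≈0) (+-identityʳ x)

  infixr 7 _·_
  _·_ : ℤ → Carrier → Carrier
  + n      · x = n • x
  -[1+ n ] · x = - (suc n • x)

  ·-cong : ∀ i {x y} → x ≈ y → i · x ≈ i · y
  ·-cong (+ n)    x≈y = ×-congʳ n x≈y
  ·-cong -[1+ n ] x≈y = -‿cong (×-congʳ (suc n) x≈y)

  1·x≈x : ∀ x → 1ℤ · x ≈ x
  1·x≈x = +-identityʳ

  ⊖-· : ∀ m n x → (m ⊖ n) · x ≈ m • x - n • x
  ⊖-· m       zero    x = sym (x-0≈x (m • x))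
  ⊖-· zero    (suc n) x = sym (+-identityˡ _)
  ⊖-· (suc m) (suc n) x rewrite ℤ.[1+m]⊖[1+n]≡m⊖n m n =
    trans (⊖-· m n x) (sym (+-cancel-sub x (m • x) (n • x)))

  ·-distribʳ : ∀ i j x → (i ℤ.+ j) · x ≈ i · x + j · x
  ·-distribʳ (+ m)    (+ n)    x = ×-homo-+ x m n
  ·-distribʳ (+ m)    -[1+ n ] x = ⊖-· m (suc n) x
  ·-distribʳ -[1+ m ] (+ n)    x = trans (⊖-· n (suc m) x) (+-comm _ _)
  ·-distribʳ -[1+ m ] -[1+ n ] x = begin
    - (suc (suc (m ℕ.+ n)) • x)     ≡⟨ ≡.cong (λ k → - (suc k • x)) (+-suc m n) ⟨
    - ((suc m ℕ.+ suc n) • x)       ≈⟨ -‿cong (×-homo-+ x (suc m) (suc n)) ⟩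
    - (suc m • x + suc n • x)       ≈⟨ -‿+-comm _ _ ⟨
    - (suc m • x) + - (suc n • x)   ∎
    where open import Data.Nat.Properties using (+-suc)

  ·-distribˡ : ∀ i x y → i · (x + y) ≈ i · x + i · y
  ·-distribˡ (+ n)    x y = ×-distrib-+ x y n
  ·-distribˡ -[1+ n ] x y = trans (-‿cong (×-distrib-+ x y (suc n))) (sym (-‿+-comm _ _))

  ·-neg : ∀ i x → (ℤ.- i) · x ≈ - (i · x)
  ·-neg (+ zero)  x = sym -0≈0
  ·-neg (+ suc n) x = refl
  ·-neg -[1+ n ]  x = sym (-‿involutive _)

  ·-zero : ∀ i → i · 0# ≈ 0#
  ·-zero i = trans (sym (trans (+-congʳ (trans (·-cong i (sym (+-identityʳ 0#))) (·-distribˡ i 0# 0#))) (+-sub (i · 0#) (i · 0#))))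
                   (-‿inverseʳ (i · 0#))

  *-· : ∀ i j x → (i ℤ.* j) · x ≈ i · (j · x)
  *-· (+ n) j x = positive n
    where
    positive : ∀ n → (+ n ℤ.* j) · x ≈ n • (j · x)
    positive zero    rewrite ℤ.*-zeroˡ j = refl
    positive (suc n) rewrite ℤ.suc-* (+ n) j = trans (·-distribʳ j (+ n ℤ.* j) x) (+-congˡ (positive n))
  *-· -[1+ n ] j x rewrite ≡.sym (ℤ.neg-distribˡ-* (+ suc n) j) =
    trans (·-neg (+ suc n ℤ.* j) x) (-‿cong (*-· (+ suc n) j x))

  ·-comm : ∀ i j x → i · j · x ≈ j · i · x
  ·-comm i j x = trans (sym (*-· i j x)) (trans (reflexive (≡.cong (_· x) (ℤ.*-comm i j))) (*-· j i x))

  ·-negʳ : ∀ i x → i · (- x) ≈ - (i · x)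
  ·-negʳ i x = -‿unique (i · (- x)) (i · x)
    (trans (sym (·-distribˡ i (- x) x)) (trans (·-cong i (-‿inverseˡ x)) (·-zero i)))

  -0#≈0# : - 0# ≈ 0#
  -0#≈0# = -0≈0

  combination : ∀ {n} → Vector ℤ n → Vector Carrier n → Carrier
  combination {zero}  a x = 0#
  combination {suc n} a x = head a · head x + combination (tail a) (tail x)

  combination-cong : ∀ {n} (a : Vector ℤ n) {x y} → (∀ i → x i ≈ y i) → combination a x ≈ combination a y
  combination-cong {zero}  a h = refl
  combination-cong {suc n} a h = +-cong (·-cong (head a) (h zero)) (combination-cong (tail a) (h ∘ suc))

  combination-congˡ : ∀ {n} {a b : Vector ℤ n} (x : Vector Carrier n) → (∀ i → a i ≡ b i) → combination a x ≈ combination b x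
  combination-congˡ {zero}  x h = refl
  combination-congˡ {suc n} x h = +-cong (reflexive (≡.cong (_· head x) (h zero))) (combination-congˡ (tail x) (h ∘ suc))

  combination-+ : ∀ {n} (a : Vector ℤ n) x y → combination a (λ i → x i + y i) ≈ combination a x + combination a y
  combination-+ {zero}  a x y = sym (+-identityˡ 0#)
  combination-+ {suc n} a x y =
    trans (+-cong (·-distribˡ (head a) (head x) (head y)) (combination-+ (tail a) (tail x) (tail y)))
          (interchange _ _ _ _)

  combination-· : ∀ {n} (a : Vector ℤ n) k x → combination a (λ i → k · x i) ≈ k · combination a x
  combination-· {zero}  a k x = sym (·-zero k)
  combination-· {suc n} a k x =
    trans (+-cong (·-comm (head a) k (head x)) (combination-· (tail a) k (tail x))) (sym (·-distribˡ k _ _))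

  combination-*ˡ : ∀ {n} k (a : Vector ℤ n) x → combination (λ i → k ℤ.* a i) x ≈ k · combination a x
  combination-*ˡ {zero}  k a x = sym (·-zero k)
  combination-*ˡ {suc n} k a x =
    trans (+-cong (*-· k (head a) (head x)) (combination-*ˡ k (tail a) (tail x))) (sym (·-distribˡ k _ _))

  combination-+ˡ : ∀ {n} (a b : Vector ℤ n) x → combination (λ i → a i ℤ.+ b i) x ≈ combination a x + combination b x
  combination-+ˡ {zero}  a b x = sym (+-identityˡ 0#)
  combination-+ˡ {suc n} a b x =
    trans (+-cong (·-distribʳ (head a) (head b) (head x)) (combination-+ˡ (tail a) (tail b) (tail x)))
          (interchange _ _ _ _)

  combination-0ˡ : ∀ {n} (x : Vector Carrier n) → combination (λ _ → 0ℤ) x ≈ 0#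
  combination-0ˡ {zero}  x = refl
  combination-0ˡ {suc n} x = trans (+-identityˡ _) (combination-0ˡ (tail x))

  combination-0 : ∀ {n} (a : Vector ℤ n) → combination a (λ _ → 0#) ≈ 0#
  combination-0 {zero}  a = refl
  combination-0 {suc n} a = trans (+-cong (·-zero (head a)) (combination-0 (tail a))) (+-identityˡ 0#)

-- Substitution of differences of terms

-- The pair (p , q) denotes p − q; this makes up for the missing subtraction.
DTerm : ∀ {c} → Set c → ℕ → Set c
DTerm C n = Term C n × Term C n

module _ {c} {C : Set c} where

  -- The language has no symbol for zero, so the subtrahend cannot be empty: a term `t` is
  -- represented as (t + t) - t, and zero below as a difference d - d.
  varᵈ : ∀ {n} → Fin n → DTerm C n
  varᵈ i = var i ⊕ var i , var i

  constᵈ : ∀ {n} → C → DTerm C n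
  constᵈ a = const a ⊕ const a , const a

  infixl 6 _+ᵈ_ _-ᵈ_
  _+ᵈ_ _-ᵈ_ : ∀ {n} → DTerm C n → DTerm C n → DTerm C n
  (p , q) +ᵈ (p′ , q′) = p ⊕ p′ , q ⊕ q′
  (p , q) -ᵈ (p′ , q′) = p ⊕ q′ , q ⊕ p′

  infixr 7 _×ᵈ_ _·ᵈ_
  _×ᵈ_ : ∀ {n} → ℕ → DTerm C n → DTerm C n
  zero  ×ᵈ d = d -ᵈ d
  suc k ×ᵈ d = d +ᵈ k ×ᵈ d

  _·ᵈ_ : ∀ {n} → ℤ → DTerm C n → DTerm C n
  + k      ·ᵈ d = k ×ᵈ d
  -[1+ k ] ·ᵈ d = (d -ᵈ d) -ᵈ suc k ×ᵈ d

  weakenᵗ : ∀ {n} → Term C n → Term C (suc n)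
  weakenᵗ (var i)   = var (suc i)
  weakenᵗ (const a) = const a
  weakenᵗ (s ⊕ t)   = weakenᵗ s ⊕ weakenᵗ t

  weakenᵈ : ∀ {n} → DTerm C n → DTerm C (suc n)
  weakenᵈ (p , q) = weakenᵗ p , weakenᵗ q

  infix 5 _≐ᵈ_ _≺ᵈ_
  _≐ᵈ_ _≺ᵈ_ : ∀ {n} → DTerm C n → DTerm C n → Formula C n
  (p , q) ≐ᵈ (p′ , q′) = p ⊕ q′ ≐ q ⊕ p′
  (p , q) ≺ᵈ (p′ , q′) = p ⊕ q′ ≺ q ⊕ p′

  ⋁ : ∀ {n} → List (Formula C n) → Formula C n
  ⋁ []ˡ      = falsum
  ⋁ (φ ∷ˡ Φ) = φ ∨ ⋁ Φ

module _ {c d} {C : Set c} {D : Set d} where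

  liftᵈ : ∀ {m n} → (Fin n → DTerm D m) → Fin (suc n) → DTerm D (suc m)
  liftᵈ σ zero    = varᵈ zero
  liftᵈ σ (suc i) = weakenᵈ (σ i)

  substᵗ : ∀ {m n} → (C → DTerm D m) → (Fin n → DTerm D m) → Term C n → DTerm D m
  substᵗ κ σ (var i)   = σ i
  substᵗ κ σ (const a) = κ a
  substᵗ κ σ (s ⊕ t)   = substᵗ κ σ s +ᵈ substᵗ κ σ t

  substᶠ : ∀ {m n} → (C → DTerm D m) → (Fin n → DTerm D m) → Formula C n → Formula D m
  substᶠ κ σ (s ≐ t) = substᵗ κ σ s ≐ᵈ substᵗ κ σ t
  substᶠ κ σ (s ≺ t) = substᵗ κ σ s ≺ᵈ substᵗ κ σ t
  substᶠ κ σ falsum  = falsum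
  substᶠ κ σ (φ ∧ ψ) = substᶠ κ σ φ ∧ substᶠ κ σ ψ
  substᶠ κ σ (φ ∨ ψ) = substᶠ κ σ φ ∨ substᶠ κ σ ψ
  substᶠ κ σ (φ ⇒ ψ) = substᶠ κ σ φ ⇒ substᶠ κ σ ψ
  substᶠ κ σ (all φ) = all (substᶠ (weakenᵈ ∘ κ) (liftᵈ σ) φ)
  substᶠ κ σ (ex φ)  = ex (substᶠ (weakenᵈ ∘ κ) (liftᵈ σ) φ)

private
  v₀ : ∀ {c} {C : Set c} {n} → Term C (suc n)
  v₀ = var zero
  v₁ : ∀ {c} {C : Set c} {n} → Term C (suc (suc n))
  v₁ = var (suc zero)
  v₂ : ∀ {c} {C : Set c} {n} → Term C (suc (suc (suc n)))
  v₂ = var (suc (suc zero))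

module _ {c} {C : Set c} where

  -- This expresses "for all sufficiently large values", which is more than the name says. The
  -- substitution makes room at index 1 for the threshold.
  cofinallyᶠ : ∀ {n} → Formula C (suc n) → Formula C n
  cofinallyᶠ φ = ex (all (v₁ ≺ v₀ ⇒ substᶠ constᵈ (varᵈ zero ∷ λ i → varᵈ (suc (suc i))) φ))

  along : ∀ {n} → ℤ → ℤ → Fin (suc (suc n)) → DTerm C (suc (suc n))
  along M a zero          = a ·ᵈ varᵈ zero +ᵈ varᵈ (suc zero)
  along M a (suc zero)    = M ·ᵈ varᵈ zero
  along M a (suc (suc i)) = varᵈ (suc (suc i))

  -- In the context c ∷ ρ: for all large w, φ holds of a w + c and M w.
  along-line : ∀ {n} → ℤ → ℤ → Formula C (suc (suc n)) → Formula C (suc n)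
  along-line M a φ = cofinallyᶠ (substᶠ constᵈ (along M a) φ)

-- Arithmetic and semantics in a model

module Model {ℓ} (Z : PresburgerModel ℓ) where

  open PresburgerModel Z public
  open AbelianGroup +-abelianGroup public using ()
    renaming (assoc to +-assoc; comm to +-comm; identityˡ to +-identityˡ; identityʳ to +-identityʳ;
              ∙-congˡ to +-congˡ; ∙-congʳ to +-congʳ; inverseˡ to -‿inverseˡ; inverseʳ to -‿inverseʳ;
              ⁻¹-cong to -‿cong; setoid to ≈-setoid; commutativeSemigroup to +-commutativeSemigroup)
  open IntegerMultiples +-abelianGroup public
  open import Algebra.Properties.CommutativeSemigroup +-commutativeSemigroup public using (interchange)

  <-irrefl : ∀ {x} → x < x → Empty
  <-irrefl {x} x<x with models (all (v₀ ≺ v₀ ⇒ falsum)) (λ x p → ⊥-elim (ℤ.<-irrefl ≡.refl p)) x x<x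
  ... | ()

  <-trans : ∀ {x y z} → x < y → y < z → x < z
  <-trans {x} {y} {z} = models (all (all (all (v₂ ≺ v₁ ⇒ v₁ ≺ v₀ ⇒ v₂ ≺ v₀)))) (λ _ _ _ → ℤ.<-trans) x y z

  trichotomous : ∀ x y → x < y ⊎ (x ≈ y ⊎ y < x)
  trichotomous = models (all (all (v₁ ≺ v₀ ∨ (v₁ ≐ v₀ ∨ v₀ ≺ v₁)))) tri
    where
    tri : ∀ x y → x ℤ.< y ⊎ (x ≡ y ⊎ y ℤ.< x)
    tri x y with ℤ.<-cmp x y
    ... | tri< p _ _ = inj₁ p
    ... | tri≈ _ p _ = inj₂ (inj₁ p)
    ... | tri> _ _ p = inj₂ (inj₂ p)

  +-monoʳ-< : ∀ z {x y} → x < y → x +ᶻ z < y +ᶻ z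
  +-monoʳ-< z {x} {y} = models (all (all (all (v₂ ≺ v₁ ⇒ v₂ ⊕ v₀ ≺ v₁ ⊕ v₀)))) (λ _ _ z → ℤ.+-monoˡ-< z) x y z

  exceeds : ∀ x → ∃[ y ] x < y
  exceeds = models (all (ex (v₁ ≺ v₀))) λ x → ℤ.suc x ,
    ℤ.≤-<-trans (ℤ.≤-reflexive (≡.sym (ℤ.+-identityˡ x))) (ℤ.+-monoˡ-< x (ℤ.+<+ (ℕ.s≤s ℕ.z≤n)))

  <-resp : ∀ {x x′ y y′} → x ≈ x′ → y ≈ y′ → x < y → x′ < y′
  <-resp e f p = proj₁ <-resp-≈ f (proj₂ <-resp-≈ e p)

  +-cancelʳ-< : ∀ z {x y} → x +ᶻ z < y +ᶻ z → x < y
  +-cancelʳ-< z {x} {y} p = <-resp (+-sub x z) (+-sub y z) (+-monoʳ-< (-ᶻ z) p)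

  +-cancelʳ-≈ : ∀ z {x y} → x +ᶻ z ≈ y +ᶻ z → x ≈ y
  +-cancelʳ-≈ z {x} {y} p = ≈.trans (≈.sym (+-sub x z)) (≈.trans (+-congʳ p) (+-sub y z))

  module _ {p q p′ q′ : Carrier} where
    private
      clearˡ : (p - q) +ᶻ (q +ᶻ q′) ≈ p +ᶻ q′
      clearˡ = ≈.trans (≈.sym (+-assoc _ q q′)) (+-congʳ (sub-+ p q))
      clearʳ : (p′ - q′) +ᶻ (q +ᶻ q′) ≈ q +ᶻ p′
      clearʳ = ≈.trans (+-congˡ (+-comm q q′)) (≈.trans (≈.sym (+-assoc _ q′ q)) (≈.trans (+-congʳ (sub-+ p′ q′)) (+-comm p′ q)))

    clear-≈ : p - q ≈ p′ - q′ ⇔ p +ᶻ q′ ≈ q +ᶻ p′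
    clear-≈ = mk⇔ (λ e → ≈.trans (≈.sym clearˡ) (≈.trans (+-congʳ e) clearʳ))
                  (λ e → +-cancelʳ-≈ (q +ᶻ q′) (≈.trans clearˡ (≈.trans e (≈.sym clearʳ))))

    clear-< : p - q < p′ - q′ ⇔ p +ᶻ q′ < q +ᶻ p′
    clear-< = mk⇔ (λ e → <-resp clearˡ clearʳ (+-monoʳ-< (q +ᶻ q′) e))
                  (λ e → +-cancelʳ-< (q +ᶻ q′) (<-resp (≈.sym clearˡ) (≈.sym clearʳ) e))

  module Value {c} {C : Set c} (γ : C → Carrier) where
    open Semantics γ

    ⟦_⟧ᵈ : ∀ {n} → DTerm C n → Vector Carrier n → Carrier
    ⟦ p , q ⟧ᵈ ρ = ⟦ p ⟧ᵗ ρ - ⟦ q ⟧ᵗ ρ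

    varᵈ-correct : ∀ {n} (i : Fin n) ρ → ⟦ varᵈ i ⟧ᵈ ρ ≈ ρ i
    varᵈ-correct i ρ = +-sub (ρ i) (ρ i)

    constᵈ-correct : ∀ {n} a (ρ : Vector Carrier n) → ⟦ constᵈ a ⟧ᵈ ρ ≈ γ a
    constᵈ-correct a ρ = +-sub (γ a) (γ a)

    +ᵈ-correct : ∀ {n} (d e : DTerm C n) ρ → ⟦ d +ᵈ e ⟧ᵈ ρ ≈ ⟦ d ⟧ᵈ ρ +ᶻ ⟦ e ⟧ᵈ ρ
    +ᵈ-correct d e ρ = ≈.sym (sub-+-sub _ _ _ _)

    -ᵈ-correct : ∀ {n} (d e : DTerm C n) ρ → ⟦ d -ᵈ e ⟧ᵈ ρ ≈ ⟦ d ⟧ᵈ ρ - ⟦ e ⟧ᵈ ρ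
    -ᵈ-correct d (p , q) ρ = ≈.trans (≈.sym (sub-+-sub _ _ _ _)) (+-congˡ (≈.sym (neg-sub _ _)))

    ×ᵈ-correct : ∀ {n} k (d : DTerm C n) ρ → ⟦ k ×ᵈ d ⟧ᵈ ρ ≈ + k · ⟦ d ⟧ᵈ ρ
    ×ᵈ-correct zero    d ρ = ≈.trans (-ᵈ-correct d d ρ) (-‿inverseʳ _)
    ×ᵈ-correct (suc k) d ρ = ≈.trans (+ᵈ-correct d (k ×ᵈ d) ρ) (+-congˡ (×ᵈ-correct k d ρ))

    ·ᵈ-correct : ∀ {n} i (d : DTerm C n) ρ → ⟦ i ·ᵈ d ⟧ᵈ ρ ≈ i · ⟦ d ⟧ᵈ ρ
    ·ᵈ-correct (+ k)    d ρ = ×ᵈ-correct k d ρ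
    ·ᵈ-correct -[1+ k ] d ρ = ≈.trans (-ᵈ-correct (d -ᵈ d) (suc k ×ᵈ d) ρ)
      (≈.trans (+-cong (≈.trans (-ᵈ-correct d d ρ) (-‿inverseʳ _)) (-‿cong (×ᵈ-correct (suc k) d ρ))) (+-identityˡ _))

    weakenᵗ-correct : ∀ {n} (t : Term C n) x ρ → ⟦ weakenᵗ t ⟧ᵗ (x ∷ ρ) ≡ ⟦ t ⟧ᵗ ρ
    weakenᵗ-correct (var i)   x ρ = ≡.refl
    weakenᵗ-correct (const a) x ρ = ≡.refl
    weakenᵗ-correct (s ⊕ t)   x ρ = ≡.cong₂ _+ᶻ_ (weakenᵗ-correct s x ρ) (weakenᵗ-correct t x ρ)

    weakenᵈ-correct : ∀ {n} (d : DTerm C n) x ρ → ⟦ weakenᵈ d ⟧ᵈ (x ∷ ρ) ≈ ⟦ d ⟧ᵈ ρ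
    weakenᵈ-correct (p , q) x ρ = ≈.reflexive (≡.cong₂ _-_ (weakenᵗ-correct p x ρ) (weakenᵗ-correct q x ρ))

    ≐ᵈ-correct : ∀ {n} (d e : DTerm C n) ρ → ⟦ d ⟧ᵈ ρ ≈ ⟦ e ⟧ᵈ ρ ⇔ ⟦ d ≐ᵈ e ⟧ ρ
    ≐ᵈ-correct d e ρ = clear-≈

    ≺ᵈ-correct : ∀ {n} (d e : DTerm C n) ρ → ⟦ d ⟧ᵈ ρ < ⟦ e ⟧ᵈ ρ ⇔ ⟦ d ≺ᵈ e ⟧ ρ
    ≺ᵈ-correct d e ρ = clear-<

    ⋁-correct : ∀ {n} (Φ : List (Formula C n)) ρ → Any (λ φ → ⟦ φ ⟧ ρ) Φ ⇔ ⟦ ⋁ Φ ⟧ ρ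
    ⋁-correct []ˡ      ρ = mk⇔ (λ ()) (λ ())
    ⋁-correct (φ ∷ˡ Φ) ρ = mk⇔
      (λ { (here p) → inj₁ p ; (there q) → inj₂ (to (⋁-correct Φ ρ) q) })
      (λ { (inj₁ p) → here p ; (inj₂ q) → there (from (⋁-correct Φ ρ) q) })

  module Substitution {c d} {C : Set c} {D : Set d} (γ : C → Carrier) (δ : D → Carrier) where
    private
      module C = Semantics γ
      module D = Semantics δ
    open Value δ

    substᵗ-correct : ∀ {m n} {κ : C → DTerm D m} {σ : Fin n → DTerm D m} {ρ ρ′} →
      (∀ a → γ a ≈ ⟦ κ a ⟧ᵈ ρ) → (∀ i → ρ′ i ≈ ⟦ σ i ⟧ᵈ ρ) →
      ∀ t → C.⟦ t ⟧ᵗ ρ′ ≈ ⟦ substᵗ κ σ t ⟧ᵈ ρ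
    substᵗ-correct hκ hσ (var i)   = hσ i
    substᵗ-correct hκ hσ (const a) = hκ a
    substᵗ-correct hκ hσ (s ⊕ t)   =
      ≈.trans (+-cong (substᵗ-correct hκ hσ s) (substᵗ-correct hκ hσ t)) (≈.sym (+ᵈ-correct (substᵗ _ _ s) (substᵗ _ _ t) _))

    substᶠ-correct : ∀ {m n} {κ : C → DTerm D m} {σ : Fin n → DTerm D m} {ρ ρ′} →
      (∀ a → γ a ≈ ⟦ κ a ⟧ᵈ ρ) → (∀ i → ρ′ i ≈ ⟦ σ i ⟧ᵈ ρ) →
      ∀ φ → C.⟦ φ ⟧ ρ′ ⇔ D.⟦ substᶠ κ σ φ ⟧ ρ
    lift-correct : ∀ {m n} {σ : Fin n → DTerm D m} {ρ ρ′} → (∀ i → ρ′ i ≈ ⟦ σ i ⟧ᵈ ρ) →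
      ∀ x i → (x ∷ ρ′) i ≈ ⟦ liftᵈ {C = C} σ i ⟧ᵈ (x ∷ ρ)
    lift-correct {ρ = ρ} hσ x zero = ≈.sym (varᵈ-correct zero (x ∷ ρ))
    lift-correct {σ = σ} {ρ} hσ x (suc i) = ≈.trans (hσ i) (≈.sym (weakenᵈ-correct (σ i) x ρ))

    weaken-correct : ∀ {m} {κ : C → DTerm D m} {ρ} → (∀ a → γ a ≈ ⟦ κ a ⟧ᵈ ρ) →
      ∀ x a → γ a ≈ ⟦ weakenᵈ (κ a) ⟧ᵈ (x ∷ ρ)
    weaken-correct {κ = κ} {ρ} hκ x a = ≈.trans (hκ a) (≈.sym (weakenᵈ-correct (κ a) x ρ))

    substᶠ-correct hκ hσ (s ≐ t) = mk⇔
      (λ e → to (≐ᵈ-correct (substᵗ _ _ s) (substᵗ _ _ t) _) (≈.trans (≈.sym (substᵗ-correct hκ hσ s)) (≈.trans e (substᵗ-correct hκ hσ t))))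
      (λ e → ≈.trans (substᵗ-correct hκ hσ s) (≈.trans (from (≐ᵈ-correct (substᵗ _ _ s) (substᵗ _ _ t) _) e) (≈.sym (substᵗ-correct hκ hσ t))))
    substᶠ-correct hκ hσ (s ≺ t) = mk⇔
      (λ e → to (≺ᵈ-correct (substᵗ _ _ s) (substᵗ _ _ t) _) (<-resp (substᵗ-correct hκ hσ s) (substᵗ-correct hκ hσ t) e))
      (λ e → <-resp (≈.sym (substᵗ-correct hκ hσ s)) (≈.sym (substᵗ-correct hκ hσ t)) (from (≺ᵈ-correct (substᵗ _ _ s) (substᵗ _ _ t) _) e))
    substᶠ-correct hκ hσ falsum  = mk⇔ (λ ()) (λ ())
    substᶠ-correct hκ hσ (φ ∧ ψ) = mk⇔
      (λ (p , q) → to (substᶠ-correct hκ hσ φ) p , to (substᶠ-correct hκ hσ ψ) q)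
      (λ (p , q) → from (substᶠ-correct hκ hσ φ) p , from (substᶠ-correct hκ hσ ψ) q)
    substᶠ-correct hκ hσ (φ ∨ ψ) = mk⇔
      (Sum.map (to (substᶠ-correct hκ hσ φ)) (to (substᶠ-correct hκ hσ ψ)))
      (Sum.map (from (substᶠ-correct hκ hσ φ)) (from (substᶠ-correct hκ hσ ψ)))
    substᶠ-correct hκ hσ (φ ⇒ ψ) = mk⇔
      (λ h → to (substᶠ-correct hκ hσ ψ) ∘ h ∘ from (substᶠ-correct hκ hσ φ))
      (λ h → from (substᶠ-correct hκ hσ ψ) ∘ h ∘ to (substᶠ-correct hκ hσ φ))
    substᶠ-correct {κ = κ} {ρ = ρ} hκ hσ (all φ) = mk⇔
      (λ h x → to (substᶠ-correct (weaken-correct {κ = κ} {ρ} hκ x) (lift-correct hσ x) φ) (h x))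
      (λ h x → from (substᶠ-correct (weaken-correct {κ = κ} {ρ} hκ x) (lift-correct hσ x) φ) (h x))
    substᶠ-correct {κ = κ} {ρ = ρ} hκ hσ (ex φ) = mk⇔
      (λ (x , p) → x , to (substᶠ-correct (weaken-correct {κ = κ} {ρ} hκ x) (lift-correct hσ x) φ) p)
      (λ (x , p) → x , from (substᶠ-correct (weaken-correct {κ = κ} {ρ} hκ x) (lift-correct hσ x) φ) p)

  -- Both environments are compared with one substitution instance of the formula.
  formula-resp : ∀ {c} {C : Set c} {γ γ′ : C → Carrier} → (∀ a → γ a ≈ γ′ a) →
    ∀ {n} (φ : Formula C n) {ρ ρ′} → (∀ i → ρ i ≈ ρ′ i) →
    Semantics.⟦_⟧ γ φ ρ → Semantics.⟦_⟧ γ′ φ ρ′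
  formula-resp {γ = γ} {γ′} hγ φ {ρ} {ρ′} hρ p =
    from (Substitution.substᶠ-correct γ′ γ′ {κ = constᵈ} {σ = varᵈ}
        (λ a → ≈.sym (constᵈ-correct a ρ′)) (λ i → ≈.sym (varᵈ-correct i ρ′)) φ)
      (to (Substitution.substᶠ-correct γ γ′ {κ = constᵈ} {σ = varᵈ}
        (λ a → ≈.trans (hγ a) (≈.sym (constᵈ-correct a ρ′)))
        (λ i → ≈.trans (hρ i) (≈.sym (varᵈ-correct i ρ′))) φ) p)
    where open Value γ′

  Eventually : ∀ {p} → (Carrier → Set p) → Set (ℓ ⊔ p)
  Eventually P = ∃[ C ] (∀ x → C < x → P x)

  module Cofinal {c} {C : Set c} (γ : C → Carrier) where
    open Semantics γ
    open Value γ
    open Substitution γ γ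

    cofinallyᶠ-correct : ∀ {n} (φ : Formula C (suc n)) ρ →
      Eventually (λ x → ⟦ φ ⟧ (x ∷ ρ)) ⇔ ⟦ cofinallyᶠ φ ⟧ ρ
    cofinallyᶠ-correct φ ρ = mk⇔
      (λ (C , h) → C , λ x C<x → to (eq C x) (h x C<x))
      (λ (C , h) → C , λ x C<x → from (eq C x) (h x C<x))
      where
      σ-correct : ∀ C x i → (x ∷ ρ) i ≈ ⟦ (varᵈ zero ∷ λ i → varᵈ (suc (suc i))) i ⟧ᵈ (x ∷ C ∷ ρ)
      σ-correct C x zero    = ≈.sym (varᵈ-correct zero (x ∷ C ∷ ρ))
      σ-correct C x (suc i) = ≈.sym (varᵈ-correct (suc (suc i)) (x ∷ C ∷ ρ))
      eq : ∀ C x → _ ⇔ _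
      eq C x = substᶠ-correct {ρ = x ∷ C ∷ ρ} (λ a → ≈.sym (constᵈ-correct a (x ∷ C ∷ ρ))) (σ-correct C x) φ

    along-line-correct : ∀ {n} M a (φ : Formula C (suc (suc n))) c ρ →
      Eventually (λ w → ⟦ φ ⟧ (a · w +ᶻ c ∷ M · w ∷ ρ)) ⇔ ⟦ along-line M a φ ⟧ (c ∷ ρ)
    along-line-correct M a φ c ρ = mk⇔
      (λ (C , h) → to (cofinallyᶠ-correct (substᶠ constᵈ (along M a) φ) (c ∷ ρ)) (C , λ w C<w → to (eq w) (h w C<w)))
      (λ p → let C , h = from (cofinallyᶠ-correct (substᶠ constᵈ (along M a) φ) (c ∷ ρ)) p in C , λ w C<w → from (eq w) (h w C<w))
      where
      σ-correct : ∀ w i → (a · w +ᶻ c ∷ M · w ∷ ρ) i ≈ ⟦ along M a i ⟧ᵈ (w ∷ c ∷ ρ)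
      σ-correct w zero = ≈.sym (≈.trans (+ᵈ-correct (a ·ᵈ varᵈ zero) (varᵈ (suc zero)) (w ∷ c ∷ ρ))
        (+-cong (≈.trans (·ᵈ-correct a (varᵈ zero) (w ∷ c ∷ ρ)) (·-cong a (varᵈ-correct zero (w ∷ c ∷ ρ)))) (varᵈ-correct (suc zero) (w ∷ c ∷ ρ))))
      σ-correct w (suc zero) = ≈.sym (≈.trans (·ᵈ-correct M (varᵈ zero) (w ∷ c ∷ ρ)) (·-cong M (varᵈ-correct zero (w ∷ c ∷ ρ))))
      σ-correct w (suc (suc i)) = ≈.sym (varᵈ-correct (suc (suc i)) (w ∷ c ∷ ρ))
      eq : ∀ w → _ ⇔ _
      eq w = substᶠ-correct {ρ = w ∷ c ∷ ρ} (λ a → ≈.sym (constᵈ-correct a (w ∷ c ∷ ρ))) (σ-correct w) φ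

-- Transfer from ℤ

lower-em : ∀ {ℓ} → ExcludedMiddle ℓ → ExcludedMiddle 0ℓ
lower-em {ℓ} em {P} = Dec.map′ lower lift (em {Lift ℓ P})

range : ℕ → List ℤ
range zero    = 0ℤ ∷ˡ []ˡ
range (suc D) = + suc D ∷ˡ -[1+ D ] ∷ˡ range D

range⁺ : ∀ {p} {P : ℤ → Set p} {D a} → ∣ a ∣ ℕ.≤ D → P a → Any P (range D)
range⁺ {D = zero}  {+ zero}   _   p = here p
range⁺ {D = suc D} {a}        a≤D p with ℕ.m≤n⇒m<n∨m≡n a≤D
... | inj₁ (ℕ.s≤s a<D) = there (there (range⁺ a<D p))
range⁺ {D = suc D} {+ .(suc D)} a≤D p | inj₂ ≡.refl = here p
range⁺ {D = suc D} { -[1+ .D ]} a≤D p | inj₂ ≡.refl = there (here p)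

range⁻ : ∀ {p} {P : ℤ → Set p} D → Any P (range D) → ∃[ a ] ∣ a ∣ ℕ.≤ D × P a
range⁻ zero    (here p)            = _ , ℕ.z≤n , p
range⁻ (suc D) (here p)            = _ , ℕ.≤-refl , p
range⁻ (suc D) (there (here p))    = _ , ℕ.≤-refl , p
range⁻ (suc D) (there (there any)) = let a , a≤D , p = range⁻ D any in a , ℕ.m≤n⇒m≤1+n a≤D , p

any-pointwise : ∀ {a b r p q} {A : Set a} {B : Set b} {R : A → B → Set r} {P : A → Set p} {Q : B → Set q} →
  (∀ {x y} → R x y → P x → Q y) → ∀ {xs ys} → Pointwise R xs ys → Any P xs → Any Q ys
any-pointwise f (r ∷ˡ rs) (here p)  = here (f r p)
any-pointwise f (r ∷ˡ rs) (there p) = there (any-pointwise f rs p)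

any-pointwise⁻ : ∀ {a b r p q} {A : Set a} {B : Set b} {R : A → B → Set r} {P : A → Set p} {Q : B → Set q} →
  (∀ {x y} → R x y → Q y → P x) → ∀ {xs ys} → Pointwise R xs ys → Any Q ys → Any P xs
any-pointwise⁻ f (r ∷ˡ rs) (here p)  = here (f r p)
any-pointwise⁻ f (r ∷ˡ rs) (there p) = there (any-pointwise⁻ f rs p)

ℤ-model : PresburgerModel 0ℓ
ℤ-model = record { structure = ℤ-structure ; models = λ _ → id }

module ℤₘ = Model ℤ-model

·≡* : ∀ i x → i ℤₘ.· x ≡ i ℤ.* x
·≡* (+ n) x = positive n
  where
  positive : ∀ n → + n ℤₘ.· x ≡ + n ℤ.* x
  positive zero    = ≡.sym (ℤ.*-zeroˡ x)
  positive (suc n) = ≡.trans (≡.cong (λ z → x ℤ.+ z) (positive n)) (≡.sym (ℤ.suc-* (+ n) x))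
·≡* -[1+ n ] x = ≡.trans (≡.cong ℤ.-_ (·≡* (+ suc n) x)) (ℤ.neg-distribˡ-* (+ suc n) x)

module _ {c} {C : Set c} {n : ℕ} where

  -- Standard slopes up to `D` make the conclusion a finite disjunction; only the intercept, which
  -- may be nonstandard, is left to a quantifier.
  linearityᶠ : List (Formula C (suc (suc n))) → ℕ → ℕ → Formula C n
  linearityᶠ Φ D M = cofinallyᶠ (⋁ (List.map ex Φ)) ⇒
    ⋁ (List.map (λ φ → ⋁ (List.map (λ a → ex (along-line (+ M) a φ)) (range D))) Φ)

module Linearity {ℓ} (Z : PresburgerModel ℓ) {c} {C : Set c} (γ : C → PresburgerModel.Carrier Z) where
  open Model Z
  open Semantics γ
  open Value γ
  open Cofinal γ

  Solvable : ∀ {n} → List (Formula C (suc (suc n))) → Vector Carrier n → Set _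
  Solvable Φ ρ = Eventually (λ x → Any (λ φ → ∃[ y ] ⟦ φ ⟧ (y ∷ x ∷ ρ)) Φ)

  LinearlySolvable : ∀ {n} → List (Formula C (suc (suc n))) → ℕ → ℕ → Vector Carrier n → Set _
  LinearlySolvable Φ D M ρ = Any (λ φ → ∃[ a ] ∣ a ∣ ℕ.≤ D × ∃[ c ]
    Eventually (λ w → ⟦ φ ⟧ (a · w +ᶻ c ∷ + M · w ∷ ρ))) Φ

  linearityᶠ-correct : ∀ {n} (Φ : List (Formula C (suc (suc n)))) D M ρ →
    (Solvable Φ ρ → LinearlySolvable Φ D M ρ) ⇔ ⟦ linearityᶠ Φ D M ⟧ ρ
  linearityᶠ-correct {n} Φ D M ρ = mk⇔
    (λ h → conclusion⁺ ∘ h ∘ premise⁻) (λ h → conclusion⁻ ∘ h ∘ premise⁺)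
    where
    line : ℤ → Formula C (suc (suc n)) → Formula C (suc n)
    line a φ = along-line (+ M) a φ
    premise⁺ : Solvable Φ ρ → ⟦ cofinallyᶠ (⋁ (List.map ex Φ)) ⟧ ρ
    premise⁺ (C , h) = to (cofinallyᶠ-correct (⋁ (List.map ex Φ)) ρ)
      (C , λ x C<x → to (⋁-correct (List.map ex Φ) (x ∷ ρ)) (Any.map⁺ (h x C<x)))
    premise⁻ : ⟦ cofinallyᶠ (⋁ (List.map ex Φ)) ⟧ ρ → Solvable Φ ρ
    premise⁻ p = let C , h = from (cofinallyᶠ-correct (⋁ (List.map ex Φ)) ρ) p in
      C , λ x C<x → Any.map⁻ (from (⋁-correct (List.map ex Φ) (x ∷ ρ)) (h x C<x))
    conclusion⁺ : LinearlySolvable Φ D M ρ → ⟦ ⋁ (List.map (λ φ → ⋁ (List.map (λ a → ex (line a φ)) (range D))) Φ) ⟧ ρ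
    conclusion⁺ p = to (⋁-correct (List.map (λ φ → ⋁ (List.map (λ a → ex (line a φ)) (range D))) Φ) ρ)
      (Any.map⁺ (Any.map (λ {φ} (a , a≤D , c , h) →
        to (⋁-correct (List.map (λ a → ex (line a φ)) (range D)) ρ)
          (Any.map⁺ (range⁺ {P = λ a → ⟦ ex (line a φ) ⟧ ρ} a≤D (c , to (along-line-correct (+ M) a φ c ρ) h)))) p))
    conclusion⁻ : ⟦ ⋁ (List.map (λ φ → ⋁ (List.map (λ a → ex (line a φ)) (range D))) Φ) ⟧ ρ → LinearlySolvable Φ D M ρ
    conclusion⁻ p = Any.map (λ {φ} q →
        let a , a≤D , c , h = range⁻ D (Any.map⁻ (from (⋁-correct (List.map (λ a → ex (line a φ)) (range D)) ρ) q))
        in a , a≤D , c , from (along-line-correct (+ M) a φ c ρ) h)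
      (Any.map⁻ (from (⋁-correct (List.map (λ φ → ⋁ (List.map (λ a → ex (line a φ)) (range D))) Φ) ρ) p))

ℤ-linearity : ExcludedMiddle 0ℓ → ∀ {n} (Φ : List (Formula Empty (suc (suc n)))) →
  ∃[ D ] ∃[ M ] NonZero M × (∀ ρ → ⟦ linearityᶠ Φ D M ⟧ℤ ρ)
ℤ-linearity em Φ = slope , modulus , modulus≢0 , λ ρ → to (linearityᶠ-correct Φ slope modulus ρ)
  λ h → Any.map (λ {φ} (a , a≤D , c , C , k) → a , a≤D , c , C , λ w C<w →
      ℤₘ.formula-resp (λ _ → ≡.refl) φ
        (λ { zero → ≡.cong (λ z → z ℤ.+ c) (≡.sym (·≡* a w)) ; (suc zero) → ≡.sym (·≡* (+ modulus) w) ; (suc (suc i)) → ≡.refl })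
        (k w C<w))
    (solve ρ h)
  where
  open LinearSolutions (linear-solutions em Φ)
  open Linearity ℤ-model no-constants

constantsᵗ : ∀ {c} {C : Set c} {n} → Term C n → List C
constantsᵗ (var i)   = []ˡ
constantsᵗ (const a) = a ∷ˡ []ˡ
constantsᵗ (s ⊕ t)   = constantsᵗ s ++ˡ constantsᵗ t

constants : ∀ {c} {C : Set c} {n} → Formula C n → List C
constants (s ≐ t) = constantsᵗ s ++ˡ constantsᵗ t
constants (s ≺ t) = constantsᵗ s ++ˡ constantsᵗ t
constants falsum  = []ˡ
constants (φ ∧ ψ) = constants φ ++ˡ constants ψ
constants (φ ∨ ψ) = constants φ ++ˡ constants ψ
constants (φ ⇒ ψ) = constants φ ++ˡ constants ψ
constants (all φ) = constants φ
constants (ex φ)  = constants φ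

module _ {c} {C : Set c} (xs : List C) where

  -- Only formulas without parameters can be compared between ℤ and `Z`, so constants become
  -- additional variables, numbered by their place in `xs`.
  pureᵗ : ∀ {n} (t : Term C n) → constantsᵗ t ⊆ xs → Term Empty (n ℕ.+ List.length xs)
  pureᵗ     (var i)   h = var (i ↑ˡ List.length xs)
  pureᵗ {n} (const a) h = var (n ↑ʳ Any.index (h (here ≡.refl)))
  pureᵗ     (s ⊕ t)   h = pureᵗ s (h ∘ ∈-++⁺ˡ) ⊕ pureᵗ t (h ∘ ∈-++⁺ʳ (constantsᵗ s))

  pure : ∀ {n} (φ : Formula C n) → constants φ ⊆ xs → Formula Empty (n ℕ.+ List.length xs)
  pure (s ≐ t) h = pureᵗ s (h ∘ ∈-++⁺ˡ) ≐ pureᵗ t (h ∘ ∈-++⁺ʳ (constantsᵗ s))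
  pure (s ≺ t) h = pureᵗ s (h ∘ ∈-++⁺ˡ) ≺ pureᵗ t (h ∘ ∈-++⁺ʳ (constantsᵗ s))
  pure falsum  h = falsum
  pure (φ ∧ ψ) h = pure φ (h ∘ ∈-++⁺ˡ) ∧ pure ψ (h ∘ ∈-++⁺ʳ (constants φ))
  pure (φ ∨ ψ) h = pure φ (h ∘ ∈-++⁺ˡ) ∨ pure ψ (h ∘ ∈-++⁺ʳ (constants φ))
  pure (φ ⇒ ψ) h = pure φ (h ∘ ∈-++⁺ˡ) ⇒ pure ψ (h ∘ ∈-++⁺ʳ (constants φ))
  pure (all φ) h = all (pure φ h)
  pure (ex φ)  h = ex (pure φ h)

module Transfer {ℓ} (Z : PresburgerModel ℓ) where
  open Model Z
  open Semantics (no-constants {A = Carrier}) renaming (⟦_⟧ to ⟦_⟧₀; ⟦_⟧ᵗ to ⟦_⟧₀ᵗ)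

  -- Free variables are bound universally one at a time until a sentence is left.
  transfer : ∀ n (φ : Formula Empty n) → (∀ ρ → ⟦ φ ⟧ℤ ρ) → ∀ ρ → ⟦ φ ⟧₀ ρ
  transfer zero φ h ρ = formula-resp (λ ()) φ (λ ())
    (models φ (ℤₘ.formula-resp (λ ()) φ (λ ()) (h [])))
  transfer (suc n) φ h ρ = formula-resp (λ ()) φ (λ { zero → ≈.refl ; (suc i) → ≈.refl })
    (transfer n (all φ) (λ ρ x → h (x ∷ ρ)) (tail ρ) (head ρ))

  module _ {c} {C : Set c} (γ : C → Carrier) (xs : List C) where
    open Semantics γ

    Combines : ∀ {n} → Vector Carrier n → Vector Carrier (n ℕ.+ List.length xs) → Set ℓ
    Combines {n} ρ τ = (∀ i → τ (i ↑ˡ List.length xs) ≈ ρ i) × (∀ j → τ (n ↑ʳ j) ≈ γ (List.lookup xs j))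

    combines-∷ : ∀ {n} {ρ : Vector Carrier n} {τ} → Combines ρ τ → ∀ x → Combines (x ∷ ρ) (x ∷ τ)
    combines-∷ (l , r) x = (λ { zero → ≈.refl ; (suc i) → l i }) , r

    combines-++ : ∀ {n} (ρ : Vector Carrier n) → Combines ρ (ρ ++ (γ ∘ List.lookup xs))
    combines-++ ρ = (λ i → ≈.reflexive (lookup-++ˡ ρ (γ ∘ List.lookup xs) i)) ,
                    (λ j → ≈.reflexive (lookup-++ʳ ρ (γ ∘ List.lookup xs) j))

    pureᵗ-correct : ∀ {n} (t : Term C n) (h : constantsᵗ t ⊆ xs) {ρ τ} → Combines ρ τ → ⟦ pureᵗ xs t h ⟧₀ᵗ τ ≈ ⟦ t ⟧ᵗ ρ
    pureᵗ-correct (var i)   h (l , r) = l i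
    pureᵗ-correct (const a) h (l , r) = ≈.trans (r _) (≈.reflexive (≡.cong γ (≡.sym (Any.lookup-index (h (here ≡.refl))))))
    pureᵗ-correct (s ⊕ t)   h k = +-cong (pureᵗ-correct s (h ∘ ∈-++⁺ˡ) k) (pureᵗ-correct t (h ∘ ∈-++⁺ʳ (constantsᵗ s)) k)

    pure-correct : ∀ {n} (φ : Formula C n) (h : constants φ ⊆ xs) {ρ τ} → Combines ρ τ → ⟦ φ ⟧ ρ ⇔ ⟦ pure xs φ h ⟧₀ τ
    pure-correct (s ≐ t) h k = mk⇔
      (λ e → ≈.trans (pureᵗ-correct s (h ∘ ∈-++⁺ˡ) k) (≈.trans e (≈.sym (pureᵗ-correct t (h ∘ ∈-++⁺ʳ (constantsᵗ s)) k))))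
      (λ e → ≈.trans (≈.sym (pureᵗ-correct s (h ∘ ∈-++⁺ˡ) k)) (≈.trans e (pureᵗ-correct t (h ∘ ∈-++⁺ʳ (constantsᵗ s)) k)))
    pure-correct (s ≺ t) h k = mk⇔
      (<-resp (≈.sym (pureᵗ-correct s (h ∘ ∈-++⁺ˡ) k)) (≈.sym (pureᵗ-correct t (h ∘ ∈-++⁺ʳ (constantsᵗ s)) k)))
      (<-resp (pureᵗ-correct s (h ∘ ∈-++⁺ˡ) k) (pureᵗ-correct t (h ∘ ∈-++⁺ʳ (constantsᵗ s)) k))
    pure-correct falsum h k = mk⇔ (λ ()) (λ ())
    pure-correct (φ ∧ ψ) h k = mk⇔
      (λ (p , q) → to (pure-correct φ (h ∘ ∈-++⁺ˡ) k) p , to (pure-correct ψ (h ∘ ∈-++⁺ʳ (constants φ)) k) q)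
      (λ (p , q) → from (pure-correct φ (h ∘ ∈-++⁺ˡ) k) p , from (pure-correct ψ (h ∘ ∈-++⁺ʳ (constants φ)) k) q)
    pure-correct (φ ∨ ψ) h k = mk⇔
      (Sum.map (to (pure-correct φ (h ∘ ∈-++⁺ˡ) k)) (to (pure-correct ψ (h ∘ ∈-++⁺ʳ (constants φ)) k)))
      (Sum.map (from (pure-correct φ (h ∘ ∈-++⁺ˡ) k)) (from (pure-correct ψ (h ∘ ∈-++⁺ʳ (constants φ)) k)))
    pure-correct (φ ⇒ ψ) h k = mk⇔
      (λ f → to (pure-correct ψ (h ∘ ∈-++⁺ʳ (constants φ)) k) ∘ f ∘ from (pure-correct φ (h ∘ ∈-++⁺ˡ) k))
      (λ f → from (pure-correct ψ (h ∘ ∈-++⁺ʳ (constants φ)) k) ∘ f ∘ to (pure-correct φ (h ∘ ∈-++⁺ˡ) k))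
    pure-correct (all φ) h k = mk⇔
      (λ f x → to (pure-correct φ h (combines-∷ k x)) (f x))
      (λ f x → from (pure-correct φ h (combines-∷ k x)) (f x))
    pure-correct (ex φ) h k = mk⇔
      (λ (x , p) → x , to (pure-correct φ h (combines-∷ k x)) p)
      (λ (x , p) → x , from (pure-correct φ h (combines-∷ k x)) p)

    PureOf : ∀ {n} → Formula C n → Formula Empty (n ℕ.+ List.length xs) → Set _
    PureOf φ ψ = ∀ {ρ τ} → Combines ρ τ → ⟦ φ ⟧ ρ ⇔ ⟦ ψ ⟧₀ τ

    pure-all : ∀ {n} (Φ : List (Formula C n)) → (∀ {a} → Any (λ φ → a ∈ constants φ) Φ → a ∈ xs) →
               ∃[ Ψ ] Pointwise PureOf Φ Ψ
    pure-all []ˡ      h = []ˡ , []ˡ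
    pure-all (φ ∷ˡ Φ) h = let Ψ , r = pure-all Φ (h ∘ there) in
      pure xs φ (h ∘ here) ∷ˡ Ψ , pure-correct φ (h ∘ here) ∷ˡ r

  module _ (em : ExcludedMiddle 0ℓ) {c} {C : Set c} (γ : C → Carrier) where
    open Linearity Z γ
    open Semantics γ
    private module L₀ = Linearity Z (no-constants {A = Carrier})

    -- The `D` and `M` found over ℤ serve every value of the variables that stand for the
    -- parameters, hence also the actual parameters in `Z`.
    linearity : ∀ {n} (Φ : List (Formula C (suc (suc n)))) →
      ∃[ D ] ∃[ M ] NonZero M × (∀ ρ → Solvable Φ ρ → LinearlySolvable Φ D M ρ)
    linearity {n} Φ = D , M , M≢0 , λ ρ (K , h) →
      let τ = ρ ++ (γ ∘ List.lookup xs)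
          k = combines-++ γ xs ρ
      in any-pointwise⁻ (λ r (a , a≤D , c , K , h) → a , a≤D , c , K , λ w K<w →
             from (r (combines-∷ γ xs (combines-∷ γ xs {τ = τ} k _) _)) (h w K<w)) Φ~Ψ
         (from (L₀.linearityᶠ-correct Ψ D M τ) (transfer (n ℕ.+ List.length xs) (linearityᶠ Ψ D M) valid τ)
           (K , λ x K<x → any-pointwise (λ r (y , p) → y , to (r (combines-∷ γ xs (combines-∷ γ xs {τ = τ} k x) y)) p) Φ~Ψ (h x K<x)))
      where
      xs : List C
      xs = List.concatMap constants Φ
      Ψ : List (Formula Empty (suc (suc n) ℕ.+ List.length xs))
      Ψ = proj₁ (pure-all γ xs Φ (Any.concatMap⁺ constants))
      Φ~Ψ : Pointwise (PureOf γ xs) Φ Ψ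
      Φ~Ψ = proj₂ (pure-all γ xs Φ (Any.concatMap⁺ constants))
      D = proj₁ (ℤ-linearity em Ψ)
      M = proj₁ (proj₂ (ℤ-linearity em Ψ))
      M≢0 = proj₁ (proj₂ (proj₂ (ℤ-linearity em Ψ)))
      valid = proj₂ (proj₂ (proj₂ (ℤ-linearity em Ψ)))

-- Definable predicates, and linear solutions at infinity

∷-++ : ∀ {a} {A : Set a} {m n} x (v : Vector A m) (ρ : Vector A n) i → ((x ∷ v) ++ ρ) i ≡ (x ∷ (v ++ ρ)) i
∷-++     x v ρ zero    = ≡.refl
∷-++ {m = m} x v ρ (suc i) with splitAt m i
... | inj₁ _ = ≡.refl
... | inj₂ _ = ≡.refl

module Definability {ℓ} (Z : PresburgerModel ℓ) where

  open Model Z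
  open Semantics {C = Carrier} id
  open Value {C = Carrier} id
  open Substitution {C = Carrier} {D = Carrier} id id
  open Cofinal {C = Carrier} id

  infix 4 _≋_
  _≋_ : ∀ {n} → Vector Carrier n → Vector Carrier n → Set ℓ
  x ≋ y = ∀ i → x i ≈ y i

  ≋-sym : ∀ {n} {x y : Vector Carrier n} → x ≋ y → y ≋ x
  ≋-sym h i = ≈.sym (h i)

  ≋-trans : ∀ {n} {x y z : Vector Carrier n} → x ≋ y → y ≋ z → x ≋ z
  ≋-trans h k i = ≈.trans (h i) (k i)

  ∷-cong : ∀ {n x y} {ρ ρ′ : Vector Carrier n} → x ≈ y → ρ ≋ ρ′ → (x ∷ ρ) ≋ (y ∷ ρ′)
  ∷-cong e h zero    = e
  ∷-cong e h (suc i) = h i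

  head-tail : ∀ {n} (y : Vector Carrier (suc n)) → y ≋ (head y ∷ tail y)
  head-tail y zero    = ≈.refl
  head-tail y (suc i) = ≈.refl

  ++-cong : ∀ {m n} {x x′ : Vector Carrier m} {y y′ : Vector Carrier n} → x ≋ x′ → y ≋ y′ → (x ++ y) ≋ (x′ ++ y′)
  ++-cong {m} h k i with splitAt m i
  ... | inj₁ j = h j
  ... | inj₂ j = k j

  resp : ∀ {n} (φ : Formula Carrier n) {ρ ρ′} → ρ ≋ ρ′ → ⟦ φ ⟧ ρ → ⟦ φ ⟧ ρ′
  resp φ = formula-resp (λ _ → ≈.refl) φ

  infixl 6 _⊞_
  _⊞_ : ∀ {n} → Vector Carrier n → Vector Carrier n → Vector Carrier n
  (x ⊞ y) i = x i +ᶻ y i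

  infixr 7 _⊡_
  _⊡_ : ∀ {n} → ℤ → Vector Carrier n → Vector Carrier n
  (k ⊡ x) i = k · x i

  -- Environments keep their blocks of variables apart, and only `eval` flattens them. A predicate
  -- can then be an ordinary function of its blocks, its formula being assembled by the combinators
  -- without counting variables.
  record Context : Set (lsuc ℓ) where
    field
      Env  : Set ℓ
      size : ℕ
      eval : Env → Vector Carrier size
  open Context

  ⟨_⟩ : ℕ → Context
  ⟨ n ⟩ = record { Env = Vector Carrier n ; size = n ; eval = id }

  infixl 5 _▹_
  _▹_ : Context → ℕ → Context
  Γ ▹ k = record { Env = Vector Carrier k × Env Γ ; size = k ℕ.+ size Γ ; eval = λ (y , ε) → y ++ eval Γ ε }

  Definable : (Γ : Context) → (Env Γ → Set ℓ) → Set ℓ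
  Definable Γ P = Σ (Formula Carrier (size Γ)) λ φ → ∀ ε → P ε ⇔ ⟦ φ ⟧ (eval Γ ε)

  Affine : (Γ : Context) → (Env Γ → Carrier) → Set ℓ
  Affine Γ f = Σ (DTerm Carrier (size Γ)) λ d → ∀ ε → f ε ≈ ⟦ d ⟧ᵈ (eval Γ ε)

  Affineⱽ : (Γ : Context) → ∀ {k} → (Env Γ → Vector Carrier k) → Set ℓ
  Affineⱽ Γ F = ∀ i → Affine Γ (λ ε → F ε i)

  -- No formula separates vectors with equal entries, so definability alone supplies the congruence
  -- property of every predicate used later.
  def-resp : ∀ {Γ P} → Definable Γ P → ∀ {ε ε′} → eval Γ ε ≋ eval Γ ε′ → P ε → P ε′
  def-resp (φ , h) e p = from (h _) (resp φ e (to (h _) p))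

  def-⇔ : ∀ {Γ P Q} → (∀ ε → Q ε ⇔ P ε) → Definable Γ P → Definable Γ Q
  def-⇔ e (φ , h) = φ , λ ε → mk⇔ (to (h ε) ∘ to (e ε)) (from (e ε) ∘ from (h ε))

  module _ {Γ : Context} where

    affine-const : ∀ a → Affine Γ (λ _ → a)
    affine-const a = constᵈ a , λ ε → ≈.sym (constᵈ-correct a (eval Γ ε))

    affine-var : ∀ i → Affine Γ (λ ε → eval Γ ε i)
    affine-var i = varᵈ i , λ ε → ≈.sym (varᵈ-correct i (eval Γ ε))

    affine-+ : ∀ {f g} → Affine Γ f → Affine Γ g → Affine Γ (λ ε → f ε +ᶻ g ε)
    affine-+ (d , h) (e , k) = d +ᵈ e , λ ε → ≈.trans (+-cong (h ε) (k ε)) (≈.sym (+ᵈ-correct d e (eval Γ ε)))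

    affine-· : ∀ {f} k → Affine Γ f → Affine Γ (λ ε → k · f ε)
    affine-· k (d , h) = k ·ᵈ d , λ ε → ≈.trans (·-cong k (h ε)) (≈.sym (·ᵈ-correct k d (eval Γ ε)))

    affine-combination : ∀ {n} (a : Vector ℤ n) {F} → Affineⱽ Γ F → Affine Γ (λ ε → combination a (F ε))
    affine-combination {zero}  a h = affine-const 0ᶻ
    affine-combination {suc n} a h = affine-+ (affine-· (head a) (h zero)) (affine-combination (tail a) (h ∘ suc))

    affine-++ : ∀ {k l} {F : Env Γ → Vector Carrier k} {G : Env Γ → Vector Carrier l} →
                Affineⱽ Γ F → Affineⱽ Γ G → Affineⱽ Γ (λ ε → F ε ++ G ε)
    affine-++ {k} {F = F} {G} hF hG i = split (splitAt k i)
      where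
      split : ∀ s → Affine Γ (λ ε → [ F ε , G ε ] s)
      split (inj₁ j) = hF j
      split (inj₂ j) = hG j

    def-substitute : ∀ {Δ P} {σ : Env Γ → Env Δ} → Definable Δ P → Affineⱽ Γ (λ ε → eval Δ (σ ε)) →
                     Definable Γ (λ ε → P (σ ε))
    def-substitute {σ = σ} (φ , h) aff = substᶠ constᵈ (λ i → proj₁ (aff i)) φ , λ ε →
      let e = substᶠ-correct {ρ = eval Γ ε} (λ a → ≈.sym (constᵈ-correct a (eval Γ ε))) (λ i → proj₂ (aff i) ε) φ
      in mk⇔ (to e ∘ to (h (σ ε))) (from (h (σ ε)) ∘ from e)

    def-≈ : ∀ {f g} → Affine Γ f → Affine Γ g → Definable Γ (λ ε → f ε ≈ g ε)
    def-≈ (d , h) (e , k) = (d ≐ᵈ e) , λ ε → mk⇔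
      (λ p → to (≐ᵈ-correct d e (eval Γ ε)) (≈.trans (≈.sym (h ε)) (≈.trans p (k ε))))
      (λ p → ≈.trans (h ε) (≈.trans (from (≐ᵈ-correct d e (eval Γ ε)) p) (≈.sym (k ε))))

    def-< : ∀ {f g} → Affine Γ f → Affine Γ g → Definable Γ (λ ε → f ε < g ε)
    def-< (d , h) (e , k) = (d ≺ᵈ e) , λ ε → mk⇔
      (λ p → to (≺ᵈ-correct d e (eval Γ ε)) (<-resp (h ε) (k ε) p))
      (λ p → <-resp (≈.sym (h ε)) (≈.sym (k ε)) (from (≺ᵈ-correct d e (eval Γ ε)) p))

    def-⊥ : Definable Γ (λ _ → ⊥)
    def-⊥ = falsum , λ ε → mk⇔ id id

    def-∧ : ∀ {P Q} → Definable Γ P → Definable Γ Q → Definable Γ (λ ε → P ε × Q ε)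
    def-∧ (φ , h) (ψ , k) = (φ ∧ ψ) , λ ε → mk⇔
      (λ (p , q) → to (h ε) p , to (k ε) q) (λ (p , q) → from (h ε) p , from (k ε) q)

    def-∨ : ∀ {P Q} → Definable Γ P → Definable Γ Q → Definable Γ (λ ε → P ε ⊎ Q ε)
    def-∨ (φ , h) (ψ , k) = (φ ∨ ψ) , λ ε → mk⇔
      (Sum.map (to (h ε)) (to (k ε))) (Sum.map (from (h ε)) (from (k ε)))

    def-→ : ∀ {P Q} → Definable Γ P → Definable Γ Q → Definable Γ (λ ε → P ε → Q ε)
    def-→ (φ , h) (ψ , k) = (φ ⇒ ψ) , λ ε → mk⇔
      (λ f p → to (k ε) (f (from (h ε) p))) (λ f p → from (k ε) (f (to (h ε) p)))

    def-Π : ∀ n {P : Fin n → Env Γ → Set ℓ} → (∀ i → Definable Γ (P i)) → Definable Γ (λ ε → ∀ i → P i ε)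
    def-Π zero    h = (falsum ⇒ falsum) , λ ε → mk⇔ (λ _ → id) (λ _ ())
    def-Π (suc n) h = def-⇔ (λ ε → mk⇔ (λ p → p zero , p ∘ suc) (λ { (p , q) zero → p ; (p , q) (suc i) → q i }))
                            (def-∧ (h zero) (def-Π n (h ∘ suc)))

    def-Σ : ∀ n {P : Fin n → Env Γ → Set ℓ} → (∀ i → Definable Γ (P i)) → Definable Γ (λ ε → ∃[ i ] P i ε)
    def-Σ zero    h = falsum , λ ε → mk⇔ (λ ()) (λ ())
    def-Σ (suc n) h = def-⇔ (λ ε → mk⇔ (λ { (zero , p) → inj₁ p ; (suc i , p) → inj₂ (i , p) })
                                       (λ { (inj₁ p) → zero , p ; (inj₂ (i , p)) → suc i , p }))
                            (def-∨ (h zero) (def-Σ n (h ∘ suc)))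

    affine-new : ∀ {k} → Affineⱽ (Γ ▹ k) proj₁
    affine-new i = varᵈ (i ↑ˡ size Γ) , λ (y , ε) →
      ≈.trans (≈.reflexive (≡.sym (lookup-++ˡ y (eval Γ ε) i))) (≈.sym (varᵈ-correct (i ↑ˡ size Γ) (y ++ eval Γ ε)))

    affine-env : ∀ {k} → Affineⱽ (Γ ▹ k) (eval Γ ∘ proj₂)
    affine-env {k} i = varᵈ (k ↑ʳ i) , λ (y , ε) →
      ≈.trans (≈.reflexive (≡.sym (lookup-++ʳ y (eval Γ ε) i))) (≈.sym (varᵈ-correct (k ↑ʳ i) (y ++ eval Γ ε)))

    affine-old : ∀ {k f} → Affine Γ f → Affine (Γ ▹ k) (f ∘ proj₂)
    affine-old {k} {f} (d , h) =
      let d′ = substᵗ constᵈ (proj₁ ∘ affine-env {k}) (proj₁ d) -ᵈ substᵗ constᵈ (proj₁ ∘ affine-env {k}) (proj₂ d)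
      in d′ , λ (y , ε) →
        let τ = y ++ eval Γ ε
            sub = λ t → substᵗ-correct {κ = constᵈ} {σ = proj₁ ∘ affine-env {k}} {ρ = τ}
                          (λ a → ≈.sym (constᵈ-correct a τ)) (λ i → proj₂ (affine-env {k} i) (y , ε)) t
        in ≈.trans (h ε) (≈.trans (+-cong (sub (proj₁ d)) (-‿cong (sub (proj₂ d))))
             (≈.sym (-ᵈ-correct (substᵗ constᵈ (proj₁ ∘ affine-env {k}) (proj₁ d)) (substᵗ constᵈ (proj₁ ∘ affine-env {k}) (proj₂ d)) τ)))

    exⁿ : ∀ {n} k → Formula Carrier (k ℕ.+ n) → Formula Carrier n
    exⁿ zero    φ = φ
    exⁿ (suc k) φ = exⁿ k (ex φ)

    exⁿ⁺ : ∀ {n} k (φ : Formula Carrier (k ℕ.+ n)) ρ y → ⟦ φ ⟧ (y ++ ρ) → ⟦ exⁿ k φ ⟧ ρ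
    exⁿ⁺ zero    φ ρ y p = p
    exⁿ⁺ (suc k) φ ρ y p = exⁿ⁺ k (ex φ) ρ (tail y) (head y ,
      resp φ (≋-trans (++-cong {x = y} {head y ∷ tail y} {ρ} (head-tail y) (λ _ → ≈.refl))
                      (λ i → ≈.reflexive (∷-++ (head y) (tail y) ρ i))) p)

    exⁿ⁻ : ∀ {n} k (φ : Formula Carrier (k ℕ.+ n)) ρ → ⟦ exⁿ k φ ⟧ ρ → ∃[ y ] ⟦ φ ⟧ (y ++ ρ)
    exⁿ⁻ zero    φ ρ p = [] , p
    exⁿ⁻ (suc k) φ ρ p = let y , x , q = exⁿ⁻ k (ex φ) ρ p in
      (x ∷ y) , resp φ (λ i → ≈.reflexive (≡.sym (∷-++ x y ρ i))) q

    def-∃ : ∀ k {P : Vector Carrier k → Env Γ → Set ℓ} → Definable (Γ ▹ k) (λ (y , ε) → P y ε) →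
            Definable Γ (λ ε → ∃[ y ] P y ε)
    def-∃ k (φ , h) = exⁿ k φ , λ ε → mk⇔
      (λ (y , p) → exⁿ⁺ k φ _ y (to (h (y , ε)) p))
      (λ p → let y , q = exⁿ⁻ k φ _ p in y , from (h (y , ε)) q)

    def-∀ : ∀ {P : Carrier → Env Γ → Set ℓ} → Definable (Γ ▹ 1) (λ (y , ε) → P (head y) ε) →
            Definable Γ (λ ε → ∀ x → P x ε)
    def-∀ (φ , h) = all φ , λ ε → mk⇔
      (λ p x → resp φ (single x ε) (to (h ((x ∷ []) , ε)) (p x)))
      (λ p x → from (h ((x ∷ []) , ε)) (resp φ (≋-sym (single x ε)) (p x)))
      where
      single : ∀ x ε → ((x ∷ []) ++ eval Γ ε) ≋ (x ∷ eval Γ ε)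
      single x ε i = ≈.reflexive (∷-++ x [] (eval Γ ε) i)

  -- The head is quantified innermost: v i is large compared with v (i + 1).
  Eventuallyⁿ : ∀ m → (Vector Carrier m → Set ℓ) → Set ℓ
  Eventuallyⁿ zero    P = P []
  Eventuallyⁿ (suc m) P = Eventuallyⁿ m (λ v → Eventually (λ x → P (x ∷ v)))

  def-Eventuallyⁿ : ∀ {Γ} m {P : Vector Carrier m → Env Γ → Set ℓ} → Definable (Γ ▹ m) (λ (v , ε) → P v ε) →
                    Definable Γ (λ ε → Eventuallyⁿ m (λ v → P v ε))
  def-Eventuallyⁿ zero {P} (φ , h) = φ , λ ε → h ([] , ε)
  def-Eventuallyⁿ {Γ} (suc m) {P} (φ , h) = def-Eventuallyⁿ m (cofinallyᶠ φ , λ (v , ε) → mk⇔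
    (λ (C , k) → to (cofinallyᶠ-correct φ (v ++ eval Γ ε))
      (C , λ x C<x → resp φ (λ i → ≈.reflexive (∷-++ x v (eval Γ ε) i)) (to (h ((x ∷ v) , ε)) (k x C<x))))
    (λ p → let C , k = from (cofinallyᶠ-correct φ (v ++ eval Γ ε)) p in
      C , λ x C<x → from (h ((x ∷ v) , ε)) (resp φ (λ i → ≈.reflexive (≡.sym (∷-++ x v (eval Γ ε) i))) (k x C<x))))

  0<⇒<-+ : ∀ {x} y → 0ᶻ < x → y < x +ᶻ y
  0<⇒<-+ y 0<x = <-resp (+-identityˡ y) ≈.refl (+-monoʳ-< y 0<x)

  multiple-large : ∀ {C x} k → 0ᶻ < x → C < x → C < + suc k · x
  multiple-large {x = x} zero    0<x C<x = <-resp ≈.refl (≈.sym (+-identityʳ x)) C<x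
  multiple-large {x = x} (suc k) 0<x C<x = <-trans (multiple-large k 0<x C<x) (0<⇒<-+ (+ suc k · x) 0<x)

  upper-bound : ∀ x y → ∃[ z ] (∀ w → z < w → x < w × y < w)
  upper-bound x y with trichotomous x y
  ... | inj₁ x<y        = y , λ w y<w → <-trans x<y y<w , y<w
  ... | inj₂ (inj₁ x≈y) = y , λ w y<w → <-resp (≈.sym x≈y) ≈.refl y<w , y<w
  ... | inj₂ (inj₂ y<x) = x , λ w x<w → x<w , <-trans y<x x<w

  eventually-× : ∀ {P Q : Carrier → Set ℓ} → Eventually P → Eventually Q → Eventually (λ x → P x × Q x)
  eventually-× (C , p) (D , q) = let E , h = upper-bound C D in
    E , λ x E<x → p x (proj₁ (h x E<x)) , q x (proj₂ (h x E<x))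

  eventually-map : ∀ {P Q : Carrier → Set ℓ} → (∀ x → P x → Q x) → Eventually P → Eventually Q
  eventually-map f (C , h) = C , λ x C<x → f x (h x C<x)

  eventually-shift : ∀ {P : Carrier → Set ℓ} d → Eventually P → Eventually (λ x → P (x +ᶻ d))
  eventually-shift d (C , h) = C - d , λ x C-d<x → h (x +ᶻ d) (<-resp (sub-+ C d) ≈.refl (+-monoʳ-< d C-d<x))

  eventually-scale : ∀ {P : Carrier → Set ℓ} k .{{_ : NonZero k}} → Eventually P → Eventually (λ x → P (+ k · x))
  -- The threshold must also pass zero: a positive multiple of `x` is at least `x` only if `x` is
  -- not negative.
  eventually-scale (suc k) (C , h) = let D , g = upper-bound C 0ᶻ in
    D , λ x D<x → h (+ suc k · x) (multiple-large k (proj₂ (g x D<x)) (proj₁ (g x D<x)))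

  eventually-witness : ∀ {P : Carrier → Set ℓ} → Eventually P → ∃[ x ] P x
  eventually-witness (C , h) = let x , C<x = exceeds C in x , h x C<x

  Respects : ∀ {m} → (Vector Carrier m → Set ℓ) → Set ℓ
  Respects P = ∀ {v v′} → v ≋ v′ → P v → P v′

  respects-tail : ∀ {m} {P : Vector Carrier (suc m) → Set ℓ} → Respects P → Respects (λ v → Eventually (λ x → P (x ∷ v)))
  respects-tail r e = eventually-map (λ x → r (∷-cong ≈.refl e))

  ev-map : ∀ m {P Q : Vector Carrier m → Set ℓ} → (∀ v → P v → Q v) → Eventuallyⁿ m P → Eventuallyⁿ m Q
  ev-map zero    f p = f [] p
  ev-map (suc m) f p = ev-map m (λ v → eventually-map (λ x → f (x ∷ v))) p

  ev-× : ∀ m {P Q : Vector Carrier m → Set ℓ} → Eventuallyⁿ m P → Eventuallyⁿ m Q → Eventuallyⁿ m (λ v → P v × Q v)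
  ev-× zero    p q = p , q
  ev-× (suc m) p q = ev-map m (λ v (p , q) → eventually-× p q) (ev-× m p q)

  ev-witness : ∀ m {P : Vector Carrier m → Set ℓ} → Eventuallyⁿ m P → ∃[ v ] P v
  ev-witness zero    p = [] , p
  ev-witness (suc m) p = let v , q = ev-witness m p ; x , r = eventually-witness q in (x ∷ v) , r

  -- The threshold for the head may depend on the tail, but it exists for the translated tail too.
  -- The vector `d` may have nonstandard entries; this is what later allows translations by all of
  -- Zⁿ.
  ev-shift : ∀ m {P : Vector Carrier m → Set ℓ} → Respects P → ∀ d → Eventuallyⁿ m P → Eventuallyⁿ m (λ v → P (v ⊞ d))
  ev-shift zero    r d p = r (λ ()) p
  ev-shift (suc m) {P} r d p =
    ev-map m (λ v q → eventually-map (λ x → r (λ { zero → ≈.refl ; (suc i) → ≈.refl })) (eventually-shift (head d) q))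
      (ev-shift m (respects-tail r) (tail d) p)

  ev-scale : ∀ m {P : Vector Carrier m → Set ℓ} → Respects P → ∀ k .{{_ : NonZero k}} →
             Eventuallyⁿ m P → Eventuallyⁿ m (λ v → P (+ k ⊡ v))
  ev-scale zero    r k p = r (λ ()) p
  ev-scale (suc m) {P} r k p =
    ev-map m (λ v q → eventually-map (λ x → r (λ { zero → ≈.refl ; (suc i) → ≈.refl })) (eventually-scale k q))
      (ev-scale m (respects-tail r) k p)

  -- In `x ++ u` the block `u` comes last and is therefore chosen first: `x` is large compared with
  -- `u`.
  ev-split : ∀ a b {P : Vector Carrier (a ℕ.+ b) → Set ℓ} → Respects P →
             Eventuallyⁿ (a ℕ.+ b) P → Eventuallyⁿ b (λ u → Eventuallyⁿ a (λ x → P (x ++ u)))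
  ev-split zero    b r p = ev-map b (λ u → r (λ i → ≈.refl)) p
  ev-split (suc a) b r p = ev-map b (λ u → ev-map a (λ x → eventually-map (λ y → r (λ i → ≈.reflexive (≡.sym (∷-++ y x u i))))))
    (ev-split a b (respects-tail r) p)

  ev-join : ∀ a b {P : Vector Carrier (a ℕ.+ b) → Set ℓ} → Respects P →
            Eventuallyⁿ b (λ u → Eventuallyⁿ a (λ x → P (x ++ u))) → Eventuallyⁿ (a ℕ.+ b) P
  ev-join zero    b r p = ev-map b (λ u → r (λ i → ≈.refl)) p
  ev-join (suc a) b r p = ev-join a b (respects-tail r)
    (ev-map b (λ u → ev-map a (λ x → eventually-map (λ y → r (λ i → ≈.reflexive (∷-++ y x u i))))) p)

  affine-map : ∀ {k m} → (Fin k → Vector ℤ m) → Vector Carrier k → Vector Carrier m → Vector Carrier k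
  affine-map A c w i = combination (A i) w +ᶻ c i

  module _ (em : ExcludedMiddle 0ℓ) where
    open Linearity Z {C = Carrier} id
    open Transfer Z

    LinearOn : ∀ m → Formula Carrier (suc m) → Set ℓ
    LinearOn m φ = ∃[ M ] NonZero M × ∃[ a ] ∃[ c ]
      Eventuallyⁿ m (λ w → ⟦ φ ⟧ (combination a w +ᶻ c ∷ + M ⊡ w))

    -- A line over the first variable whose intercept is linear in the others is linear in all of
    -- them. One solution dilates the head by `M`, the other the tail by `M′`; dilating each once
    -- more by the other factor makes the modulus common.
    linear-on-suc : ∀ {m} M .{{_ : NonZero M}} a (φ : Formula Carrier (suc (suc m))) →
                    LinearOn m (along-line (+ M) a φ) → LinearOn (suc m) φ
    linear-on-suc {m} M a φ (M′ , M′≢0 , a′ , c′ , h) =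
      M ℕ.* M′ , ℕ.m*n≢0 M M′ {{it}} {{M′≢0}} , (a ℤ.* + M′) ∷ (λ i → + M ℤ.* a′ i) , c′ ,
      ev-map m (λ w → eventually-map (λ x → resp φ (eq x w)) ∘ eventually-scale M′ {{M′≢0}})
        (ev-scale m respects M
          (ev-map m (λ w → from (along-line-correct (+ M) a φ (combination a′ w +ᶻ c′) (+ M′ ⊡ w))) h))
      where
      it : NonZero M
      it = ℕ.>-nonZero (ℕ.>-nonZero⁻¹ M)
      respects : Respects (λ w → Eventually (λ x → ⟦ φ ⟧ (a · x +ᶻ (combination a′ w +ᶻ c′) ∷ + M · x ∷ + M′ ⊡ w)))
      respects e = eventually-map λ x → resp φ
        (∷-cong (+-congˡ (+-congʳ (combination-cong a′ e))) (∷-cong ≈.refl (λ i → ·-cong (+ M′) (e i))))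
      eq : ∀ x w → (a · + M′ · x +ᶻ (combination a′ (+ M ⊡ w) +ᶻ c′) ∷ + M · + M′ · x ∷ + M′ ⊡ + M ⊡ w)
                   ≋ (combination ((a ℤ.* + M′) ∷ (λ i → + M ℤ.* a′ i)) (x ∷ w) +ᶻ c′ ∷ + (M ℕ.* M′) ⊡ (x ∷ w))
      eq x w zero = ≈.trans (≈.sym (+-assoc _ _ c′)) (+-congʳ (+-cong (≈.sym (*-· a (+ M′) x))
        (≈.trans (combination-· a′ (+ M) w) (≈.sym (combination-*ˡ (+ M) a′ w)))))
      eq x w (suc zero) = ≈.trans (≈.sym (*-· (+ M) (+ M′) x)) (≈.reflexive (≡.cong (_· x) (≡.sym (ℤ.pos-* M M′))))
      eq x w (suc (suc i)) = ≈.trans (·-comm (+ M′) (+ M) (w i))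
        (≈.trans (≈.sym (*-· (+ M) (+ M′) (w i))) (≈.reflexive (≡.cong (_· w i) (≡.sym (ℤ.pos-* M M′)))))

    -- The innermost variable is eliminated first. The unknown of the remaining problem is the
    -- intercept, and every formula is replaced by its lines for all slopes in `range D`.
    linear-solution : ∀ m (Φ : List (Formula Carrier (suc m))) →
      Eventuallyⁿ m (λ x → Any (λ φ → ∃[ y ] ⟦ φ ⟧ (y ∷ x)) Φ) → Any (LinearOn m) Φ
    linear-solution zero Φ p = Any.map (λ {φ} (y , q) → 1 , _ , [] , y ,
      resp φ (∷-cong (≈.sym (+-identityˡ y)) (λ ())) q) p
    linear-solution (suc m) Φ p =
      Any.map (λ {φ} q → let a , _ , r = range⁻ D (Any.map⁻ q) in linear-on-suc M {{M≢0}} a φ r)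
        (Any.concatMap⁻ lines (linear-solution m (List.concatMap lines Φ)
          (ev-map m (λ v q → Any.concatMap⁺ lines (Any.map (λ {φ} (a , a≤D , c , h) →
            Any.map⁺ (range⁺ {P = λ a → ∃[ y ] ⟦ along-line (+ M) a φ ⟧ (y ∷ v)} a≤D (c , to (along-line-correct (+ M) a φ c v) h)))
            (sound v q))) p)))
      where
      D = proj₁ (linearity em id Φ)
      M = proj₁ (proj₂ (linearity em id Φ))
      M≢0 = proj₁ (proj₂ (proj₂ (linearity em id Φ)))
      sound = proj₂ (proj₂ (proj₂ (linearity em id Φ)))
      lines : Formula Carrier (suc (suc m)) → List (Formula Carrier (suc m))
      lines φ = List.map (λ a → along-line (+ M) a φ) (range D)

    -- The unknowns become linear one at a time, the remaining ones staying under an existential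
    -- quantifier. Each further solution dilates the variables again, so the slopes already found
    -- are multiplied by the new modulus.
    linear-solutionⁿ : ∀ k m {P : Vector Carrier k → Vector Carrier m → Set ℓ} →
      Definable (⟨ m ⟩ ▹ k) (λ (y , x) → P y x) → Eventuallyⁿ m (λ x → ∃[ y ] P y x) →
      ∃[ M ] NonZero M × ∃[ A ] ∃[ c ] Eventuallyⁿ m (λ w → P (affine-map A c w) (+ M ⊡ w))
    linear-solutionⁿ zero m def p = 1 , _ , (λ ()) , (λ ()) ,
      ev-map m (λ w (y , q) → def-resp def {y , w} {_ , + 1 ⊡ w}
        (++-cong {x = y} {affine-map (λ ()) (λ ()) w} (λ ()) (λ i → ≈.sym (1·x≈x (w i)))) q) p
    linear-solutionⁿ (suc k) m {P} def p = result (linear-solution m (φ₀ ∷ˡ []ˡ)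
        (ev-map m (λ x (y , q) → here (head y , to (correct₀ (head y ∷ x)) (tail y ,
          def-resp def {y , x} {(head y ∷ tail y) , x} (++-cong (head-tail y) (λ _ → ≈.refl)) q))) p))
      where
      P₀ : Vector Carrier (suc m) → Set ℓ
      P₀ v = ∃[ y ] P (head v ∷ y) (tail v)
      def₀ : Definable ⟨ suc m ⟩ P₀
      def₀ = def-∃ k {P = λ y v → P (head v ∷ y) (tail v)}
        (def-substitute {σ = λ (y , v) → (head v ∷ y) , tail v} def
          (affine-++ {F = λ (y , v) → head v ∷ y} {G = λ (y , v) → tail v}
            (λ { zero → affine-env {Γ = ⟨ suc m ⟩} {k} zero ; (suc i) → affine-new {Γ = ⟨ suc m ⟩} i })
            (λ i → affine-env {Γ = ⟨ suc m ⟩} {k} (suc i))))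
      φ₀ = proj₁ def₀
      correct₀ = proj₂ def₀

      result : Any (LinearOn m) (φ₀ ∷ˡ []ˡ) →
        ∃[ M ] NonZero M × ∃[ A ] ∃[ c ] Eventuallyⁿ m (λ w → P (affine-map A c w) (+ M ⊡ w))
      result (here (M , M≢0 , a , c , h)) with linear-solutionⁿ k m def′
          (ev-map m (λ w q → from (correct₀ (combination a w +ᶻ c ∷ + M ⊡ w)) q) h)
        where
        def′ : Definable (⟨ m ⟩ ▹ k) (λ (y , w) → P (combination a w +ᶻ c ∷ y) (+ M ⊡ w))
        def′ = def-substitute {σ = λ (y , w) → (combination a w +ᶻ c ∷ y) , + M ⊡ w} def
          (affine-++ {F = λ (y , w) → combination a w +ᶻ c ∷ y} {G = λ (y , w) → + M ⊡ w}
            (λ { zero → affine-+ (affine-combination a (affine-env {Γ = ⟨ m ⟩})) (affine-const c)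
               ; (suc i) → affine-new {Γ = ⟨ m ⟩} i })
            (λ i → affine-· (+ M) (affine-env {Γ = ⟨ m ⟩} i)))
      ... | M′ , M′≢0 , A , c′ , g =
        M ℕ.* M′ , ℕ.m*n≢0 M M′ {{M≢0}} {{M′≢0}} , (λ i → + M′ ℤ.* a i) ∷ A , c ∷ c′ ,
        ev-map m (λ w → def-resp def {_ , + M ⊡ + M′ ⊡ w} {affine-map ((λ i → + M′ ℤ.* a i) ∷ A) (c ∷ c′) w , + (M ℕ.* M′) ⊡ w}
          (++-cong {y = + M ⊡ + M′ ⊡ w}
             (λ { zero → +-congʳ (≈.trans (combination-· a (+ M′) w) (≈.sym (combination-*ˡ (+ M′) a w)))
                ; (suc i) → ≈.refl })
             (λ i → ≈.trans (≈.sym (*-· (+ M) (+ M′) (w i))) (≈.reflexive (≡.cong (_· w i) (≡.sym (ℤ.pos-* M M′))))))) g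

-- Linear algebra over ℤ

dot-cong : ∀ {n} {a b x y : Vector ℤ n} → (∀ i → a i ≡ b i) → (∀ i → x i ≡ y i) → dot a x ≡ dot b y
dot-cong {zero}  h k = ≡.refl
dot-cong {suc n} h k = ≡.cong₂ ℤ._+_ (≡.cong₂ ℤ._*_ (h zero) (k zero)) (dot-cong (h ∘ suc) (k ∘ suc))

dot-scaleʳ : ∀ {n} k (a x : Vector ℤ n) → dot a (λ i → k ℤ.* x i) ≡ k ℤ.* dot a x
dot-scaleʳ {zero}  k a x = ≡.sym (ℤ.*-zeroʳ k)
dot-scaleʳ {suc n} k a x rewrite dot-scaleʳ k (tail a) (tail x) =
  lemma k (head a) (head x) (dot (tail a) (tail x))
  where
  lemma : ∀ k a r x → a ℤ.* (k ℤ.* r) ℤ.+ k ℤ.* x ≡ k ℤ.* (a ℤ.* r ℤ.+ x)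
  lemma = solve-∀

dot-remove : ∀ {n} (p : Fin (suc n)) (a x : Vector ℤ (suc n)) →
             dot a x ≡ a p ℤ.* x p ℤ.+ dot (removeAt a p) (removeAt x p)
dot-remove zero a x = ≡.refl
dot-remove {suc n} (suc p) a x rewrite dot-remove p (tail a) (tail x) =
  lemma (a zero ℤ.* x zero) (a (suc p) ℤ.* x (suc p)) (dot (removeAt (tail a) p) (removeAt (tail x) p))
  where
  lemma : ∀ u v w → u ℤ.+ (v ℤ.+ w) ≡ v ℤ.+ (u ℤ.+ w)
  lemma = solve-∀

-- A matrix is given by its rows.
Relation : ∀ {k n} → (Fin k → Vector ℤ n) → Set
Relation {n = n} V = Σ (Vector ℤ n) λ e → (∃[ i ] e i ≢ 0ℤ) × (∀ r → dot (V r) e ≡ 0ℤ)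

-- Fraction-free Gaussian elimination with pivot `V zero p`: the combination cancels column `p`,
-- which is then dropped.
eliminate : ∀ {k n} → (Fin (suc k) → Vector ℤ (suc n)) → Fin (suc n) → Fin k → Vector ℤ n
eliminate V p s j = V zero p ℤ.* removeAt (V (suc s)) p j ℤ.+ ℤ.- V (suc s) p ℤ.* removeAt (V zero) p j

-- Multiplying the reduced relation by the pivot lets the missing coordinate be solved for without
-- division.
eliminate-relation : ∀ {k n} (V : Fin (suc k) → Vector ℤ (suc n)) p → V zero p ≢ 0ℤ →
                     Relation (eliminate V p) → Relation V
eliminate-relation V p a≢0 (e , (j , ej≢0) , h) = e⁺ , (punchIn p j , nonzero) , vanishes
  where
  a = V zero p
  r = removeAt (V zero) p
  e⁺ = insertAt (λ j → a ℤ.* e j) p (ℤ.- dot r e)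
  nonzero : e⁺ (punchIn p j) ≢ 0ℤ
  nonzero z with ℤ.i*j≡0⇒i≡0∨j≡0 a (≡.trans (≡.sym (insertAt-punchIn (λ j → a ℤ.* e j) p _ j)) z)
  ... | inj₁ a≡0  = a≢0 a≡0
  ... | inj₂ ej≡0 = ej≢0 ej≡0
  expand : ∀ s → dot (V s) e⁺ ≡ V s p ℤ.* ℤ.- dot r e ℤ.+ a ℤ.* dot (removeAt (V s) p) e
  expand s = ≡.trans (dot-remove p (V s) e⁺) (≡.cong₂ (λ x y → V s p ℤ.* x ℤ.+ y)
    (insertAt-lookup (λ j → a ℤ.* e j) p _)
    (≡.trans (dot-cong {x = removeAt e⁺ p} (λ _ → ≡.refl) (insertAt-punchIn (λ j → a ℤ.* e j) p _))
             (dot-scaleʳ a (removeAt (V s) p) e)))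
  lemma₀ : ∀ a d → a ℤ.* ℤ.- d ℤ.+ a ℤ.* d ≡ 0ℤ
  lemma₀ = solve-∀
  lemma₁ : ∀ v d w → v ℤ.* ℤ.- d ℤ.+ w ≡ w ℤ.+ ℤ.- v ℤ.* d
  lemma₁ = solve-∀
  vanishes : ∀ s → dot (V s) e⁺ ≡ 0ℤ
  vanishes zero    = ≡.trans (expand zero) (lemma₀ a (dot r e))
  vanishes (suc s) = ≡.trans (expand (suc s)) (≡.trans (lemma₁ (V (suc s) p) (dot r e) _)
    (≡.trans (≡.sym (dot-combine a (ℤ.- V (suc s) p) (removeAt (V (suc s)) p) r e)) (h s)))

module LinearAlgebra {ℓ} (Z : PresburgerModel ℓ) where
  open Model Z
  open Definability Z using (multiple-large)

  ·-positive : ∀ k {x} → 0ᶻ < x → 0ᶻ < + suc k · x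
  ·-positive k 0<x = multiple-large k 0<x 0<x

  neg-positive : ∀ {x} → x < 0ᶻ → 0ᶻ < -ᶻ x
  neg-positive {x} x<0 = <-resp (-‿inverseʳ x) (+-identityˡ _) (+-monoʳ-< (-ᶻ x) x<0)

  ×-torsion-free : ∀ k {x} → + suc k · x ≈ 0ᶻ → x ≈ 0ᶻ
  ×-torsion-free k {x} e with trichotomous x 0ᶻ
  ... | inj₂ (inj₁ x≈0) = x≈0
  ... | inj₂ (inj₂ 0<x) = ⊥-elim (<-irrefl (<-resp ≈.refl e (·-positive k 0<x)))
  ... | inj₁ x<0 = ⊥-elim (<-irrefl {0ᶻ} (<-resp ≈.refl
    (≈.trans (·-negʳ (+ suc k) x) (≈.trans (-‿cong e) -0#≈0#))
    (·-positive k (neg-positive x<0))))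

  torsion-free : ∀ i {x} → i ≢ 0ℤ → i · x ≈ 0ᶻ → x ≈ 0ᶻ
  torsion-free (+ zero)  i≢0 e = ⊥-elim (i≢0 ≡.refl)
  torsion-free (+ suc k) i≢0 e = ×-torsion-free k e
  torsion-free -[1+ k ] {x} i≢0 e = ×-torsion-free k {x}
    (≈.trans (·-neg -[1+ k ] x) (≈.trans (-‿cong e) -0#≈0#))

  combination-remove : ∀ {n} (p : Fin (suc n)) (a : Vector ℤ (suc n)) (x : Vector Carrier (suc n)) →
    combination a x ≈ a p · x p +ᶻ combination (removeAt a p) (removeAt x p)
  combination-remove zero a x = ≈.refl
  combination-remove {suc n} (suc p) a x = ≈.trans (+-congˡ (combination-remove p (tail a) (tail x)))
    (x∙yz≈y∙xz _ _ _)
    where open import Algebra.Properties.CommutativeSemigroup +-commutativeSemigroup using (x∙yz≈y∙xz)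

  -- Injectivity is required on vectors over `Z`, so kernel vectors with nonstandard entries are
  -- excluded too.
  Injective : ∀ {k n} → (Fin k → Vector ℤ n) → Set ℓ
  Injective V = ∀ d → (∀ r → combination (V r) d ≈ 0ᶻ) → ∀ i → d i ≈ 0ᶻ

  isolate : ∀ {x y} → x +ᶻ y ≈ 0ᶻ → y ≈ -ᶻ x
  isolate {x} {y} e = ≈.trans (≈.sym (+-identityˡ y)) (≈.trans (+-congʳ (≈.sym (-‿inverseˡ x)))
    (≈.trans (+-assoc (-ᶻ x) x y) (≈.trans (+-congˡ e) (+-identityʳ _))))

  eliminate-injective : ∀ {k n} (V : Fin (suc k) → Vector ℤ (suc n)) p → V zero p ≢ 0ℤ →
                        Injective (eliminate V p) → Injective V
  eliminate-injective V p a≢0 inj d h = all-zero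
    where
    a = V zero p
    r = removeAt (V zero) p
    d′ = removeAt d p
    other : ∀ s → combination (removeAt (V s) p) d′ ≈ -ᶻ (V s p · d p)
    other s = isolate (≈.trans (≈.sym (combination-remove p (V s) d)) (h s))
    vanishes : ∀ s → combination (eliminate V p s) d′ ≈ 0ᶻ
    vanishes s = ≈.trans (combination-+ˡ (λ j → a ℤ.* removeAt (V (suc s)) p j) (λ j → ℤ.- V (suc s) p ℤ.* r j) d′)
      (≈.trans (+-cong (≈.trans (combination-*ˡ a (removeAt (V (suc s)) p) d′) (≈.trans (·-cong a (other (suc s))) (·-negʳ a _)))
                       (≈.trans (combination-*ˡ (ℤ.- V (suc s) p) r d′) (≈.trans (·-cong (ℤ.- V (suc s) p) (other zero))
                          (≈.trans (·-negʳ (ℤ.- V (suc s) p) (a · d p)) (-‿cong (·-neg (V (suc s) p) (a · d p)))))))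
      (≈.trans (+-congˡ (-‿cong (-‿cong (·-comm (V (suc s) p) a (d p))))) (-‿inverseʳ _)))
    rest-zero : ∀ j → d′ j ≈ 0ᶻ
    rest-zero = inj d′ vanishes
    pivot-zero : d p ≈ 0ᶻ
    pivot-zero = torsion-free a a≢0 (≈.trans (≈.sym (+-identityʳ _))
      (≈.trans (+-congˡ (≈.sym (≈.trans (combination-cong r rest-zero) (combination-0 r))))
      (≈.trans (≈.sym (combination-remove p (V zero) d)) (h zero))))
    all-zero : ∀ i → d i ≈ 0ᶻ
    all-zero i with p ≟ᶠ i
    ... | yes ≡.refl = pivot-zero
    ... | no  p≢i    = ≈.trans (≈.reflexive (≡.cong d (≡.sym (punchIn-punchOut p≢i)))) (rest-zero (punchOut p≢i))

  -- Elimination works alike over ℤ and over `Z`, which is torsion-free: a nonzero pivot determines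
  -- its coordinate. Hence a kernel over `Z` is already visible over ℤ. The inequality between
  -- columns and rows is what bounds charts.
  relation-or-injective : ∀ {k n} (V : Fin k → Vector ℤ n) → Relation V ⊎ (n ℕ.≤ k × Injective V)
  relation-or-injective {zero} {zero}  V = inj₂ (ℕ.z≤n , λ _ _ ())
  relation-or-injective {zero} {suc n} V = inj₁ ((λ _ → 1ℤ) , (zero , λ ()) , λ ())
  relation-or-injective {suc k} {n} V with any? (λ p → ¬? (V zero p ℤ.≟ 0ℤ))
  relation-or-injective {suc k} {suc n} V | yes (p , a≢0) with relation-or-injective (eliminate V p)
  ... | inj₁ relation    = inj₁ (eliminate-relation V p a≢0 relation)
  ... | inj₂ (n≤k , inj) = inj₂ (ℕ.s≤s n≤k , eliminate-injective V p a≢0 inj)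
  relation-or-injective {suc k} {n} V | no none with relation-or-injective (V ∘ suc)
  ... | inj₁ (e , e≢0 , h) = inj₁ (e , e≢0 , λ
    { zero    → ≡.trans (dot-cong {x = e} (λ i → Dec.decidable-stable (V zero i ℤ.≟ 0ℤ) (λ ne → none (i , ne))) (λ _ → ≡.refl)) (dot-zero e)
    ; (suc r) → h r })
  ... | inj₂ (n≤k , inj) = inj₂ (ℕ.m≤n⇒m≤1+n n≤k , λ d h → inj d (h ∘ suc))

  positive : ∃[ δ ] 0ᶻ < δ
  positive = exceeds 0ᶻ

  δ : Carrier
  δ = proj₁ positive

  δ≉0 : δ ≈ 0ᶻ → Empty
  δ≉0 e = <-irrefl {0ᶻ} (<-resp ≈.refl e (proj₂ positive))

  ·δ-injective : ∀ i → i · δ ≈ 0ᶻ → i ≡ 0ℤ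
  ·δ-injective i e with i ℤ.≟ 0ℤ
  ... | yes i≡0 = i≡0
  ... | no  i≢0 = ⊥-elim (δ≉0 (torsion-free i i≢0 e))

  combination-dot : ∀ {n} (a e : Vector ℤ n) x → combination a (λ i → e i · x) ≈ dot a e · x
  combination-dot {zero}  a e x = ≈.refl
  combination-dot {suc n} a e x = ≈.trans (+-cong (≈.sym (*-· (head a) (head e) x)) (combination-dot (tail a) (tail e) x))
    (≈.sym (·-distribʳ (head a ℤ.* head e) (dot (tail a) (tail e)) x))

  -- Multiplying a positive element `δ` by the entries of an integral kernel vector would give a
  -- kernel vector over `Z`.
  injective⇒¬relation : ∀ {k n} {V : Fin k → Vector ℤ n} → Injective V → ∀ e → (∀ r → dot (V r) e ≡ 0ℤ) → ∀ i → e i ≡ 0ℤ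
  injective⇒¬relation {V = V} inj e h i = ·δ-injective (e i) (inj (λ i → e i · δ)
    (λ r → ≈.trans (combination-dot (V r) e δ) (≈.reflexive (≡.cong (_· δ) (h r)))) i)

-- Definable choice

zeroᵈ : ∀ {c} {C : Set c} {n} → DTerm C (suc n)
zeroᵈ = varᵈ zero -ᵈ varᵈ zero

beforeᶠ : ∀ {c} {C : Set c} {n} → Formula C (suc (suc n))
beforeᶠ =
  ((y ≺ᵈ zeroᵈ ⇒ falsum) ⇒ ((x ≺ᵈ zeroᵈ ⇒ falsum) ∧ (y ≺ᵈ x ⇒ falsum))) ∧
  (y ≺ᵈ zeroᵈ ⇒ x ≺ᵈ zeroᵈ ⇒ x ≺ᵈ y ⇒ falsum)
  where
  y = varᵈ zero
  x = varᵈ (suc zero)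

canonicalᶠ : ∀ {c} {C : Set c} {n} → Formula C (suc n) → Formula C (suc n)
canonicalᶠ φ = φ ∧ all (substᶠ constᵈ (varᵈ zero ∷ λ i → varᵈ (suc (suc i))) φ ⇒ beforeᶠ)

module Choice {ℓ} (Z : PresburgerModel ℓ) where
  open Model Z
  open Definability Z

  -- The order 0, 1, 2, …, −1, −2, …
  Before : Carrier → Carrier → Set ℓ
  Before x y = ((y < 0ᶻ → ⊥ {ℓ}) → (x < 0ᶻ → ⊥ {ℓ}) × (y < x → ⊥ {ℓ})) × (y < 0ᶻ → x < 0ᶻ → x < y → ⊥ {ℓ})

  Canonical : ∀ {p} → (Carrier → Set p) → Carrier → Set (ℓ ⊔ p)
  Canonical S x = S x × (∀ y → S y → Before x y)

  module _ {c} {C : Set c} (γ : C → Carrier) where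
    open Semantics γ
    open Value γ
    open Substitution γ γ

    beforeᶠ-correct : ∀ {n} (ρ : Vector Carrier n) x y → Before x y ⇔ ⟦ beforeᶠ ⟧ (y ∷ x ∷ ρ)
    beforeᶠ-correct ρ x y = mk⇔
      (λ (h , k) → (λ y≮0 → let x≮0 , y≮x = h (y≮0 ∘ to y<0) in x≮0 ∘ from x<0 , y≮x ∘ from y<x) ,
                   (λ p q r → k (from y<0 p) (from x<0 q) (from x<y r)))
      (λ (h , k) → (λ y≮0 → let x≮0 , y≮x = h (y≮0 ∘ from y<0) in x≮0 ∘ to x<0 , y≮x ∘ to y<x) ,
                   (λ p q r → k (to y<0 p) (to x<0 q) (to x<y r)))
      where
      τ : Vector Carrier _
      τ = y ∷ x ∷ ρ
      value-y : ⟦ varᵈ zero ⟧ᵈ τ ≈ y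
      value-y = varᵈ-correct zero τ
      value-x : ⟦ varᵈ (suc zero) ⟧ᵈ τ ≈ x
      value-x = varᵈ-correct (suc zero) τ
      value-0 : ⟦ zeroᵈ ⟧ᵈ τ ≈ 0ᶻ
      value-0 = ≈.trans (-ᵈ-correct (varᵈ zero) (varᵈ zero) τ) (-‿inverseʳ _)
      less : ∀ d e {u v} → ⟦ d ⟧ᵈ τ ≈ u → ⟦ e ⟧ᵈ τ ≈ v → u < v ⇔ ⟦ d ≺ᵈ e ⟧ τ
      less d e p q = mk⇔ (λ h → to (≺ᵈ-correct d e τ) (<-resp (≈.sym p) (≈.sym q) h))
                         (λ h → <-resp p q (from (≺ᵈ-correct d e τ) h))
      y<0 = less (varᵈ zero) zeroᵈ value-y value-0
      x<0 = less (varᵈ (suc zero)) zeroᵈ value-x value-0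
      y<x = less (varᵈ zero) (varᵈ (suc zero)) value-y value-x
      x<y = less (varᵈ (suc zero)) (varᵈ zero) value-x value-y

    canonicalᶠ-correct : ∀ {n} (φ : Formula C (suc n)) ρ x →
      Canonical (λ y → ⟦ φ ⟧ (y ∷ ρ)) x ⇔ ⟦ canonicalᶠ φ ⟧ (x ∷ ρ)
    canonicalᶠ-correct φ ρ x = mk⇔
      (λ (p , h) → p , λ y q → to (beforeᶠ-correct ρ x y) (h y (from (eq y) q)))
      (λ (p , h) → p , λ y q → from (beforeᶠ-correct ρ x y) (h y (to (eq y) q)))
      where
      σ-correct : ∀ y i → (y ∷ ρ) i ≈ ⟦ (varᵈ zero ∷ λ i → varᵈ (suc (suc i))) i ⟧ᵈ (y ∷ x ∷ ρ)
      σ-correct y zero    = ≈.sym (varᵈ-correct zero (y ∷ x ∷ ρ))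
      σ-correct y (suc i) = ≈.sym (varᵈ-correct (suc (suc i)) (y ∷ x ∷ ρ))
      eq : ∀ y → _ ⇔ _
      eq y = substᶠ-correct {ρ = y ∷ x ∷ ρ} (λ a → ≈.sym (constᵈ-correct a (y ∷ x ∷ ρ))) (σ-correct y) φ

  -- The order is total, so two first elements coincide. Two predicates are allowed because one
  -- coset, described from two of its members, gives predicates that are merely equivalent.
  canonical-unique : ∀ {p} {S S′ : Carrier → Set p} → (∀ x → S x ⇔ S′ x) →
                     ∀ {x x′} → Canonical S x → Canonical S′ x′ → x ≈ x′
  canonical-unique e {x} {x′} (Sx , first) (S′x′ , first′) = compare (first x′ (from (e x′) S′x′)) (first′ x (to (e x) Sx))
    where
    antisym : (x < x′ → ⊥ {ℓ}) → (x′ < x → ⊥ {ℓ}) → x ≈ x′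
    antisym x≮x′ x′≮x with trichotomous x x′
    ... | inj₁ x<x′          = ⊥ₚ-elim (x≮x′ x<x′)
    ... | inj₂ (inj₁ x≈x′)   = x≈x′
    ... | inj₂ (inj₂ x′<x)   = ⊥ₚ-elim (x′≮x x′<x)
    sign : ∀ z → z < 0ᶻ ⊎ (z < 0ᶻ → ⊥ {ℓ})
    sign z with trichotomous z 0ᶻ
    ... | inj₁ z<0        = inj₁ z<0
    ... | inj₂ (inj₁ z≈0) = inj₂ λ z<0 → ⊥-elim (<-irrefl (<-resp z≈0 ≈.refl z<0))
    ... | inj₂ (inj₂ 0<z) = inj₂ λ z<0 → ⊥-elim (<-irrefl (<-trans z<0 0<z))
    compare : Before x x′ → Before x′ x → x ≈ x′
    compare (p , q) (p′ , q′) with sign x | sign x′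
    ... | inj₁ x<0 | inj₁ x′<0 = antisym (q x′<0 x<0) (q′ x<0 x′<0)
    ... | inj₁ x<0 | inj₂ x′≮0 = ⊥ₚ-elim (proj₁ (p x′≮0) x<0)
    ... | inj₂ x≮0 | inj₁ x′<0 = ⊥ₚ-elim (proj₁ (p′ x≮0) x′<0)
    ... | inj₂ x≮0 | inj₂ x′≮0 = antisym (proj₂ (p′ x≮0)) (proj₂ (p x′≮0))

  -- Lexicographic choice, last coordinate first: it reduces choice of vectors to choice in one
  -- variable, in projections and then in fibres.
  Canonicalⁿ : ∀ k → (Vector Carrier k → Set ℓ) → Vector Carrier k → Set ℓ
  Canonicalⁿ zero    S v = S v
  Canonicalⁿ (suc k) S v = Canonicalⁿ k (λ w → ∃[ x ] S (x ∷ w)) (tail v) × Canonical (λ x → S (x ∷ tail v)) (head v)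

  canonicalⁿ-sound : ∀ k {S} → Respects S → ∀ {v} → Canonicalⁿ k S v → S v
  canonicalⁿ-sound zero    r p = p
  canonicalⁿ-sound (suc k) r {v} (_ , p , _) = r (≋-sym (head-tail v)) p

  canonicalⁿ-unique : ∀ k {S S′} → Respects S → (∀ v → S v ⇔ S′ v) →
                      ∀ {v v′} → Canonicalⁿ k S v → Canonicalⁿ k S′ v′ → v ≋ v′
  canonicalⁿ-unique zero    r e p p′ ()
  canonicalⁿ-unique (suc k) {S} {S′} r e {v} {v′} (p , q) (p′ , q′) = λ
    { zero    → canonical-unique (λ x → mk⇔ (λ s → to (e (x ∷ tail v′)) (r (∷-cong ≈.refl tails) s))
                                            (λ s → r (∷-cong ≈.refl (≋-sym tails)) (from (e (x ∷ tail v′)) s))) q q′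
    ; (suc i) → tails i }
    where
    tails : tail v ≋ tail v′
    tails = canonicalⁿ-unique k (λ w≋ (x , s) → x , r (∷-cong ≈.refl w≋) s)
      (λ w → mk⇔ (λ (x , s) → x , to (e (x ∷ w)) s) (λ (x , s) → x , from (e (x ∷ w)) s)) p p′

  canonicalⁿ-cong : ∀ k {S S′} → (∀ v → S v ⇔ S′ v) → ∀ {v} → Canonicalⁿ k S v → Canonicalⁿ k S′ v
  canonicalⁿ-cong zero    e p = to (e _) p
  canonicalⁿ-cong (suc k) e {v} (p , s , first) =
    canonicalⁿ-cong k (λ w → mk⇔ (λ (x , s) → x , to (e (x ∷ w)) s) (λ (x , s) → x , from (e (x ∷ w)) s)) p ,
    to (e (head v ∷ tail v)) s , λ y s′ → first y (from (e (y ∷ tail v)) s′)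

  module _ {Γ : Context} where
    def-∃₁ : ∀ {P : Carrier → Context.Env Γ → Set ℓ} → Definable (Γ ▹ 1) (λ (y , ε) → P (head y) ε) →
             Definable Γ (λ ε → ∃[ x ] P x ε)
    def-∃₁ def = def-⇔ (λ ε → mk⇔ (λ (x , p) → (x ∷ []) , p) (λ (y , p) → head y , p)) (def-∃ 1 def)

  def-before : ∀ {Γ f g} → Affine Γ f → Affine Γ g → Definable Γ (λ ε → Before (f ε) (g ε))
  def-before {Γ} {f} {g} af ag = def-∧
    (def-→ (not (def-< ag 0ᵃ)) (def-∧ (not (def-< af 0ᵃ)) (not (def-< ag af))))
    (def-→ (def-< ag 0ᵃ) (def-→ (def-< af 0ᵃ) (not (def-< af ag))))
    where
    0ᵃ : Affine Γ (λ _ → 0ᶻ)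
    0ᵃ = affine-const 0ᶻ
    not : ∀ {P} → Definable Γ P → Definable Γ (λ ε → P ε → ⊥)
    not d = def-→ d def-⊥

  def-canonicalⁿ : ∀ {Γ} k {S : Vector Carrier k → Context.Env Γ → Set ℓ} → Definable (Γ ▹ k) (λ (v , ε) → S v ε) →
                   Definable (Γ ▹ k) (λ (v , ε) → Canonicalⁿ k (λ w → S w ε) v)
  def-canonicalⁿ zero    def = def
  def-canonicalⁿ {Γ} (suc k) {S} def = def-∧
    (def-substitute {σ = λ (v , ε) → tail v , ε}
      (def-canonicalⁿ k {S = λ w ε → ∃[ x ] S (x ∷ w) ε} (def-∃₁ {P = λ x (w , ε) → S (x ∷ w) ε}
        (def-substitute {σ = λ (y , w , ε) → (head y ∷ w) , ε} def
          (affine-++ {F = λ (y , w , ε) → head y ∷ w} {G = λ (y , w , ε) → Context.eval Γ ε}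
            (λ { zero → affine-new zero ; (suc i) → affine-old (affine-new i) })
            (λ i → affine-old (affine-env i))))))
      (affine-++ {F = λ (v , ε) → tail v} {G = λ (v , ε) → Context.eval Γ ε} (affine-new ∘ suc) affine-env))
    (def-∧
      (def-substitute {σ = λ (v , ε) → (head v ∷ tail v) , ε} def
        (affine-++ {F = λ (v , ε) → head v ∷ tail v} {G = λ (v , ε) → Context.eval Γ ε}
          (λ { zero → affine-new zero ; (suc i) → affine-new (suc i) }) affine-env))
      (def-∀ {P = λ y (v , ε) → S (y ∷ tail v) ε → Before (head v) y} (def-→
        (def-substitute {σ = λ (y , v , ε) → (head y ∷ tail v) , ε} def
          (affine-++ {F = λ (y , v , ε) → head y ∷ tail v} {G = λ (y , v , ε) → Context.eval Γ ε}
            (λ { zero → affine-new zero ; (suc i) → affine-old (affine-new (suc i)) })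
            (λ i → affine-old (affine-env i))))
        (def-before (affine-old (affine-new zero)) (affine-new zero)))))

-- On ℤ the order is a well-order of type ω + ω: a nonnegative member of least value comes first,
-- and if there is none, the negative member closest to zero.
ℤ-canonical : ExcludedMiddle 0ℓ → ∀ {S : ℤ → Set} → ∃[ x ] S x → ∃[ x ] Choice.Canonical ℤ-model S x
ℤ-canonical em {S} (x , s) with em {∃[ n ] S (+ n)}
... | yes (n , sn) with least em (λ n → S (+ n)) n sn
...   | m , sm , minimal = + m , sm , λ
  { (+ k)    sk → (λ _ → (λ { (ℤ.+<+ ()) }) , λ { (ℤ.+<+ k<m) → ⊥-elim (ℕ.<⇒≱ k<m (minimal k sk)) }) , λ { (ℤ.+<+ ()) }
  ; -[1+ k ] sk → (λ k≮0 → ⊥ₚ-elim (k≮0 ℤ.-<+)) , λ { _ (ℤ.+<+ ()) } }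
ℤ-canonical em {S} (+ n , s) | no none = ⊥-elim (none (n , s))
ℤ-canonical em {S} (-[1+ n ] , s) | no none with least em (λ n → S -[1+ n ]) n s
...   | m , sm , minimal = -[1+ m ] , sm , λ
  { (+ k)    sk → ⊥-elim (none (k , sk))
  ; -[1+ k ] sk → (λ k≮0 → ⊥ₚ-elim (k≮0 ℤ.-<+)) , λ { _ _ (ℤ.-<- k<m) → ⊥-elim (ℕ.<⇒≱ k<m (minimal k sk)) } }

module CanonicalExistence {ℓ} (Z : PresburgerModel ℓ) (em : ExcludedMiddle 0ℓ) where
  open Model Z
  open Definability Z
  open Choice Z
  open Transfer Z
  open Semantics {C = Carrier} id

  -- In a nonstandard model the order is no well-order, but that nonempty definable sets have first
  -- elements is a scheme of sentences true in ℤ.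
  canonical-exists : ∀ {n} (φ : Formula Carrier (suc n)) ρ →
    ∃[ x ] ⟦ φ ⟧ (x ∷ ρ) → ∃[ x ] Canonical (λ x → ⟦ φ ⟧ (x ∷ ρ)) x
  canonical-exists {n} φ ρ (x , p) =
    let y , q = transfer (n ℕ.+ List.length xs) (ex ψ ⇒ ex (canonicalᶠ ψ)) valid τ (x , to (pureness x) p)
        s , first = from (canonicalᶠ-correct no-constants ψ τ y) q
    in y , from (pureness y) s , λ z t → first z (to (pureness z) t)
    where
    xs = constants φ
    ψ : Formula Empty (suc n ℕ.+ List.length xs)
    ψ = pure xs φ id
    τ : Vector Carrier (n ℕ.+ List.length xs)
    τ = ρ ++ List.lookup xs
    pureness : ∀ x → ⟦ φ ⟧ (x ∷ ρ) ⇔ Semantics.⟦_⟧ no-constants ψ (x ∷ τ)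
    pureness x = pure-correct id xs φ id (combines-∷ id xs {τ = τ} (combines-++ id xs ρ) x)
    valid : ∀ ρ → ⟦ ex ψ ⇒ ex (canonicalᶠ ψ) ⟧ℤ ρ
    valid ρ (x , p) = let y , q = ℤ-canonical em (x , p) in
      y , to (Choice.canonicalᶠ-correct ℤ-model no-constants ψ ρ y) q

  canonicalⁿ-exists : ∀ k {S} → Definable ⟨ k ⟩ S → ∃[ v ] S v → ∃[ v ] Canonicalⁿ k S v
  canonicalⁿ-exists zero    def p = p
  canonicalⁿ-exists (suc k) {S} def@(φ , h) (v , s) =
    let w , p = canonicalⁿ-exists k {S = λ w → ∃[ x ] S (x ∷ w)}
                  (ex φ , λ w → mk⇔ (λ (x , q) → x , to (h (x ∷ w)) q) (λ (x , q) → x , from (h (x ∷ w)) q))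
                  (tail v , head v , def-resp def (head-tail v) s)
        x , q = canonicalⁿ-sound k (λ w≋ (x , s) → x , def-resp def (∷-cong ≈.refl w≋) s) p
        y , r , first = canonical-exists φ w (x , to (h (x ∷ w)) q)
    in (y ∷ w) , p , from (h (y ∷ w)) r , λ z t → first z (to (h (z ∷ w)) t)

-- The group

Matrix : ℕ → ℕ → Set
Matrix k n = Fin k → Vector ℤ n

infixl 7 _⊗_
_⊗_ : ∀ {k m n} → Matrix k m → Matrix m n → Matrix k n
(A ⊗ B) r i = dot (A r) (λ j → B j i)

dot-split : ∀ m {n} (a x : Vector ℤ (m ℕ.+ n)) →
            dot a x ≡ dot (take m a) (take m x) ℤ.+ dot (drop m a) (drop m x)
dot-split zero    a x = ≡.sym (ℤ.+-identityˡ _)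
dot-split (suc m) a x = ≡.trans (≡.cong (λ z → head a ℤ.* head x ℤ.+ z) (dot-split m (tail a) (tail x)))
  (≡.sym (ℤ.+-assoc (head a ℤ.* head x) _ _))

module MatrixAction {ℓ} (Z : PresburgerModel ℓ) where
  open Model Z
  open Definability Z
  open LinearAlgebra Z

  infixr 7 _⊙_
  _⊙_ : ∀ {k n} → Matrix k n → Vector Carrier n → Vector Carrier k
  (A ⊙ x) r = combination (A r) x

  ⊙-cong : ∀ {k n} (A : Matrix k n) {x y} → x ≋ y → A ⊙ x ≋ A ⊙ y
  ⊙-cong A e r = combination-cong (A r) e

  combination-column : ∀ {m n} (a : Vector ℤ m) (B : Matrix m n) x →
    combination (λ i → dot a (λ j → B j i)) x ≈ combination a (B ⊙ x)
  combination-column {zero}  a B x = combination-0ˡ x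
  combination-column {suc m} a B x =
    ≈.trans (combination-+ˡ (λ i → head a ℤ.* B zero i) (λ i → dot (tail a) (λ j → B (suc j) i)) x)
      (+-cong (combination-*ˡ (head a) (B zero) x) (combination-column (tail a) (B ∘ suc) x))

  ⊗-⊙ : ∀ {k m n} (A : Matrix k m) (B : Matrix m n) x → (A ⊗ B) ⊙ x ≋ A ⊙ B ⊙ x
  ⊗-⊙ A B x r = combination-column (A r) B x

  ⊙-⊡ : ∀ {k n} (A : Matrix k n) c x → A ⊙ (c ⊡ x) ≋ c ⊡ (A ⊙ x)
  ⊙-⊡ A c x r = combination-· (A r) c x

  ⊙-⊞ : ∀ {k n} (A : Matrix k n) x y → A ⊙ (x ⊞ y) ≋ (A ⊙ x) ⊞ (A ⊙ y)
  ⊙-⊞ A x y r = combination-+ (A r) x y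

  combination-split : ∀ m {n} (a : Vector ℤ (m ℕ.+ n)) (x : Vector Carrier m) (y : Vector Carrier n) →
    combination a (x ++ y) ≈ combination (take m a) x +ᶻ combination (drop m a) y
  combination-split zero    a x y = ≈.sym (+-identityˡ _)
  combination-split (suc m) a x y =
    ≈.trans (+-congˡ (≈.trans (combination-cong (tail a) (λ i → ≈.trans (++-cong (head-tail x) (λ _ → ≈.refl) (suc i))
                                (≈.reflexive (∷-++ (head x) (tail x) y (suc i)))))
                              (combination-split m (tail a) (tail x) y)))
            (≈.sym (+-assoc _ _ _))

  affine-map-cong : ∀ {k m} (A : Matrix k m) c {x y} → x ≋ y → affine-map A c x ≋ affine-map A c y
  affine-map-cong A c e r = +-congʳ (combination-cong (A r) e)

  affine-map-⊞ : ∀ {k m} (A : Matrix k m) c x y → affine-map A c (x ⊞ y) ≋ (A ⊙ y) ⊞ affine-map A c x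
  affine-map-⊞ A c x y r = ≈.trans (+-congʳ (≈.trans (combination-+ (A r) x y) (+-comm _ _))) (+-assoc _ _ _)

  affine-map-fixed : ∀ {k m} (A : Matrix k m) c x y → affine-map A c x ≋ affine-map A c (x ⊞ y) → ∀ r → (A ⊙ y) r ≈ 0ᶻ
  affine-map-fixed A c x y e r = +-cancelʳ-≈ (affine-map A c x r)
    (≈.trans (≈.sym (affine-map-⊞ A c x y r)) (≈.trans (≈.sym (e r)) (≈.sym (+-identityˡ _))))

module Multiplication {ℓ} (Z : PresburgerModel ℓ) (G : DefinableAbelianGroup Z) where
  open Model Z
  open Definability Z
  open DefinableAbelianGroup G renaming (dim to k)
  open Semantics {C = Carrier} id
  private
    module A = AbelianGroup abelianGroup
    Γ = proj₁ ∙-definable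

  open import Algebra.Properties.Group A.group using (∙-cancelʳ)
  open import Relation.Binary.Reasoning.Setoid A.setoid

  In : Vector Carrier k → Set ℓ
  In x = ⟦ universe ⟧ x

  -- As a relation between vectors, multiplication is definable, carries its memberships with it and
  -- is insensitive to the choice of membership proofs; computations in `G` are carried out with it.
  Mul : Vector Carrier k → Vector Carrier k → Vector Carrier k → Set ℓ
  Mul a b c = In a × In b × In c × ⟦ Γ ⟧ (a ++ (b ++ c))

  private
    mul⁺ : ∀ {a b c} (pa : In a) (pb : In b) (pc : In c) → (a , pa) A.∙ (b , pb) A.≈ (c , pc) → Mul a b c
    mul⁺ pa pb pc e = pa , pb , pc , to (proj₂ ∙-definable (_ , pa) (_ , pb) (_ , pc)) e

    mul⁻ : ∀ {a b c} → Mul a b c → (pa : In a) (pb : In b) (pc : In c) → (a , pa) A.∙ (b , pb) A.≈ (c , pc)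
    mul⁻ {a} {b} {c} (pa , pb , pc , p) pa′ pb′ pc′ =
      A.trans {(a , pa′) A.∙ (b , pb′)} {(a , pa) A.∙ (b , pb)} {c , pc′}
        (A.∙-cong {a , pa′} {a , pa} {b , pb′} {b , pb} (λ _ → ≈.refl) (λ _ → ≈.refl)) (from (proj₂ ∙-definable (a , pa) (b , pb) (c , pc)) p)

  def-In : Definable ⟨ k ⟩ In
  def-In = universe , λ x → mk⇔ id id

  abstract
    def-Mul : Definable (⟨ k ⟩ ▹ k ▹ k) (λ (a , b , c) → Mul a b c)
    def-Mul = def-∧ (def-substitute {σ = λ (a , b , c) → a} def-In (λ i → affine-new i))
      (def-∧ (def-substitute {σ = λ (a , b , c) → b} def-In (λ i → affine-old (affine-new i)))
      (def-∧ (def-substitute {σ = λ (a , b , c) → c} def-In (λ i → affine-old (affine-env {Γ = ⟨ k ⟩} i)))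
        (Γ , λ ε → mk⇔ id id)))

  mul-resp : ∀ {a a′ b b′ c c′} → a ≋ a′ → b ≋ b′ → c ≋ c′ → Mul a b c → Mul a′ b′ c′
  mul-resp ea eb ec = def-resp def-Mul (++-cong ea (++-cong eb ec))

  mul-left : ∀ {a b c} → Mul a b c → In a
  mul-left = proj₁
  mul-right : ∀ {a b c} → Mul a b c → In b
  mul-right (_ , p , _) = p
  mul-result : ∀ {a b c} → Mul a b c → In c
  mul-result (_ , _ , p , _) = p

  mul-intro : ∀ (x y : Element Z universe) → Mul (proj₁ x) (proj₁ y) (proj₁ (x ∙ y))
  mul-intro (a , pa) (b , pb) = mul⁺ pa pb (proj₂ ((a , pa) ∙ (b , pb))) (λ _ → ≈.refl)

  mul-total : ∀ {a b} → In a → In b → ∃[ c ] Mul a b c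
  mul-total pa pb = _ , mul-intro (_ , pa) (_ , pb)

  mul-ε : ∀ {a} → In a → Mul (proj₁ ε) a a
  mul-ε pa = mul⁺ (proj₂ ε) pa pa (A.identityˡ (_ , pa))

  mul-unique : ∀ {a b c c′} → Mul a b c → Mul a b c′ → c ≋ c′
  mul-unique {a} {b} {c} {c′} m@(pa , pb , pc , _) m′@(_ , _ , pc′ , _) =
    A.trans {c , pc} {(a , pa) A.∙ (b , pb)} {c′ , pc′} (A.sym {(a , pa) A.∙ (b , pb)} {c , pc} (mul⁻ m pa pb pc)) (mul⁻ m′ pa pb pc′)

  mul-comm : ∀ {a b c} → Mul a b c → Mul b a c
  mul-comm {a} {b} {c} m@(pa , pb , pc , _) = mul⁺ pb pa pc
    (A.trans {(b , pb) A.∙ (a , pa)} {(a , pa) A.∙ (b , pb)} {c , pc}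
      (A.comm (b , pb) (a , pa)) (mul⁻ m pa pb pc))

  mul-cancelʳ : ∀ {a a′ b c} → Mul a b c → Mul a′ b c → a ≋ a′
  mul-cancelʳ {a} {a′} {b} {c} m@(pa , pb , pc , _) m′@(pa′ , _ , _ , _) =
    ∙-cancelʳ (_ , pb) (_ , pa) (_ , pa′)
      (A.trans {(a , pa) A.∙ (b , pb)} {c , pc} {(a′ , pa′) A.∙ (b , pb)}
        (mul⁻ m pa pb pc) (A.sym {(a′ , pa′) A.∙ (b , pb)} {c , pc} (mul⁻ m′ pa′ pb pc)))

  mul-cancelˡ : ∀ {a b b′ c} → Mul a b c → Mul a b′ c → b ≋ b′
  mul-cancelˡ m m′ = mul-cancelʳ (mul-comm m) (mul-comm m′)

  mul-assoc : ∀ {a b c d e f} → Mul a b c → Mul c d e → Mul b d f → Mul a f e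
  mul-assoc {a} {b} {c} {d} {e} {f} m@(pa , pb , pc , _) m′@(_ , pd , pe , _) m″@(_ , _ , pf , _) = mul⁺ pa pf pe (begin
    (a , pa) A.∙ (f , pf)                 ≈⟨ A.∙-congˡ {a , pa} (mul⁻ m″ pb pd pf) ⟨
    (a , pa) A.∙ ((b , pb) A.∙ (d , pd))  ≈⟨ A.assoc (a , pa) (b , pb) (d , pd) ⟨
    ((a , pa) A.∙ (b , pb)) A.∙ (d , pd)  ≈⟨ A.∙-congʳ {d , pd} (mul⁻ m pa pb pc) ⟩
    (c , pc) A.∙ (d , pd)                 ≈⟨ mul⁻ m′ pc pd pe ⟩
    (e , pe)                              ∎)

  divide : ∀ {a c} → In a → In c → ∃[ g ] Mul g a c
  divide {a} {c} pa pc = _ , mul⁺ (proj₂ ((c , pc) ∙ ((a , pa) ⁻¹))) pa pc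
    (A.trans {((c , pc) ∙ ((a , pa) ⁻¹)) ∙ (a , pa)} {(c , pc) ∙ (((a , pa) ⁻¹) ∙ (a , pa))} {c , pc}
      (A.assoc (c , pc) ((a , pa) ⁻¹) (a , pa))
      (A.trans {(c , pc) ∙ (((a , pa) ⁻¹) ∙ (a , pa))} {(c , pc) ∙ ε} {c , pc}
        (A.∙-congˡ {c , pc} (A.inverseˡ (a , pa))) (A.identityʳ (c , pc))))

  -- p₁ / q₁ = Y / X = p / q
  mul-ratio : ∀ {p₁ q₁ p q X Y z₁ z g} → Mul p₁ X z₁ → Mul q₁ Y z₁ → Mul p X z → Mul q Y z → Mul g q₁ p₁ → Mul g q p
  mul-ratio {g = g} p₁X q₁Y pX qY gq₁ =
    let gX , mgX   = mul-total (mul-left gq₁) (mul-right p₁X)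
        -- q₁ (g X) = z₁, so g X = Y
        q₁gX       = mul-assoc (mul-comm gq₁) p₁X mgX
        gX≋Y       = mul-cancelˡ q₁gX q₁Y
        gXY        = mul-resp (λ _ → ≈.refl) (λ _ → ≈.refl) gX≋Y mgX
        gq , mgq   = mul-total (mul-left gq₁) (mul-left qY)
        gqX , mgqX = mul-total (mul-result mgq) (mul-right p₁X)
        gqX′       = mul-assoc (mul-comm mgq) mgqX gXY
        gqX≋z      = mul-unique gqX′ qY
        gq≋p       = mul-cancelʳ (mul-resp (λ _ → ≈.refl) (λ _ → ≈.refl) gqX≋z mgqX) pX
    in mul-resp (λ _ → ≈.refl) (λ _ → ≈.refl) gq≋p mgq

-- A relation is solved for one of its terms with a nonnegative denominator; `ς` is opposite to the
-- sign of `i`.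
absolute-relation : ∀ i → ∃[ ς ] (∀ u w → i ℤ.* u ℤ.+ w ≡ 0ℤ → + ∣ i ∣ ℤ.* u ≡ ς ℤ.* w)
absolute-relation (+ n)    = ℤ.- 1ℤ , λ u w e →
  ≡.trans (lemma (+ n ℤ.* u) w) (≡.trans (≡.cong (λ z → z ℤ.+ ℤ.- 1ℤ ℤ.* w) e) (ℤ.+-identityˡ _))
  where
  lemma : ∀ v w → v ≡ v ℤ.+ w ℤ.+ ℤ.- 1ℤ ℤ.* w
  lemma = solve-∀
absolute-relation -[1+ n ] = 1ℤ , λ u w e →
  ≡.trans (lemma (+ suc n) u w) (≡.trans (≡.cong (λ z → 1ℤ ℤ.* w ℤ.- z) e) (ℤ.+-identityʳ _))
  where
  lemma : ∀ v u w → v ℤ.* u ≡ 1ℤ ℤ.* w ℤ.- (ℤ.- v ℤ.* u ℤ.+ w)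
  lemma = solve-∀

nonZero-∣∣ : ∀ {i} → i ≢ 0ℤ → NonZero ∣ i ∣
nonZero-∣∣ {+ zero}  i≢0 = ⊥-elim (i≢0 ≡.refl)
nonZero-∣∣ {+ suc n} i≢0 = _
nonZero-∣∣ { -[1+ n ]} i≢0 = _

Dependent : ∀ {k n} → Matrix k n → Vector ℤ k → Set
Dependent {n = n} W v = ∃[ N ] NonZero N × Σ (Vector ℤ n) λ e → ∀ r → + N ℤ.* v r ≡ dot (W r) e

common-denominator : ∀ {k n} (W : Matrix k n) s (v : Fin s → Vector ℤ k) → (∀ j → Dependent W (v j)) →
  ∃[ N ] NonZero N × Σ (Fin s → Vector ℤ n) λ κ → ∀ j r → + N ℤ.* v j r ≡ dot (W r) (κ j)
common-denominator W zero    v h = 1 , _ , (λ ()) , λ ()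
common-denominator W (suc s) v h with h zero | common-denominator W s (v ∘ suc) (h ∘ suc)
... | N , N≢0 , e , p | N′ , N′≢0 , κ , q =
  N ℕ.* N′ , ℕ.m*n≢0 N N′ {{N≢0}} {{N′≢0}} , (λ { zero i → + N′ ℤ.* e i ; (suc j) i → + N ℤ.* κ j i }) , λ
  { zero r    → ≡.trans (≡.cong (ℤ._* v zero r) (≡.trans (ℤ.pos-* N N′) (ℤ.*-comm (+ N) (+ N′))))
                  (≡.trans (ℤ.*-assoc (+ N′) (+ N) _) (≡.trans (≡.cong (+ N′ ℤ.*_) (p r)) (≡.sym (dot-scaleʳ (+ N′) (W r) e))))
  ; (suc j) r → ≡.trans (≡.cong (ℤ._* v (suc j) r) (ℤ.pos-* N N′))
                  (≡.trans (ℤ.*-assoc (+ N) (+ N′) _) (≡.trans (≡.cong (+ N ℤ.*_) (q j r)) (≡.sym (dot-scaleʳ (+ N) (W r) (κ j))))) }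

-- Charts of maximal rank and the exchange of shifts

module Charts {ℓ} (em : ExcludedMiddle ℓ) (Z : PresburgerModel ℓ) (G : DefinableAbelianGroup Z) where
  open Model Z
  open Definability Z
  open LinearAlgebra Z
  open MatrixAction Z
  open Multiplication Z G
  open DefinableAbelianGroup G using () renaming (dim to k; ε to εᴳ)

  -- A linear family x ↦ A x + c of elements of G, together with n directions T
  -- along which it is injective.
  record Chart (n : ℕ) : Set ℓ where
    field
      m         : ℕ
      A         : Matrix k m
      c         : Vector Carrier k
      T         : Matrix m n
      in-G      : Eventuallyⁿ m (λ x → In (affine-map A c x))
      injective : Injective (A ⊗ T)

  chart-bound : ∀ {n} → Chart n → n ℕ.≤ k
  chart-bound chart with relation-or-injective (A ⊗ T)
    where open Chart chart
  ... | inj₂ (n≤k , _) = n≤k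
  ... | inj₁ (e , (i , ei≢0) , h) = ⊥-elim (ei≢0 (injective⇒¬relation {V = A ⊗ T} injective e h i))
    where open Chart chart

  trivial-chart : Chart 0
  trivial-chart = record
    { m = 0 ; A = λ _ () ; c = proj₁ εᴳ ; T = λ ()
    ; in-G = def-resp def-In (λ r → ≈.sym (+-identityˡ _)) (proj₂ εᴳ)
    ; injective = λ _ _ () }

  maximal-chart : ∃[ n ] Chart n × ¬ Chart (suc n)
  maximal-chart = search (suc k) 0 (ℕ.+-identityʳ (suc k)) trivial-chart
    where
    search : ∀ fuel n → fuel ℕ.+ n ≡ suc k → Chart n → ∃[ n ] Chart n × ¬ Chart (suc n)
    search zero    n e chart = ⊥-elim (ℕ.<-irrefl ≡.refl (≡.subst (ℕ._≤ k) e (chart-bound chart)))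
    search (suc f) n e chart with em {Chart (suc n)}
    ... | yes chart′ = search f (suc n) (≡.trans (ℕ.+-suc f n) e) chart′
    ... | no  none   = n , chart , none

  affine-affine-map : ∀ {Γ k m} (A : Matrix k m) c {F} → Affineⱽ Γ F → Affineⱽ Γ (λ ε → affine-map A c (F ε))
  affine-affine-map A c aF i = affine-+ (affine-combination (A i) aF) (affine-const (c i))

  -- The family `U` and its directions `τ` are arbitrary because two cases are needed: the chart
  -- itself with `τ = T`, which makes it regular, and a curve of coset representatives.
  module Exchange {n} (chart : Chart n) (maximal : ¬ Chart (suc n))
                  {q} (B : Matrix k q) (b : Vector Carrier k) (U-in-G : Eventuallyⁿ q (λ u → In (affine-map B b u)))
                  {s} (τ : Matrix q s) where
    open Chart chart

    F : Vector Carrier m → Vector Carrier k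
    F = affine-map A c
    U : Vector Carrier q → Vector Carrier k
    U = affine-map B b

    Product : Vector Carrier k → Vector Carrier (m ℕ.+ q) → Set ℓ
    Product g v = Mul (U (drop m v)) (F (take m v)) g

    abstract
      def-Product : Definable (⟨ m ℕ.+ q ⟩ ▹ k) (λ (g , v) → Product g v)
      def-Product = def-substitute {σ = λ (g , v) → U (drop m v) , F (take m v) , g} def-Mul
        (affine-++ {F = λ (g , v) → U (drop m v)} {G = λ (g , v) → F (take m v) ++ g}
          (affine-affine-map B b (λ j → affine-env {Γ = ⟨ m ℕ.+ q ⟩} (m ↑ʳ j)))
          (affine-++ {F = λ (g , v) → F (take m v)} {G = proj₁}
            (affine-affine-map A c (λ j → affine-env {Γ = ⟨ m ℕ.+ q ⟩} (j ↑ˡ q)))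
            (λ i → affine-new {Γ = ⟨ m ℕ.+ q ⟩} i)))

    take-++ : ∀ {m q} (x : Vector Carrier m) (u : Vector Carrier q) → take m (x ++ u) ≋ x
    take-++ x u i = ≈.reflexive (lookup-++ˡ x u i)
    drop-++ : ∀ {m q} (x : Vector Carrier m) (u : Vector Carrier q) → drop m (x ++ u) ≋ u
    drop-++ x u i = ≈.reflexive (lookup-++ʳ x u i)

    products : Eventuallyⁿ (m ℕ.+ q) (λ v → ∃[ g ] Product g v)
    products = ev-join m q
      (λ e (g , p) → g , def-resp def-Product {g , _} {g , _} (++-cong {x = g} (λ _ → ≈.refl) e) p)
      (ev-map q (λ u pu → ev-map m (λ x px →
          let g , p = mul-total pu px
          in g , mul-resp (affine-map-cong B b (≋-sym (drop-++ x u))) (affine-map-cong A c (≋-sym (take-++ x u))) (λ _ → ≈.refl) p) in-G)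
        U-in-G)

    abstract
      linear : ∃[ M ] NonZero M × ∃[ A ] ∃[ c ] Eventuallyⁿ (m ℕ.+ q) (λ w → Product (affine-map A c w) (+ M ⊡ w))
      linear = linear-solutionⁿ (lower-em em) k (m ℕ.+ q) def-Product products

    M : ℕ
    M = proj₁ linear
    M≢0 : NonZero M
    M≢0 = proj₁ (proj₂ linear)
    L : Matrix k (m ℕ.+ q)
    L = proj₁ (proj₂ (proj₂ linear))
    l : Vector Carrier k
    l = proj₁ (proj₂ (proj₂ (proj₂ linear)))

    Lˣ : Matrix k m
    Lˣ r = take m (L r)
    Lᵘ : Matrix k q
    Lᵘ r = drop m (L r)

    Lin : Vector Carrier m → Vector Carrier q → Vector Carrier k
    Lin x u = (Lˣ ⊙ x) ⊞ (Lᵘ ⊙ u) ⊞ l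

    Good : Vector Carrier m → Vector Carrier q → Set ℓ
    Good x u = Mul (U (+ M ⊡ u)) (F (+ M ⊡ x)) (Lin x u)

    ⊡-cong : ∀ {n} i {x y : Vector Carrier n} → x ≋ y → i ⊡ x ≋ i ⊡ y
    ⊡-cong i e j = ·-cong i (e j)

    good-resp : ∀ {x x′ u u′} → x ≋ x′ → u ≋ u′ → Good x u → Good x′ u′
    good-resp x≋ u≋ = mul-resp (affine-map-cong B b (⊡-cong (+ M) u≋)) (affine-map-cong A c (⊡-cong (+ M) x≋))
      (λ r → +-congʳ (+-cong (⊙-cong Lˣ x≋ r) (⊙-cong Lᵘ u≋ r)))

    linear-products : Eventuallyⁿ (m ℕ.+ q) (λ w → Product (affine-map L l w) (+ M ⊡ w))
    linear-products = proj₂ (proj₂ (proj₂ (proj₂ linear)))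

    good : Eventuallyⁿ q (λ u → Eventuallyⁿ m (λ x → Good x u))
    good = ev-map q (λ u → ev-map m (λ x → mul-resp
        (affine-map-cong B b (⊡-cong (+ M) (drop-++ x u))) (affine-map-cong A c (⊡-cong (+ M) (take-++ x u)))
        (λ r → +-congʳ (combination-split m (L r) x u))))
      (ev-split m q (λ {v} {v′} e → def-resp def-Product {affine-map L l v , + M ⊡ v} {affine-map L l v′ , + M ⊡ v′}
          (++-cong (affine-map-cong L l e) (⊡-cong (+ M) e)))
        linear-products)

    ⊙-vanish : ∀ {x y z} → (∀ r → (Lˣ ⊙ y) r ≈ (Lᵘ ⊙ z) r) → ∀ u → Lin (x ⊞ y) u ≋ Lin x (u ⊞ z)
    ⊙-vanish {x} {y} {z} e u r = +-congʳ (≈.trans (+-congʳ (⊙-⊞ Lˣ x y r))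
      (≈.trans (+-assoc _ _ _) (+-congˡ (≈.trans (+-comm _ _) (≈.trans (+-congˡ (e r)) (≈.sym (⊙-⊞ Lᵘ u z r)))))))

    zeros : ∀ {n} → Vector Carrier n
    zeros _ = 0ᶻ

    x⊞0 : ∀ {n} (x : Vector Carrier n) → x ⊞ zeros ≋ x
    x⊞0 x i = +-identityʳ (x i)

    -- With `u` held fixed, the factor coming from `U` cancels. If `Lˣ T d` vanishes, then `F` takes
    -- the same value at two points that differ by `M T d`, so `A T d` vanishes after division by
    -- `M`.
    Lˣ-injective : Injective (Lˣ ⊗ T)
    Lˣ-injective d h = injective d λ r → torsion-free (+ M) M≢0ℤ (≈.trans (≈.sym (⊙-⊡′ r)) (fixed r))
      where
      M≢0ℤ : + M ≢ 0ℤ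
      M≢0ℤ e = ℕ.≢-nonZero⁻¹ M {{M≢0}} (ℤ.+-injective e)
      both : Eventuallyⁿ q (λ u → Eventuallyⁿ m (λ x → Good x u × Good (x ⊞ T ⊙ d) u))
      both = ev-map q (λ u g → ev-× m g (ev-shift m (λ e → good-resp e (λ _ → ≈.refl)) (T ⊙ d) g)) good
      u = proj₁ (ev-witness q both)
      x = proj₁ (ev-witness m (proj₂ (ev-witness q both)))
      p = proj₂ (ev-witness m (proj₂ (ev-witness q both)))
      same : Lin (x ⊞ T ⊙ d) u ≋ Lin x u
      same = ≋-trans (⊙-vanish {x} {T ⊙ d} {zeros} (λ r → ≈.trans (≈.sym (⊗-⊙ Lˣ T d r)) (≈.trans (h r) (≈.sym (combination-0 (Lᵘ r))))) u)
                     (λ r → +-congʳ (+-congˡ (⊙-cong Lᵘ (x⊞0 u) r)))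
      equal : F (+ M ⊡ x) ≋ F (+ M ⊡ (x ⊞ T ⊙ d))
      equal = mul-cancelˡ (proj₁ p) (mul-resp (λ _ → ≈.refl) (λ _ → ≈.refl) same (proj₂ p))
      fixed : ∀ r → (A ⊙ + M ⊡ T ⊙ d) r ≈ 0ᶻ
      fixed = affine-map-fixed A c (+ M ⊡ x) (+ M ⊡ T ⊙ d)
        (≋-trans equal (affine-map-cong A c (λ i → ·-distribˡ (+ M) (x i) ((T ⊙ d) i))))
      ⊙-⊡′ : ∀ r → (A ⊙ + M ⊡ T ⊙ d) r ≈ + M · ((A ⊗ T) ⊙ d) r
      ⊙-⊡′ r = ≈.trans (⊙-⊡ A (+ M) (T ⊙ d) r) (·-cong (+ M) (≈.sym (⊗-⊙ A T d r)))

    column : Fin s → Vector ℤ k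
    column j r = (Lᵘ ⊗ τ) r j

    -- The new direction moves `u` only and the old ones move `x` only, so the product with `L` has
    -- the columns `Lᵘ τⱼ` and `Lˣ T`.
    bordered : Fin s → Matrix (m ℕ.+ q) (suc n)
    bordered j = (λ i → 0ℤ ∷ T i) ++ (λ i → τ i j ∷ λ _ → 0ℤ)

    -- Otherwise L would be a chart with n + 1 directions.
    dependent : ∀ j → Dependent (Lˣ ⊗ T) (column j)
    dependent j with relation-or-injective (L ⊗ bordered j)
    ... | inj₂ (_ , inj) = ⊥-elim (maximal (record
      { m = m ℕ.+ q ; A = L ; c = l ; T = bordered j ; in-G = ev-map (m ℕ.+ q) (λ _ → mul-result) linear-products ; injective = inj }))
    ... | inj₁ (e , (i , ei≢0) , h) = ∣ head e ∣ , nonZero-∣∣ e₀≢0 , solution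
      where
      T′ : Matrix (m ℕ.+ q) (suc n)
      T′ = bordered j
      upper-row : ∀ i a → T′ (a ↑ˡ q) i ≡ (0ℤ ∷ T a) i
      upper-row i a = ≡.cong (λ row → row i) (lookup-++ˡ (λ i → 0ℤ ∷ T i) (λ i → τ i j ∷ λ _ → 0ℤ) a)
      lower-row : ∀ i a → T′ (m ↑ʳ a) i ≡ (τ a j ∷ λ _ → 0ℤ) i
      lower-row i a = ≡.cong (λ row → row i) (lookup-++ʳ (λ i → 0ℤ ∷ T i) (λ i → τ i j ∷ λ _ → 0ℤ) a)
      dot-zeroʳ : ∀ {n} (a : Vector ℤ n) → dot a (λ _ → 0ℤ) ≡ 0ℤ
      dot-zeroʳ {zero}  a = ≡.refl
      dot-zeroʳ {suc n} a = ≡.cong₂ ℤ._+_ (ℤ.*-zeroʳ (head a)) (dot-zeroʳ (tail a))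
      first : ∀ r → (L ⊗ T′) r zero ≡ column j r
      first r = ≡.trans (dot-split m (L r) (λ a → T′ a zero))
        (≡.trans (≡.cong₂ ℤ._+_ (≡.trans (dot-cong {a = Lˣ r} (λ _ → ≡.refl) (upper-row zero)) (dot-zeroʳ (Lˣ r)))
                                (dot-cong {a = Lᵘ r} (λ _ → ≡.refl) (lower-row zero)))
                 (ℤ.+-identityˡ _))
      later : ∀ r i → (L ⊗ T′) r (suc i) ≡ (Lˣ ⊗ T) r i
      later r i = ≡.trans (dot-split m (L r) (λ a → T′ a (suc i)))
        (≡.trans (≡.cong₂ ℤ._+_ (dot-cong {a = Lˣ r} (λ _ → ≡.refl) (upper-row (suc i)))
                                (≡.trans (dot-cong {a = Lᵘ r} (λ _ → ≡.refl) (lower-row (suc i))) (dot-zeroʳ (Lᵘ r))))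
                 (ℤ.+-identityʳ _))
      relation : ∀ r → head e ℤ.* column j r ℤ.+ dot ((Lˣ ⊗ T) r) (tail e) ≡ 0ℤ
      relation r = ≡.trans (≡.cong₂ ℤ._+_ (≡.trans (ℤ.*-comm (head e) _) (≡.cong (ℤ._* head e) (≡.sym (first r))))
                                          (dot-cong {x = tail e} (λ i → ≡.sym (later r i)) (λ _ → ≡.refl)))
                           (h r)
      -- A relation that avoids the new column would be one among the columns of `Lˣ T`, which are
      -- independent.
      e₀≢0 : head e ≢ 0ℤ
      e₀≢0 e₀≡0 = ei≢0 (all-zero i)
        where
        tail-zero : ∀ i → tail e i ≡ 0ℤ
        tail-zero = injective⇒¬relation {V = Lˣ ⊗ T} Lˣ-injective (tail e) λ r →
          ≡.trans (≡.sym (≡.trans (≡.cong (λ z → z ℤ.* column j r ℤ.+ dot ((Lˣ ⊗ T) r) (tail e)) e₀≡0)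
                          (≡.trans (≡.cong (ℤ._+ dot ((Lˣ ⊗ T) r) (tail e)) (ℤ.*-zeroˡ (column j r))) (ℤ.+-identityˡ _)))) (relation r)
        all-zero : ∀ i → e i ≡ 0ℤ
        all-zero zero    = e₀≡0
        all-zero (suc i) = tail-zero i
      solution : Σ (Vector ℤ n) λ e′ → ∀ r → + ∣ head e ∣ ℤ.* column j r ≡ dot ((Lˣ ⊗ T) r) e′
      solution = let ς , f = absolute-relation (head e) in (λ i → ς ℤ.* tail e i) ,
        λ r → ≡.trans (f _ _ (relation r)) (≡.sym (dot-scaleʳ ς ((Lˣ ⊗ T) r) (tail e)))

    abstract
      denominator : ∃[ N ] NonZero N × Σ (Fin s → Vector ℤ n) λ κ → ∀ j r → + N ℤ.* column j r ≡ dot ((Lˣ ⊗ T) r) (κ j)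
      denominator = common-denominator (Lˣ ⊗ T) s column dependent
    N : ℕ
    N = proj₁ denominator
    N≢0 : NonZero N
    N≢0 = proj₁ (proj₂ denominator)
    κ : Matrix n s
    κ i j = proj₁ (proj₂ (proj₂ denominator)) j i

    balanced : ∀ d r → (Lᵘ ⊙ + N ⊡ τ ⊙ d) r ≈ (Lˣ ⊙ T ⊙ κ ⊙ d) r
    balanced d r = ≈.trans (⊙-⊡ Lᵘ (+ N) (τ ⊙ d) r) (≈.trans (·-cong (+ N) (≈.sym (⊗-⊙ Lᵘ τ d r)))
      (≈.trans (≈.sym (combination-*ˡ (+ N) ((Lᵘ ⊗ τ) r) d))
      (≈.trans (combination-congˡ d (λ j → proj₂ (proj₂ (proj₂ denominator)) j r))
      (≈.trans (combination-column ((Lˣ ⊗ T) r) κ d) (⊗-⊙ Lˣ T (κ ⊙ d) r)))))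

    -- Shifting `u` by `N τ d` changes the linear form of the product exactly as shifting `x` by
    -- `T κ d` does, so both products equal the same `z`. Although `N` and `κ` are standard, `d` may
    -- be any vector over `Z`.
    exchange : ∀ d → Eventuallyⁿ q (λ u → Eventuallyⁿ m (λ x → ∃[ z ]
      Mul (U (+ M ⊡ (u ⊞ + N ⊡ τ ⊙ d))) (F (+ M ⊡ x)) z × Mul (U (+ M ⊡ u)) (F (+ M ⊡ (x ⊞ T ⊙ κ ⊙ d))) z))
    exchange d = ev-map q (λ u (p , p′) → ev-map m (λ x (g , g′) → Lin x (u ⊞ + N ⊡ τ ⊙ d) , g ,
        mul-resp (λ _ → ≈.refl) (λ _ → ≈.refl) (⊙-vanish {x} {T ⊙ κ ⊙ d} {+ N ⊡ τ ⊙ d} (λ r → ≈.sym (balanced d r)) u) g′)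
        (ev-× m p p′))
      (ev-× q (ev-shift q (λ e → ev-map m (λ x → good-resp (λ _ → ≈.refl) e)) (+ N ⊡ τ ⊙ d) good)
              (ev-map q (λ u → ev-shift m (λ e → good-resp e (λ _ → ≈.refl)) (T ⊙ κ ⊙ d)) good))

-- Charts whose shift quotients are constant

module RegularCharts {ℓ} (em : ExcludedMiddle ℓ) (Z : PresburgerModel ℓ) (G : DefinableAbelianGroup Z) where
  open Model Z
  open Definability Z
  open LinearAlgebra Z
  open MatrixAction Z
  open Multiplication Z G
  open Charts em Z G
  open DefinableAbelianGroup G using () renaming (dim to k; ε to εᴳ)

  +-nonzero : ∀ n .{{_ : NonZero n}} → + n ≢ 0ℤ
  +-nonzero (suc n) ()

  -- The quotient F (x + T d) / F x is eventually independent of x.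
  record Regular (n : ℕ) : Set ℓ where
    field
      chart     : Chart n
    open Chart chart public
    field
      translate : ∀ d → ∃[ g ] Eventuallyⁿ m (λ x → Mul g (affine-map A c x) (affine-map A c (x ⊞ T ⊙ d)))

  make-regular : ∀ {n} → Chart n → ¬ Chart (suc n) → Regular n
  make-regular {n} chart maximal = record
    { chart = record { m = m ; A = A′ ; c = c ; T = T ; in-G = in-G′ ; injective = injective′ }
    ; translate = translate }
    where
    open Chart chart
    open Exchange chart maximal A c in-G T using (M; M≢0; N; N≢0; κ; exchange)
    instance
      _ : NonZero M
      _ = M≢0
      _ : NonZero N
      _ = N≢0
    F : Vector Carrier m → Vector Carrier k
    F = affine-map A c
    A′ : Matrix k m
    -- The new family is `x` ↦ `F (M N x)`. With `u = N x`, moving `x` by `T d` moves `u` by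
    -- `N T d`, which is the shift that `exchange` treats.
    A′ r j = + (M ℕ.* N) ℤ.* A r j
    A′-action : ∀ x r → (A′ ⊙ x) r ≈ + M · + N · (A ⊙ x) r
    A′-action x r = ≈.trans (combination-*ˡ (+ (M ℕ.* N)) (A r) x)
      (≈.trans (≈.reflexive (≡.cong (_· (A ⊙ x) r) (ℤ.pos-* M N))) (*-· (+ M) (+ N) _))
    F′≋ : ∀ x → affine-map A′ c x ≋ F (+ M ⊡ + N ⊡ x)
    F′≋ x r = +-congʳ (≈.trans (A′-action x r) (≈.sym (≈.trans (⊙-⊡ A (+ M) (+ N ⊡ x) r) (·-cong (+ M) (⊙-⊡ A (+ N) x r)))))
    F-resp : ∀ {x y} → x ≋ y → F (+ M ⊡ x) ≋ F (+ M ⊡ y)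
    F-resp e = affine-map-cong A c (λ i → ·-cong (+ M) (e i))

    in-G′ : Eventuallyⁿ m (λ x → In (affine-map A′ c x))
    in-G′ = ev-map m (λ x → def-resp def-In (≋-sym (F′≋ x)))
      (ev-scale m (λ e → def-resp def-In (F-resp e)) N (ev-scale m (λ e → def-resp def-In (affine-map-cong A c e)) M in-G))

    injective′ : Injective (A′ ⊗ T)
    injective′ d h = injective d λ r → torsion-free (+ N) (+-nonzero N) (torsion-free (+ M) (+-nonzero M)
      (≈.trans (·-cong (+ M) (·-cong (+ N) (⊗-⊙ A T d r)))
      (≈.trans (≈.sym (A′-action (T ⊙ d) r)) (≈.trans (≈.sym (⊗-⊙ A′ T d r)) (h r)))))

    module _ (d : Vector Carrier n) where
      Row : Vector Carrier m → Set ℓ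
      Row u = Eventuallyⁿ m (λ x → ∃[ z ] Mul (F (+ M ⊡ (u ⊞ + N ⊡ T ⊙ d))) (F (+ M ⊡ x)) z ×
                                          Mul (F (+ M ⊡ u)) (F (+ M ⊡ (x ⊞ T ⊙ κ ⊙ d))) z)

      abstract
        translate : ∃[ g ] Eventuallyⁿ m (λ x → Mul g (affine-map A′ c x) (affine-map A′ c (x ⊞ T ⊙ d)))
        translate with ev-witness m (exchange d)
        ... | u₁ , row₁ with ev-witness m row₁
        ...   | _ , _ , p₁ , q₁ with divide (mul-left q₁) (mul-left p₁)
        ...     | g , gq₁ = g , ev-map m (λ x → mul-resp (λ _ → ≈.refl) (≋-sym (F′≋ x))
                    (≋-trans (F-resp (λ i → ≈.sym (·-distribˡ (+ N) (x i) ((T ⊙ d) i)))) (≋-sym (F′≋ (x ⊞ T ⊙ d)))))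
                  (ev-scale m (λ e → mul-resp (λ _ → ≈.refl) (F-resp e) (F-resp (λ i → +-congʳ (e i)))) N
                    (ev-map m ratio (exchange d)))
          where
          -- The rows of `u₁` and `u` each hold for eventually all `x`, so they share some `x`. At
          -- it both quotients equal the same quotient of values at `x`, whence `g` serves every
          -- `u`.
          ratio : ∀ u → Row u → Mul g (F (+ M ⊡ u)) (F (+ M ⊡ (u ⊞ + N ⊡ T ⊙ d)))
          ratio u row = let x , (z₁ , p₁ , q₁) , (z , p , q) = ev-witness m (ev-× m row₁ row) in mul-ratio p₁ q₁ p q gq₁

-- The subgroup of translations

module Lattice {ℓ} (em : ExcludedMiddle ℓ) (Z : PresburgerModel ℓ) (G : DefinableAbelianGroup Z)
               {n} (regular : RegularCharts.Regular em Z G n) where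
  open Model Z
  open Definability Z
  open LinearAlgebra Z
  open MatrixAction Z
  open Multiplication Z G
  open Charts em Z G
  open Choice Z
  open RegularCharts em Z G
  open Regular regular
  open DefinableAbelianGroup G using (universe; ε; _⁻¹; _∙_; isAbelianGroup) renaming (dim to k)
  open Semantics {C = Carrier} id

  F : Vector Carrier m → Vector Carrier k
  F = affine-map A c

  -- The graph of the homomorphism `θ`. It is definable because "eventually" is expressed by
  -- quantifiers over the standard number `m` of variables.
  Translation : Vector Carrier n → Vector Carrier k → Set ℓ
  Translation d g = Eventuallyⁿ m (λ x → Mul g (F x) (F (x ⊞ T ⊙ d)))

  abstract
    def-Translation : Definable (⟨ n ⟩ ▹ k) (λ (g , d) → Translation d g)
    def-Translation = def-Eventuallyⁿ m {P = λ x (g , d) → Mul g (F x) (F (x ⊞ T ⊙ d))}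
      (def-substitute {σ = λ (x , g , d) → g , F x , F (x ⊞ T ⊙ d)} def-Mul
        (affine-++ {F = λ (x , g , d) → g} {G = λ (x , g , d) → F x ++ F (x ⊞ T ⊙ d)} (λ i → affine-old (affine-new {Γ = ⟨ n ⟩} i))
          (affine-++ {F = λ (x , g , d) → F x} {G = λ (x , g , d) → F (x ⊞ T ⊙ d)}
            (affine-affine-map A c affine-new)
            (affine-affine-map A c (λ i → affine-+ (affine-new i)
              (affine-combination (T i) (λ j → affine-old (affine-env {Γ = ⟨ n ⟩} j))))))))

  translation-resp : ∀ {d d′ g g′} → d ≋ d′ → g ≋ g′ → Translation d g → Translation d′ g′
  translation-resp {d} {d′} {g} {g′} d≋ g≋ = def-resp def-Translation {g , d} {g′ , d′} (++-cong g≋ d≋)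

  translation-in : ∀ {d g} → Translation d g → In g
  translation-in t = mul-left (proj₂ (ev-witness m t))

  translation-unique : ∀ {d g g′} → Translation d g → Translation d g′ → g ≋ g′
  translation-unique t t′ = let _ , p , p′ = ev-witness m (ev-× m t t′) in mul-cancelʳ p p′

  -1·x≈-x : ∀ x → (ℤ.- 1ℤ) · x ≈ -ᶻ x
  -1·x≈-x x = -‿cong (+-identityʳ x)

  translation-injective : ∀ {d d′ g} → Translation d g → Translation d′ g → d ≋ d′
  translation-injective {d} {d′} t t′ i = cancel (injective (d ⊞ (ℤ.- 1ℤ) ⊡ d′) (λ r →
      ≈.trans (⊙-⊞ (A ⊗ T) d ((ℤ.- 1ℤ) ⊡ d′) r) (≈.trans (+-cong (row r) (≈.trans (⊙-⊡ (A ⊗ T) (ℤ.- 1ℤ) d′ r) (-1·x≈-x _))) (-‿inverseʳ _))) i)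
    where
    x = proj₁ (ev-witness m (ev-× m t t′))
    p = proj₂ (ev-witness m (ev-× m t t′))
    equal : F (x ⊞ T ⊙ d) ≋ F (x ⊞ T ⊙ d′)
    equal = mul-unique (proj₁ p) (proj₂ p)
    row : ∀ r → ((A ⊗ T) ⊙ d) r ≈ ((A ⊗ T) ⊙ d′) r
    row r = ≈.trans (⊗-⊙ A T d r) (≈.trans (+-cancelʳ-≈ (F x r)
      (≈.trans (≈.sym (affine-map-⊞ A c x (T ⊙ d) r)) (≈.trans (equal r) (affine-map-⊞ A c x (T ⊙ d′) r))))
      (≈.sym (⊗-⊙ A T d′ r)))
    cancel : ∀ {x y} → x +ᶻ (ℤ.- 1ℤ) · y ≈ 0ᶻ → x ≈ y
    cancel {x} {y} e = +-cancelʳ-≈ (-ᶻ y) (≈.trans (≈.trans (+-congˡ (≈.sym (-1·x≈-x y))) e) (≈.sym (-‿inverseʳ y)))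

  translation-+ : ∀ {d d′ g g′ h} → Translation d g → Translation d′ g′ → Mul g g′ h → Translation (d ⊞ d′) h
  translation-+ {d} {d′} t t′ gg′h = ev-map m step (ev-× m t
      -- The second translation is needed at the point already moved by `T d`.
      (ev-shift m (λ e → mul-resp (λ _ → ≈.refl) (affine-map-cong A c e) (affine-map-cong A c (λ i → +-congʳ (e i)))) (T ⊙ d) t′))
    where
    step : ∀ x → _ → _
    step x (p , q) =
      let e , he = mul-total (mul-result gg′h) (mul-right p)
          g′e    = mul-assoc (mul-comm gg′h) he p
      in mul-resp (λ _ → ≈.refl) (λ _ → ≈.refl)
           (≋-trans (mul-unique g′e q) (affine-map-cong A c (λ i → ≈.trans (+-assoc _ _ _) (+-congˡ (≈.sym (⊙-⊞ T d d′ i)))))) he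

  zeros : Vector Carrier n
  zeros _ = 0ᶻ

  translation-ε : Translation zeros (proj₁ ε)
  translation-ε = ev-map m (λ x p → mul-resp (λ _ → ≈.refl) (λ _ → ≈.refl)
    (affine-map-cong A c (λ i → ≈.sym (≈.trans (+-congˡ (combination-0 (T i))) (+-identityʳ (x i))))) (mul-ε p)) in-G

  mul-inverse : ∀ (g : Element Z universe) → Mul (proj₁ g) (proj₁ (g ⁻¹)) (proj₁ ε)
  mul-inverse g = mul-resp (λ _ → ≈.refl) (λ _ → ≈.refl)
    (IsAbelianGroup.inverseʳ isAbelianGroup g) (mul-intro g (g ⁻¹))

  -- Regularity supplies some `g′` for the opposite direction. The product of `g` and `g′` belongs
  -- to the zero direction, so by uniqueness it is `ε`, and `g′` is the inverse.
  translation-⁻¹ : ∀ {d} (g : Element Z universe) → Translation d (proj₁ g) → Translation (λ i → -ᶻ d i) (proj₁ (g ⁻¹))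
  translation-⁻¹ {d} g t =
    let g′ , t′  = translate (λ i → -ᶻ d i)
        h , gg′h = mul-total (proj₂ g) (translation-in t′)
        h≋ε      = translation-unique (translation-resp {g = h} (λ i → -‿inverseʳ (d i)) (λ _ → ≈.refl) (translation-+ t t′ gg′h)) translation-ε
    in translation-resp (λ _ → ≈.refl)
         (mul-cancelˡ (mul-resp (λ _ → ≈.refl) (λ _ → ≈.refl) h≋ε gg′h) (mul-inverse g)) t′

  InLattice : Vector Carrier k → Set ℓ
  InLattice g = ∃[ d ] Translation d g

  abstract
    def-Lattice : Definable ⟨ k ⟩ InLattice
    def-Lattice = def-∃ n {P = λ d g → Translation d g}
      (def-substitute {σ = λ (d , g) → g , d} def-Translation
        (affine-++ {F = proj₂} {G = proj₁} (λ i → affine-env {Γ = ⟨ k ⟩} i) (λ i → affine-new {Γ = ⟨ k ⟩} i)))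

  latticeᶠ : DefinableSet Z k
  latticeᶠ = proj₁ def-Lattice

  lattice⁺ : ∀ {g} → InLattice g → ⟦ latticeᶠ ⟧ g
  lattice⁺ {g} = to (proj₂ def-Lattice g)

  lattice⁻ : ∀ {g} → ⟦ latticeᶠ ⟧ g → InLattice g
  lattice⁻ {g} = from (proj₂ def-Lattice g)

  lattice : DefinableSubgroup Z G
  lattice = record
    { subset    = latticeᶠ
    ; subset⊆G  = λ x p → translation-in (proj₂ (lattice⁻ p))
    ; ∙-closed  = λ x y p q → lattice⁺ (_ , translation-+ (proj₂ (lattice⁻ p)) (proj₂ (lattice⁻ q)) (mul-intro x y))
    ; ε-closed  = lattice⁺ (zeros , translation-ε)
    ; ⁻¹-closed = λ x p → lattice⁺ (_ , translation-⁻¹ x (proj₂ (lattice⁻ p)))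
    }

  private
    H = DefinableSubgroup.definableGroup lattice
    module H = DefinableAbelianGroup H

  coordinates : Element Z latticeᶠ → Vector Carrier n
  coordinates (g , p) = proj₁ (lattice⁻ p)

  coordinates-correct : ∀ g → Translation (coordinates g) (proj₁ g)
  coordinates-correct (g , p) = proj₂ (lattice⁻ p)

  -- The map from the subgroup to Zⁿ inverts `θ`. Since `def-Translation` lists `g` before `d`, its
  -- formula is the graph of this inverse as it stands.
  lattice-isomorphism : DefinableIsomorphism Z H (powerGroup Z n)
  lattice-isomorphism = record
    { to = λ g → coordinates g , id
    ; to-definable = proj₁ def-Translation , λ g d → mk⇔
        (λ e → to (proj₂ def-Translation (proj₁ g , proj₁ d)) (translation-resp e (λ _ → ≈.refl) (coordinates-correct g)))
        (λ p → translation-injective (coordinates-correct g) (from (proj₂ def-Translation (proj₁ g , proj₁ d)) p))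
    ; isGroupIsomorphism = record
      { isGroupMonomorphism = record
        { isGroupHomomorphism = record
          { isMonoidHomomorphism = record
            { isMagmaHomomorphism = record
              { isRelHomomorphism = record
                { cong = λ {g} {g′} e → translation-injective (coordinates-correct g)
                           (translation-resp (λ _ → ≈.refl) (≋-sym e) (coordinates-correct g′)) }
              ; homo = λ g g′ → translation-injective (coordinates-correct (g H.∙ g′))
                  (translation-+ (coordinates-correct g) (coordinates-correct g′) (mul-intro (include g) (include g′)))
              }
            ; ε-homo = translation-injective (coordinates-correct H.ε) translation-ε
            }
          ; ⁻¹-homo = λ g → translation-injective (coordinates-correct (g H.⁻¹)) (translation-⁻¹ (include g) (coordinates-correct g))
          }
        ; injective = λ {g} {g′} e → translation-unique (coordinates-correct g)
            (translation-resp (≋-sym e) (λ _ → ≈.refl) (coordinates-correct g′))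
        }
      ; surjective = λ (d , _) → let g , t = translate d in (g , lattice⁺ (d , t)) ,
          λ {g′} e → translation-injective (coordinates-correct g′) (translation-resp (λ _ → ≈.refl) (≋-sym e) t)
      }
    }
    where
    include : Element Z latticeᶠ → Element Z universe
    include (g , p) = g , translation-in (proj₂ (lattice⁻ p))

-- Coset representatives and their boundedness

module Quotient {ℓ} (em : ExcludedMiddle ℓ) (Z : PresburgerModel ℓ) (G : DefinableAbelianGroup Z)
                {n} (regular : RegularCharts.Regular em Z G n) (maximal : ¬ Charts.Chart em Z G (suc n)) where
  open Model Z
  open Definability Z
  open LinearAlgebra Z
  open MatrixAction Z
  open Multiplication Z G
  open Charts em Z G
  open Choice Z
  open CanonicalExistence Z (lower-em em)
  open RegularCharts em Z G using (module Regular; +-nonzero)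
  open Regular regular
  open Lattice em Z G regular
  open DefinableAbelianGroup G using (universe; ε; _⁻¹; _∙_) renaming (dim to k)
  open Semantics {C = Carrier} id

  InCoset : Vector Carrier k → Vector Carrier k → Set ℓ
  InCoset g r = ∃[ h ] InLattice h × Mul g h r

  abstract
    def-InCoset : Definable (⟨ k ⟩ ▹ k) (λ (r , g) → InCoset g r)
    def-InCoset = def-∃ k {P = λ h (r , g) → InLattice h × Mul g h r} (def-∧
      (def-substitute {σ = λ (h , r , g) → h} def-Lattice affine-new)
      (def-substitute {σ = λ (h , r , g) → g , h , r} def-Mul
        (affine-++ {F = λ (h , r , g) → g} {G = λ (h , r , g) → h ++ r} (λ i → affine-old (affine-env {Γ = ⟨ k ⟩} i))
          (affine-++ {F = λ (h , r , g) → h} {G = λ (h , r , g) → r} affine-new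
            (λ i → affine-old (affine-new {Γ = ⟨ k ⟩} i))))))

  coset-right : ∀ {g r} → InCoset g r → In r
  coset-right (_ , _ , p) = mul-result p

  coset-refl : ∀ {g} → In g → InCoset g g
  coset-refl pg = proj₁ ε , (zeros , translation-ε) , mul-comm (mul-ε pg)

  coset-trans : ∀ {g r s} → InCoset g r → InCoset r s → InCoset g s
  coset-trans (h , (_ , t) , p) (h′ , (_ , t′) , p′) =
    let hh′ , q = mul-total (mul-right p) (mul-right p′)
    in hh′ , (_ , translation-+ t t′ q) , mul-assoc p p′ q

  coset-sym : ∀ {g r} → InCoset g r → InCoset r g
  coset-sym {g} {r} (h , (d , t) , p) =
    let h⁻¹   = (h , mul-right p) ⁻¹
        e , q = mul-total (mul-result p) (proj₂ h⁻¹)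
        gεe   = mul-assoc p q (mul-inverse (h , mul-right p))
    in proj₁ h⁻¹ , (_ , translation-⁻¹ (h , mul-right p) t) ,
       mul-resp (λ _ → ≈.refl) (λ _ → ≈.refl) (mul-unique gεe (mul-comm (mul-ε (mul-left p)))) q

  coset-resp : ∀ {g} → Respects (InCoset g)
  coset-resp {g} {r} {r′} e = def-resp def-InCoset {r , g} {r′ , g} (++-cong e (λ _ → ≈.refl))

  same-coset : ∀ {g r} → InCoset g r → ∀ v → InCoset g v ⇔ InCoset r v
  same-coset p v = mk⇔ (coset-trans (coset-sym p)) (coset-trans p)

  -- The coset of `r` is described by `r` itself, so the representatives form a definable set
  -- without any definable function that selects them.
  Representative : Vector Carrier k → Set ℓ
  Representative r = In r × Canonicalⁿ k (InCoset r) r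

  abstract
    def-Representative : Definable ⟨ k ⟩ Representative
    def-Representative = def-∧ def-In (def-substitute {σ = λ r → r , r}
      (def-canonicalⁿ {Γ = ⟨ k ⟩} k {S = λ w g → InCoset g w} def-InCoset)
      (affine-++ {F = id} {G = id} (λ i → affine-var i) (λ i → affine-var i)))

  representative-unique : ∀ {r r′} → Representative r → Representative r′ → InCoset r r′ → r ≋ r′
  representative-unique (_ , p) (_ , p′) c = canonicalⁿ-unique k coset-resp (same-coset c) p p′

  representative-exists : ∀ {g} → In g → ∃[ r ] Representative r × InCoset g r
  representative-exists {g} pg =
    let r , p = canonicalⁿ-exists k (def-substitute {σ = λ r → r , g} def-InCoset
                  (affine-++ {F = id} {G = λ _ → g} (λ i → affine-var i) (λ i → affine-const (g i)))) (g , coset-refl pg)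
        c     = canonicalⁿ-sound k coset-resp p
    in r , (coset-right c , canonicalⁿ-cong k (same-coset c) p) , c

  in-coset⁺ : ∀ (g r : Element Z universe) → InLattice (proj₁ (g ⁻¹ ∙ r)) → InCoset (proj₁ g) (proj₁ r)
  in-coset⁺ g r l = _ , l , mul-assoc (mul-inverse g) (mul-ε (proj₂ r)) (mul-intro (g ⁻¹) r)

  in-coset⁻ : ∀ (g r : Element Z universe) → InCoset (proj₁ g) (proj₁ r) → InLattice (proj₁ (g ⁻¹ ∙ r))
  in-coset⁻ g r (h , l , p) = def-resp def-Lattice
    (mul-cancelˡ p (mul-assoc (mul-inverse g) (mul-ε (proj₂ r)) (mul-intro (g ⁻¹) r))) l

  Within : Carrier → Vector Carrier k → Set ℓ
  Within c y = ∀ i → (-ᶻ c ≤ y i) × (y i ≤ c)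

  Large : Vector Carrier k → Vector Carrier 1 → Set ℓ
  Large y t = Representative y × (Within (head t) y → ⊥ {ℓ})

  affine-neg : ∀ {Γ f} → Affine Γ f → Affine Γ (λ ε → -ᶻ f ε)
  affine-neg ((p , q) , h) = (q , p) , λ ε → ≈.trans (-‿cong (h ε)) (neg-sub _ _)

  def-≤ : ∀ {Γ f g} → Affine Γ f → Affine Γ g → Definable Γ (λ ε → f ε ≤ g ε)
  def-≤ af ag = def-∨ (def-< af ag) (def-≈ af ag)

  abstract
    def-Large : Definable (⟨ 1 ⟩ ▹ k) (λ (y , t) → Large y t)
    def-Large = def-∧ (def-substitute {σ = λ (y , t) → y} def-Representative (λ i → affine-new {Γ = ⟨ 1 ⟩} i))
      (def-→ (def-Π k (λ i → def-∧ (def-≤ (affine-neg t₀) (y i)) (def-≤ (y i) t₀))) def-⊥)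
      where
      t₀ : Affine (⟨ 1 ⟩ ▹ k) (λ (y , t) → head t)
      t₀ = affine-env {Γ = ⟨ 1 ⟩} zero
      y : ∀ i → Affine (⟨ 1 ⟩ ▹ k) (λ (y , t) → y i)
      y i = affine-new {Γ = ⟨ 1 ⟩} i

  eventually-all : ∀ n {P : Fin n → Carrier → Set ℓ} → (∀ i → Eventually (P i)) → Eventually (λ x → ∀ i → P i x)
  eventually-all zero    h = 0ᶻ , λ x _ ()
  eventually-all (suc n) h = eventually-map (λ x → λ { (p , q) zero → p ; (p , q) (suc i) → q i })
    (eventually-× (h zero) (eventually-all n (h ∘ suc)))

  eventually-within : ∀ y → Eventually (λ t → Within t y)
  eventually-within y = eventually-all k λ i → let C , h = upper-bound (y i) (-ᶻ y i) in
    C , λ t C<t → let y<t , -y<t = h t C<t in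
      inj₁ (<-resp (shift t (y i)) (unshift t (y i)) (+-monoʳ-< (y i - t) -y<t)) , inj₁ y<t
    where
    shift : ∀ t y → -ᶻ y +ᶻ (y - t) ≈ -ᶻ t
    shift t y = ≈.trans (≈.sym (+-assoc _ y _)) (≈.trans (+-congʳ (-‿inverseˡ y)) (+-identityˡ _))
    unshift : ∀ t y → t +ᶻ (y - t) ≈ y
    unshift t y = ≈.trans (+-comm t _) (sub-+ y t)

  -- The outcome is `constant`: a linear curve consisting of representatives does not move. A curve
  -- leaving every bounded box is then impossible.
  module Unbounded (B : Matrix k 1) (b : Vector Carrier k)
                   (U-representative : Eventuallyⁿ 1 (λ u → Representative (affine-map B b u))) where
    U : Vector Carrier 1 → Vector Carrier k
    U = affine-map B b
    identity : Matrix 1 1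
    identity _ _ = 1ℤ
    U-in-G : Eventuallyⁿ 1 (λ u → In (U u))
    U-in-G = ev-map 1 {P = λ u → Representative (U u)} (λ u r → proj₁ r) U-representative
    open Exchange chart maximal B b U-in-G identity using (M; M≢0; N; N≢0; κ; exchange)
    instance
      _ : NonZero M
      _ = M≢0
      _ : NonZero N
      _ = N≢0
    -- Any nonzero direction will do; `e` becomes the shift of the curve parameter by `N δ`.
    d : Vector Carrier 1
    d _ = δ
    e : Vector Carrier 1
    e = + N ⊡ identity ⊙ d

    abstract
      translation : ∃[ g ] Translation (+ M ⊡ κ ⊙ d) g
      translation = translate (+ M ⊡ κ ⊙ d)
    g : Vector Carrier k
    g = proj₁ translation

    scaled-translation : Eventuallyⁿ m (λ x → Mul g (F (+ M ⊡ x)) (F (+ M ⊡ (x ⊞ T ⊙ κ ⊙ d))))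
    scaled-translation = ev-map m (λ x → mul-resp (λ _ → ≈.refl) (λ _ → ≈.refl)
        (affine-map-cong A c (λ i → ≈.trans (+-congˡ (⊙-⊡ T (+ M) (κ ⊙ d) i)) (≈.sym (·-distribˡ (+ M) (x i) _)))))
      (ev-scale m (λ e → mul-resp (λ _ → ≈.refl) (affine-map-cong A c e) (affine-map-cong A c (λ i → +-congʳ (e i)))) M
        (proj₂ translation))

    representative-resp : Respects (λ u → Representative (U (+ M ⊡ u)))
    representative-resp e = def-resp def-Representative (affine-map-cong B b (λ i → ·-cong (+ M) (e i)))

    scaled-representative : Eventuallyⁿ 1 (λ u → Representative (U (+ M ⊡ u)))
    scaled-representative = ev-scale 1 {P = λ u → Representative (U u)}
      (λ e → def-resp def-Representative (affine-map-cong B b e)) M U-representative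

    Row : Vector Carrier 1 → Set ℓ
    Row u = Eventuallyⁿ m (λ x → ∃[ z ] Mul (U (+ M ⊡ (u ⊞ e))) (F (+ M ⊡ x)) z ×
                                        Mul (U (+ M ⊡ u)) (F (+ M ⊡ (x ⊞ T ⊙ κ ⊙ d))) z)

    Rep Rep′ Aligned : Vector Carrier 1 → Set ℓ
    Rep u = Representative (U (+ M ⊡ u))
    Rep′ u = Rep (u ⊞ e)
    Aligned u = Row u × Rep u × Rep′ u

    aligned : Eventuallyⁿ 1 Aligned
    aligned = ev-× 1 {P = Row} {Q = λ u → Rep u × Rep′ u} (exchange d)
      (ev-× 1 {P = Rep} {Q = Rep′} scaled-representative (ev-shift 1 {P = Rep} representative-resp e scaled-representative))

    -- Multiplied by `F (M x)`, both `U (M u)` times `g` and `U (M (u + e))` become the product `z`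
    -- of the exchange; `F (M x)` cancels.
    step-in-lattice : ∀ {u x z} → Mul (U (+ M ⊡ (u ⊞ e))) (F (+ M ⊡ x)) z →
      Mul (U (+ M ⊡ u)) (F (+ M ⊡ (x ⊞ T ⊙ κ ⊙ d))) z → Mul g (F (+ M ⊡ x)) (F (+ M ⊡ (x ⊞ T ⊙ κ ⊙ d))) →
      Mul (U (+ M ⊡ u)) g (U (+ M ⊡ (u ⊞ e)))
    step-in-lattice p q t =
      let s , Ug  = mul-total (mul-left q) (mul-left t)
          sF , sz = mul-total (mul-result Ug) (mul-right p)
          sz′     = mul-resp (λ _ → ≈.refl) (λ _ → ≈.refl) (mul-unique (mul-assoc Ug sz t) q) sz
      in mul-resp (λ _ → ≈.refl) (λ _ → ≈.refl) (mul-cancelʳ sz′ p) Ug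

    aligned-fixed : ∀ u → Aligned u → U (+ M ⊡ u) ≋ U (+ M ⊡ (u ⊞ e))
    aligned-fixed u (row , r , r′) = representative-unique r r′ (g , (_ , proj₂ translation) , in-lattice)
      where
      Column Shift : Vector Carrier m → Set ℓ
      Column x = ∃[ z ] Mul (U (+ M ⊡ (u ⊞ e))) (F (+ M ⊡ x)) z × Mul (U (+ M ⊡ u)) (F (+ M ⊡ (x ⊞ T ⊙ κ ⊙ d))) z
      Shift x = Mul g (F (+ M ⊡ x)) (F (+ M ⊡ (x ⊞ T ⊙ κ ⊙ d)))
      in-lattice : Mul (U (+ M ⊡ u)) g (U (+ M ⊡ (u ⊞ e)))
      in-lattice = let _ , (_ , p , q) , t = ev-witness m {P = λ x → Column x × Shift x}
                                               (ev-× m {P = Column} {Q = Shift} row scaled-translation)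
                   in step-in-lattice {u} p q t

    abstract
      fixed-point : ∃[ u ] U (+ M ⊡ u) ≋ U (+ M ⊡ (u ⊞ e))
      fixed-point = let u , a = ev-witness 1 {P = Aligned} aligned in u , aligned-fixed u a

    -- The representatives at `u` and `u + e` differ by an element of the subgroup, so they
    -- coincide. Hence `B` annihilates `M N δ`, which in a torsion-free group forces it to be zero.
    slope-zero : ∀ r → B r zero ≡ 0ℤ
    slope-zero r = ·δ-injective (B r zero) (torsion-free (+ N) (+-nonzero N) (torsion-free (+ M) (+-nonzero M) vanishes))
      where
      vanishes : + M · + N · B r zero · δ ≈ 0ᶻ
      vanishes = ≈.trans (·-cong (+ M) (·-cong (+ N) (≈.sym (≈.trans (+-identityʳ _)
                   (·-cong (B r zero) (≈.trans (+-identityʳ _) (1·x≈x δ)))))))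
        (≈.trans (≈.sym (≈.trans (⊙-⊡ B (+ M) e r) (·-cong (+ M) (⊙-⊡ B (+ N) (identity ⊙ d) r))))
          (affine-map-fixed B b (+ M ⊡ proj₁ fixed-point) (+ M ⊡ e)
            (≋-trans (proj₂ fixed-point) (affine-map-cong B b (λ i → ·-distribˡ (+ M) (proj₁ fixed-point i) (e i)))) r))

    constant : ∀ u → U u ≋ b
    constant u r = ≈.trans (+-congʳ (≈.trans (+-identityʳ _) (≈.reflexive (≡.cong (_· head u) (slope-zero r))))) (+-identityˡ (b r))

  -- If no box sufficed, every `t` would have a representative outside its box. A linear choice of
  -- such representatives is constant, and a constant lies inside the box once `t` is large.
  representatives-bounded : ∃[ c ] (∀ x → Representative x → Within c x)
  representatives-bounded with em {∃[ c ] (∀ x → Representative x → Within c x)}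
  ... | yes bounded  = bounded
  ... | no unbounded = ⊥-elim (contradictory (linear-solutionⁿ (lower-em em) k 1 def-Large (0ᶻ , λ t _ → large t)))
    where
    large : ∀ t → ∃[ y ] Large y (t ∷ [])
    large t with em {∃[ y ] Large y (t ∷ [])}
    ... | yes p = p
    ... | no none = ⊥-elim (unbounded (t , within))
      where
      within : ∀ x → Representative x → Within t x
      within x r with em {Within t x}
      ... | yes p = p
      ... | no ¬p = ⊥-elim (none (x , r , λ w → ⊥-elim (¬p w)))
    contradictory : ∃[ M ] NonZero M × ∃[ B ] ∃[ b ] Eventuallyⁿ 1 (λ w → Large (affine-map B b w) (+ M ⊡ w)) → Empty
    contradictory (M , M≢0 , B , b , h) =
      let representative = λ (w : Vector Carrier 1) (l : Large (affine-map B b w) (+ M ⊡ w)) → proj₁ l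
          open Unbounded B b (ev-map 1 {P = λ w → Large (affine-map B b w) (+ M ⊡ w)} representative h) using (constant)
          w , (_ , far) , near = ev-witness 1 {P = λ w → Large (affine-map B b w) (+ M ⊡ w) × Within (+ M · head w) b}
            (eventually-× h (eventually-scale {P = λ t → Within t b} M {{M≢0}} (eventually-within b)))
      in ⊥ₚ-elim (far (λ i → let l , u = near i in
           ≤-resp ≈.refl (≈.sym (constant w i)) l , ≤-resp (≈.sym (constant w i)) ≈.refl u))
      where
      ≤-resp : ∀ {x x′ y y′} → x ≈ x′ → y ≈ y′ → x ≤ y → x′ ≤ y′
      ≤-resp e f (inj₁ p) = inj₁ (<-resp e f p)
      ≤-resp e f (inj₂ p) = inj₂ (≈.trans (≈.sym e) (≈.trans p f))

  bounded-quotient : HasBoundedQuotient Z G lattice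
  bounded-quotient = record
    { representatives   = proj₁ def-Representative
    ; representatives⊆G = λ x p → proj₁ (rep⁻ p)
    ; bounded           = let c , h = representatives-bounded in c , λ x p → h x (rep⁻ p)
    ; transversal       = λ g → let r , p , q = representative-exists (proj₂ g) in
        (r , coset-right q) ,
        (rep⁺ p , lattice⁺ (in-coset⁻ g (r , coset-right q) q)) ,
        λ {r′} (p′ , q′) → representative-unique p (rep⁻ p′) (coset-trans (coset-sym q) (in-coset⁺ g r′ (lattice⁻ q′)))
    }
    where
    rep⁺ : ∀ {r} → Representative r → ⟦ proj₁ def-Representative ⟧ r
    rep⁺ {r} = to (proj₂ def-Representative r)
    rep⁻ : ∀ {r} → ⟦ proj₁ def-Representative ⟧ r → Representative r
    rep⁻ {r} = from (proj₂ def-Representative r)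

mainTheorem2 : ∀ {ℓ : Level} → ExcludedMiddle ℓ →
    (Z : PresburgerModel ℓ) → ω-Saturated (PresburgerModel.structure Z) →
    (G : DefinableAbelianGroup Z) →
    Σ (DefinableSubgroup Z G) λ H →
    (Σ ℕ λ n →
    DefinableIsomorphism Z (DefinableSubgroup.definableGroup H) (powerGroup Z n)) ×
    HasBoundedQuotient Z G H
mainTheorem2 em Z _ G with Charts.maximal-chart em Z G
... | n , chart , maximal =
  Lattice.lattice em Z G regular , (n , Lattice.lattice-isomorphism em Z G regular) ,
  Quotient.bounded-quotient em Z G regular maximal
  where
  regular : RegularCharts.Regular em Z G n
  regular = RegularCharts.make-regular em Z G chart maximal
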